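{- Let $\Phi$ be an epimorphism of a finite thick generalized hexagon $\mathcal{S}$ of order $(s,t)$ onto a thin generalized hexagon $\mathcal{G}$ of order $(s',1)$. Then $s'=1$, and exactly two classes of epimorphisms $\Phi$ occur, up to a suitable permutation of the points of $\mathcal{G}$; that is, after suitably naming the points of $\mathcal{G}$, $\Phi$ is as in (a) or (b) below, and both classes occur. (a) The points of $\mathcal{G}$ are $\overline{a},\overline{b},\overline{c},\overline{d},\overline{e},\overline{f}$, with $\overline{a}\sim\overline{b}\sim\overline{c}\sim\overline{d}\sim\overline{e}\sim\overline{f}\sim\overline{a}$; put $\widetilde{X}=\Phi^{ -1}(\overline{x})$ for $\overline{x}\in\{\overline{a},\overline{b},\overline{c},\overline{d},\overline{e},\overline{f}\}$. There is a line $L$ of $\mathcal{S}$ such that $(\widetilde{C},\widetilde{B})$, with $1\le|\widetilde{C}|\le s$ and $1\le|\widetilde{B}|\le s$, is a partition of the set of all points incident with $L$; $\widetilde{D}$ consists of the points not incident with $L$ but collinear with a point of $\widetilde{C}$; $\widetilde{A}$ consists of the points not incident with $L$ but collinear with a point of $\widetilde{B}$; $\widetilde{E}$ consists of the points not in $\widetilde{C}\cup\widetilde{D}$ but collinear with a point of $\widetilde{D}$; and $\widetilde{F}$ consists of the points not in $\widetilde{A}\cup\widetilde{B}$ but collinear with a point of $\widetilde{A}$. Further, $\Phi^{ -1}(\overline{b}\overline{c})=\{L\}$; $\Phi^{ -1}(\overline{c}\overline{d})$ is the set of all lines distinct from $L$ but incident with a point of $\widetilde{C}$; $\Phi^{ -1}(\overline{a}\overline{b})$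 is the set of all lines distinct from $L$ but incident with a point of $\widetilde{B}$; $\Phi^{ -1}(\overline{d}\overline{e})$ is the set of all lines distinct from the lines of $\Phi^{ -1}(\overline{c}\overline{d})$ but incident with a point of $\widetilde{D}$; $\Phi^{ -1}(\overline{f}\overline{a})$ is the set of all lines distinct from the lines of $\Phi^{ -1}(\overline{a}\overline{b})$ but incident with a point of $\widetilde{A}$; and $\Phi^{ -1}(\overline{f}\overline{e})$ is the set of all lines not in $\Phi^{ -1}(\overline{f}\overline{a})$ but incident with a point of $\widetilde{F}$ (that is, the set of all lines not in $\Phi^{ -1}(\overline{e}\overline{d})$ but incident with a point of $\widetilde{E}$). (b) The dual of (a), i.e. $\Phi$, regarded as an epimorphism from the point-line dual of $\mathcal{S}$ onto the point-line dual of $\mathcal{G}$, is as in (a).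
   Context: A point-line geometry is a weak generalized $m$-gon ($m\ge 3$) if any two elements (points or lines) lie in a common ordinary sub $m$-gon and there are no ordinary sub $k$-gons for $2\le k<m$; it is thick (a generalized $m$-gon) if every point is on at least three lines and every line has at least three points, and thin if it is not thick. Generalized hexagons are the case $m=6$. Order $(u,v)$ means that each line is incident with $u+1$ points and each point with $v+1$ lines. A thin generalized hexagon of order $(s',1)$, $s'\ge1$, is a thin weak generalized $6$-gon having that order. $x\sim y$ means that the points $x,y$ are collinear, and $\overline{x}\overline{y}$ denotes the line joining distinct collinear points. A morphism maps points to points, lines to lines, and preserves incidence. An epimorphism is a morphism that is surjective on points and surjective on lines (surjectivity on incident point-line pairs is not required). The point-line dual is obtained by interchanging points and lines. -}

module Defs where

open import Data.Fin.Base using (Fin; toℕ)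
open import Data.List.Base using (_∷_; [])
import Data.List.Membership.Propositional as List
open import Data.List.Relation.Unary.Unique.Propositional using (Unique)
open import Data.Nat.Base using (ℕ; suc; _≤_; _<_)
open import Data.Nat.DivMod using (_mod_)
open import Data.Product.Base using (Σ; ∃; _×_; proj₁)
open import Data.Sum.Base using (_⊎_; inj₁; inj₂)
open import Function.Base using (flip)
open import Function.Bundles using (_↔_)
open import Function.Definitions using (Injective; StrictlySurjective)
open import Level using (0ℓ)
open import Relation.Binary.PropositionalEquality.Core using (_≡_; _≢_)
open import Relation.Nullary.Negation.Core using (¬_)
open import Relation.Unary using (Pred; _∈_; _∉_; _∪_; _⊥_; _≐_)

record Geometry : Set₁ where
  infix 4 _I_ _∼_
  field
    Point : Set
    Line  : Set
    _I_   : Point → Line → Set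

  Element : Set
  Element = Point ⊎ Line

  _∼_ : Point → Point → Set
  x ∼ y = Σ Line λ l → x I l × y I l

  -- For distinct collinear points of a weak generalized polygon this does not
  -- depend on the witness of collinearity, as there are no ordinary 2-gons.
  join : ∀ {x y} → x ∼ y → Line
  join = proj₁

  CollinearWith : Pred Point 0ℓ → Pred Point 0ℓ
  CollinearWith X p = ∃ λ q → q ∈ X × p ∼ q

  Meets : Pred Point 0ℓ → Pred Line 0ℓ
  Meets X m = ∃ λ q → q ∈ X × q I m

open Geometry using (Point; Line; Element)

dual : Geometry → Geometry
dual G = record { Point = Line G ; Line = Point G ; _I_ = flip (Geometry._I_ G) }

-- Cardinalities of predicates count elements, not proofs of membership, since
-- incidence need not be proof-irrelevant.

HasCardinality : {A : Set} → Pred A 0ℓ → ℕ → Set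
HasCardinality {A} P n = Σ (Fin n → A) λ f →
  Injective _≡_ _≡_ f × (∀ i → f i ∈ P) × (∀ x → x ∈ P → ∃ λ i → f i ≡ x)

AtLeast : {A : Set} → ℕ → Pred A 0ℓ → Set
AtLeast {A} n P = Σ (Fin n → A) λ f → Injective _≡_ _≡_ f × (∀ i → f i ∈ P)

IsFinite : Geometry → Set
IsFinite G = (∃ λ n → Point G ↔ Fin n) × (∃ λ n → Line G ↔ Fin n)

next : ∀ {k} → Fin k → Fin k
next {suc k} i = suc (toℕ i) mod suc k

-- Further incidences between the chosen points and lines are not excluded. In
-- a weak generalized m-gon they cannot occur for k = m, because a chord of a
-- k-gon produces a shorter polygon.
record OrdinarySubgon (G : Geometry) (k : ℕ) : Set where
  open Geometry G using (_I_)
  field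
    vertex           : Fin k → Point G
    side             : Fin k → Line G
    vertex-injective : Injective _≡_ _≡_ vertex
    side-injective   : Injective _≡_ _≡_ side
    vertex-I-side    : ∀ i → vertex i I side i
    next-I-side      : ∀ i → vertex (next i) I side i

  Contains : Element G → Set
  Contains (inj₁ x) = ∃ λ i → vertex i ≡ x
  Contains (inj₂ l) = ∃ λ i → side i ≡ l

record IsWeakGeneralizedPolygon (m : ℕ) (G : Geometry) : Set where
  field
    -- the empty geometry is excluded
    somePoint     : Point G
    commonSubgon  : (u v : Element G) → Σ (OrdinarySubgon G m) λ Δ →
                      OrdinarySubgon.Contains Δ u × OrdinarySubgon.Contains Δ v
    noSmallSubgon : ∀ k → 2 ≤ k → k < m → ¬ OrdinarySubgon G k

IsThick : Geometry → Set
IsThick G = (∀ x → AtLeast 3 (λ l → x I l)) × (∀ l → AtLeast 3 (λ x → x I l))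
  where open Geometry G using (_I_)

HasOrder : Geometry → ℕ → ℕ → Set
HasOrder G u v =
  (∀ l → HasCardinality (λ x → x I l) (suc u)) ×
  (∀ x → HasCardinality (λ l → x I l) (suc v))
  where open Geometry G using (_I_)

record IsFiniteThickHexagon (S : Geometry) (s t : ℕ) : Set where
  field
    isFinite : IsFinite S
    isWeak   : IsWeakGeneralizedPolygon 6 S
    isThick  : IsThick S
    hasOrder : HasOrder S s t

record IsThinHexagon (G : Geometry) (s′ : ℕ) : Set where
  field
    isWeak   : IsWeakGeneralizedPolygon 6 G
    isThin   : ¬ IsThick G
    hasOrder : HasOrder G s′ 1
    1≤s′     : 1 ≤ s′

record Epimorphism (S G : Geometry) : Set where
  private
    module S = Geometry S
    module G = Geometry G
  field
    onPoint            : S.Point → G.Point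
    onLine             : S.Line → G.Line
    preserves          : ∀ {x l} → x S.I l → onPoint x G.I onLine l
    onPoint-surjective : StrictlySurjective _≡_ onPoint
    onLine-surjective  : StrictlySurjective _≡_ onLine

dualEpimorphism : ∀ {S G} → Epimorphism S G → Epimorphism (dual S) (dual G)
dualEpimorphism Φ = record
  { onPoint            = onLine
  ; onLine             = onPoint
  ; preserves          = preserves
  ; onPoint-surjective = onLine-surjective
  ; onLine-surjective  = onPoint-surjective
  }
  where open Epimorphism Φ

record HexagonNaming (G : Geometry) : Set where
  open Geometry G using (_∼_)
  field
    a b c d e f : Point G
    distinct    : Unique (a ∷ b ∷ c ∷ d ∷ e ∷ f ∷ [])
    exhaustive  : ∀ x → x List.∈ (a ∷ b ∷ c ∷ d ∷ e ∷ f ∷ [])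
    a∼b : a ∼ b
    b∼c : b ∼ c
    c∼d : c ∼ d
    d∼e : d ∼ e
    e∼f : e ∼ f
    f∼a : f ∼ a

module Fibres {S G : Geometry} (Φ : Epimorphism S G) (naming : HexagonNaming G) where
  open Geometry G using (join)
  open Epimorphism Φ
  open HexagonNaming naming

  pointFibre : Point G → Pred (Point S) 0ℓ
  pointFibre x p = onPoint p ≡ x

  lineFibre : Line G → Pred (Line S) 0ℓ
  lineFibre l m = onLine m ≡ l

  Ã B̃ C̃ D̃ Ẽ F̃ : Pred (Point S) 0ℓ
  Ã = pointFibre a
  B̃ = pointFibre b
  C̃ = pointFibre c
  D̃ = pointFibre d
  Ẽ = pointFibre e
  F̃ = pointFibre f

  ab bc cd de ef fa : Pred (Line S) 0ℓ
  ab = lineFibre (join a∼b)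
  bc = lineFibre (join b∼c)
  cd = lineFibre (join c∼d)
  de = lineFibre (join d∼e)
  ef = lineFibre (join e∼f)
  fa = lineFibre (join f∼a)

record IsClassA {S G : Geometry} (s : ℕ) (Φ : Epimorphism S G) : Set where
  open Geometry S using (_I_; CollinearWith; Meets)
  field
    naming : HexagonNaming G
  open Fibres Φ naming
  field
    L            : Line S
    L-points     : C̃ ∪ B̃ ≐ (λ p → p I L)
    C̃⊥B̃          : C̃ ⊥ B̃
    card-C̃       : ∃ λ n → HasCardinality C̃ n × 1 ≤ n × n ≤ s
    card-B̃       : ∃ λ n → HasCardinality B̃ n × 1 ≤ n × n ≤ s
    D̃-points     : D̃ ≐ (λ p → ¬ (p I L) × p ∈ CollinearWith C̃)
    Ã-points     : Ã ≐ (λ p → ¬ (p I L) × p ∈ CollinearWith B̃)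
    Ẽ-points     : Ẽ ≐ (λ p → p ∉ C̃ ∪ D̃ × p ∈ CollinearWith D̃)
    F̃-points     : F̃ ≐ (λ p → p ∉ Ã ∪ B̃ × p ∈ CollinearWith Ã)
    bc-lines     : bc ≐ (λ m → m ≡ L)
    cd-lines     : cd ≐ (λ m → m ≢ L × m ∈ Meets C̃)
    ab-lines     : ab ≐ (λ m → m ≢ L × m ∈ Meets B̃)
    de-lines     : de ≐ (λ m → m ∉ cd × m ∈ Meets D̃)
    fa-lines     : fa ≐ (λ m → m ∉ ab × m ∈ Meets Ã)
    ef-linesF    : ef ≐ (λ m → m ∉ fa × m ∈ Meets F̃)
    ef-linesE    : ef ≐ (λ m → m ∉ de × m ∈ Meets Ẽ)

-- The lines of the dual of a geometry of order (s , t) have t + 1 points.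
IsClassB : ∀ {S G} → ℕ → Epimorphism S G → Set
IsClassB t Φ = IsClassA t (dualEpimorphism Φ)

{-# OPTIONS --safe #-}

-- If v and w are at distance 5 or 6 in the incidence graph of G, then so are any
-- two elements of S over v and w. Hence the number p v u of neighbours over u of an
-- element over v depends on v and u only, and agrees with the corresponding number
-- at an element opposite v. Put P n = p (c n) (c (n + 1)) − 1 along a cycle c of
-- length 12 in G. From an element over c 0 the fibre over c 5 is reached by
-- p₀ p₁ p₂ p₃ p₄ paths; from one over c 2 distinct paths of length 3 or 5 without
-- backtracking lead to distinct elements of that fibre. Comparing the counts gives
--   P₁ P₈ + P₂ P₉ + P₃ P₁₀ + P₄ P₁₁ + P₅ P₀ ≤ P₀ P₁
-- and its rotations. For s′ ≥ 2 the paths leaving the cycle yield P₅ < P₁ for three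
-- rotations, which is circular. For s′ = 1 the inequalities force a fibre with a
-- single element, a line in class (a) and a point in class (b), and the other
-- fibres are determined by their distance from it. Conversely, the distance from
-- a line L, with a sign given by the point of L passed on the way, folds any thick
-- hexagon onto the ordinary one.
module Submission where

open import Defs
open import Data.Bool.Base using (Bool; true; false; not)
open import Data.Empty using (⊥-elim)
open import Data.Fin.Base as Fin using (Fin; zero; suc; toℕ; fromℕ; inject₁)
open import Data.Fin.Patterns using (0F; 1F; 2F; 3F; 4F; 5F; 6F)
import Data.Fin.Properties as Fin
open import Data.Fin.Relation.Unary.Top using (view; ‵fromℕ; ‵inject₁)
open import Data.List.Base as List using (List; []; _∷_; _++_; length; map; filter; concatMap; tabulate)
open import Data.List.Membership.Propositional using (_∈_; _∉_; find; lose)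
open import Data.List.Membership.Propositional.Properties
  using (∈-map⁺; ∈-map⁻; ∈-filter⁺; ∈-filter⁻; ∈-concatMap⁺; ∈-concatMap⁻; ∈-++⁻; ∈-++⁺ˡ; ∈-++⁺ʳ;
         ∈-tabulate⁺; ∈-tabulate⁻; ∈-lookup)
import Data.List.Properties as List
open import Data.List.Relation.Unary.All as All using (All; []; _∷_)
import Data.List.Relation.Unary.All.Properties as All
open import Data.List.Relation.Unary.AllPairs using ([]; _∷_)
open import Data.List.Relation.Unary.Any as Any using (here; there; _─_)
import Data.List.Relation.Unary.Any.Properties as Any
open import Data.List.Relation.Unary.Unique.Propositional using (Unique)
import Data.List.Relation.Unary.Unique.Propositional.Properties as Unique
import Data.Nat.Properties as ℕ using (_≟_)
open import Data.Nat.Base using (ℕ; zero; suc; pred; _+_; _*_; _∸_; _≤_; _<_; z≤n; s≤s; s≤s⁻¹)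
open import Data.Nat.DivMod using (_%_; _mod_; n%n≡0; m<n⇒m%n≡m)
open import Data.Nat.ListAction using (sum)
open import Data.Nat.Tactic.RingSolver using (solve-∀)
open import Data.Nat.Properties hiding (_≟_)
open import Data.Product.Base using (Σ; ∃; ∃₂; _×_; _,_; proj₁; proj₂)
open import Data.Sum.Base using (_⊎_; inj₁; inj₂; [_,_]′)
import Data.Sum.Properties as Sum using (≡-dec)
open import Data.Sum.Properties using (inj₁-injective; inj₂-injective)
open import Data.Unit.Base using (⊤; tt)
import Data.Unit.Properties as Unit using (_≟_)
open import Data.Vec.Base using (Vec; []; _∷_; lookup)
open import Function.Base using (_∘_; id; case_of_)
open import Function.Construct.Identity using (↔-id)
open import Function.Definitions using (Injective)
open import Relation.Binary.Definitions using (DecidableEquality)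
open import Relation.Binary.PropositionalEquality
  using (_≡_; _≢_; refl; sym; trans; cong; cong₂; subst; subst₂; ≢-sym; module ≡-Reasoning)
open import Relation.Nullary.Decidable using (Dec; yes; no; ¬?; map′; does; toWitness; _×-dec_; dec-true; dec-false; decidable-stable)
open import Relation.Nullary.Negation using (¬_; contradiction)
open import Relation.Unary using (Pred; _≐_) renaming (_∈_ to _∈ᵖ_)
open import Level using (0ℓ)

open Geometry using (Point; Line; Element)

-- The fibre over `c 5` is measured from two distances. Distance 5 forces each of its elements to be
-- reached from the chosen element over `c 0` along the cycle, so the product bounds the whole
-- fibre. From over `c 2`, at distance 3, a walk of length 5 affords exactly one detour: a step out
-- and back to the same label, but not to the same element. The direct walk and the five places for
-- a detour on the cycle give walks of pairwise total length at most 10, below the girth 12; so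
-- their ends differ.
--
-- A detour has one factor for each direction. As `c (n + 1)` and `c (n + 7)` are opposite, p (c (n
-- + 1)) (c n) = 1 + P (n + 7); hence the products P n P (n + 7), with P 12 = P 0. At the two ends
-- of the route the outward factor stays 1 + P. Division by p₂ p₃ p₄ then leaves 1 + P₀ + P₁ on both
-- sides, and this cancels.
--
-- Thickness of S enters as P n + P (n + 6) ≥ 1 wherever `c n` has only two neighbours in G. It
-- turns a vanishing P into a positive one half a turn further on.

private variable
  A B : Set

-- Counting with duplicate-free lists

∈-─⁺ : ∀ {x y : A} {ys} (y∈ys : y ∈ ys) → x ∈ ys → x ≢ y → x ∈ (ys ─ y∈ys)
∈-─⁺ (here refl) (here x≡y) x≢y = contradiction x≡y x≢y
∈-─⁺ (here _)    (there x∈) x≢y = x∈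
∈-─⁺ (there _)   (here x≡)  x≢y = here x≡
∈-─⁺ (there y∈)  (there x∈) x≢y = there (∈-─⁺ y∈ x∈ x≢y)

length-─ : ∀ {y : A} {ys} (y∈ys : y ∈ ys) → length ys ≡ suc (length (ys ─ y∈ys))
length-─ (here _)   = refl
length-─ (there y∈) = cong suc (length-─ y∈)

-- A relation replaces the injective function because the partner of an element is found from a
-- proof of membership; injectivity then does not depend on that proof.
length-≤-by-injection : (R : A → B → Set) →
  (∀ {x x′ y} → R x y → R x′ y → x ≡ x′) →
  ∀ {xs} → Unique xs → (ys : List B) →
  (∀ {x} → x ∈ xs → ∃ λ y → y ∈ ys × R x y) → length xs ≤ length ys
length-≤-by-injection R inj {[]} _ ys _ = z≤n
length-≤-by-injection R inj {x ∷ xs} (x∉xs ∷ xs!) ys image with image (here refl)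
... | y , y∈ys , Rxy = subst (suc (length xs) ≤_) (sym (length-─ y∈ys))
  (s≤s (length-≤-by-injection R inj xs! (ys ─ y∈ys) image′))
  where
  image′ : ∀ {x′} → x′ ∈ xs → ∃ λ y′ → y′ ∈ (ys ─ y∈ys) × R x′ y′
  image′ x′∈xs with image (there x′∈xs)
  ... | y′ , y′∈ys , Rx′y′ = y′ , ∈-─⁺ y∈ys y′∈ys distinct , Rx′y′
    where
    distinct : y′ ≢ y
    distinct refl = All.lookup x∉xs x′∈xs (inj Rxy Rx′y′)

unique-⊆⇒length-≤ : ∀ {xs : List A} → Unique xs → (ys : List A) →
  (∀ {x} → x ∈ xs → x ∈ ys) → length xs ≤ length ys
unique-⊆⇒length-≤ xs! ys xs⊆ys =
  length-≤-by-injection _≡_ (λ p q → trans p (sym q)) xs! ys (λ x∈ → _ , xs⊆ys x∈ , refl)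

unique-concatMap : (g : A → List B) → ∀ {xs} → Unique xs →
  (∀ {x} → x ∈ xs → Unique (g x)) →
  (∀ {x x′ y} → y ∈ g x → y ∈ g x′ → x ≡ x′) →
  Unique (concatMap g xs)
unique-concatMap g [] _ _ = []
unique-concatMap g {x ∷ xs} (x∉xs ∷ xs!) g! disjoint = Unique.++⁺ (g! (here refl))
  (unique-concatMap g xs! (g! ∘ there) disjoint) λ where
    (y∈gx , y∈rest) → case find (∈-concatMap⁻ g {xs = xs} y∈rest) of λ where
      (x′ , x′∈xs , y∈gx′) → All.lookup x∉xs x′∈xs (disjoint y∈gx y∈gx′)

length-concatMap : (g : A → List B) (n : ℕ) → ∀ xs →
  (∀ {x} → x ∈ xs → length (g x) ≡ n) → length (concatMap g xs) ≡ length xs * n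
length-concatMap g n []       _  = refl
length-concatMap g n (x ∷ xs) eq = trans (List.length-++ (g x))
  (cong₂ _+_ (eq (here refl)) (length-concatMap g n xs (eq ∘ there)))

length-concatMap-sum : (g : A → List B) → ∀ xs → length (concatMap g xs) ≡ sum (map (length ∘ g) xs)
length-concatMap-sum g []       = refl
length-concatMap-sum g (x ∷ xs) =
  trans (List.length-++ (g x)) (cong (length (g x) +_) (length-concatMap-sum g xs))

length-filter-≢ : (_≟_ : DecidableEquality A) → ∀ {x xs} → Unique xs → x ∈ xs →
  length (filter (λ y → ¬? (y ≟ x)) xs) ≡ length xs ∸ 1
length-filter-≢ _≟_ {x} {y ∷ xs} (y∉xs ∷ xs!) x∈ with y ≟ x | x∈
... | yes refl | _           = cong length (List.filter-all (λ z → ¬? (z ≟ x))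
                                 (All.map ≢-sym y∉xs))
... | no y≢x   | here refl   = contradiction refl y≢x
... | no y≢x   | there x∈xs  = trans (cong suc (length-filter-≢ _≟_ xs! x∈xs)) (suc-pred′ x∈xs)
  where
  suc-pred′ : ∀ {zs} → x ∈ zs → suc (length zs ∸ 1) ≡ length zs
  suc-pred′ (here _)  = refl
  suc-pred′ (there _) = refl

unique-map⇒injective : (g : A → B) → ∀ {xs} → Unique (map g xs) →
  ∀ {x y} → x ∈ xs → y ∈ xs → g x ≡ g y → x ≡ y
unique-map⇒injective g _ (here refl) (here refl) _ = refl
unique-map⇒injective g (gx∉ ∷ _) (here refl) (there y∈) eq =
  contradiction eq (All.lookup gx∉ (∈-map⁺ g y∈))
unique-map⇒injective g (gy∉ ∷ _) (there x∈) (here refl) eq =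
  contradiction (sym eq) (All.lookup gy∉ (∈-map⁺ g x∈))
unique-map⇒injective g (_ ∷ u) (there x∈) (there y∈) eq = unique-map⇒injective g u x∈ y∈ eq

-- Walks in a graph

-- The vertices of a walk after its starting vertex are listed in its type.
data Walk {V : Set} (_~_ : V → V → Set) : V → V → List V → Set where
  []  : ∀ {x} → Walk _~_ x x []
  _∷_ : ∀ {x y z ys} → x ~ y → Walk _~_ y z ys → Walk _~_ x z (y ∷ ys)

Reduced : {V : Set} → List V → Set
Reduced []              = ⊤
Reduced (_ ∷ [])        = ⊤
Reduced (_ ∷ _ ∷ [])    = ⊤
Reduced (x ∷ y ∷ z ∷ l) = x ≢ z × Reduced (y ∷ z ∷ l)

upTo : {V : Set} {x : V} {ys : List V} → x ∈ ys → List V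
upTo (here {x = y} _)   = y ∷ []
upTo (there {x = y} x∈) = y ∷ upTo x∈

length-upTo : {V : Set} {x : V} {ys : List V} (x∈ : x ∈ ys) → length (upTo x∈) ≤ length ys
length-upTo (here _)   = s≤s z≤n
length-upTo (there x∈) = s≤s (length-upTo x∈)

1≤length-upTo : {V : Set} {x : V} {ys : List V} (x∈ : x ∈ ys) → 1 ≤ length (upTo x∈)
1≤length-upTo (here _)  = s≤s z≤n
1≤length-upTo (there _) = s≤s z≤n

all-upTo : {V : Set} {P : V → Set} {x : V} {ys : List V} (x∈ : x ∈ ys) → All P ys → All P (upTo x∈)
all-upTo (here _)   (p ∷ _)  = p ∷ []
all-upTo (there x∈) (p ∷ ps) = p ∷ all-upTo x∈ ps

unique-upTo : {V : Set} {x : V} {ys : List V} (x∈ : x ∈ ys) → Unique ys → Unique (upTo x∈)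
unique-upTo (here _)   _        = [] ∷ []
unique-upTo (there x∈) (p ∷ ps) = all-upTo x∈ p ∷ unique-upTo x∈ ps

reduced-tail : {V : Set} {x : V} → ∀ ys → Reduced (x ∷ ys) → Reduced ys
reduced-tail []          _       = tt
reduced-tail (_ ∷ [])    _       = tt
reduced-tail (_ ∷ _ ∷ _) (_ , r) = r

reduced-map⁻ : {V W : Set} (f : V → W) → ∀ xs → Reduced (map f xs) → Reduced xs
reduced-map⁻ f []              _       = tt
reduced-map⁻ f (_ ∷ [])        _       = tt
reduced-map⁻ f (_ ∷ _ ∷ [])    _       = tt
reduced-map⁻ f (x ∷ y ∷ z ∷ l) (n , r) = (n ∘ cong f) , reduced-map⁻ f (y ∷ z ∷ l) r

reduced-upTo : {V : Set} {x y : V} {ys : List V} (x∈ : x ∈ ys) → Reduced (y ∷ ys) → Reduced (y ∷ upTo x∈)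
reduced-upTo (here _)           _       = tt
reduced-upTo (there (here _))   (n , _) = n , tt
reduced-upTo (there (there x∈)) (n , r) = n , reduced-upTo (there x∈) r

module _ {V : Set} {_~_ : V → V → Set} where

  walk-upTo : ∀ {x y z ys} (x∈ : x ∈ ys) → Walk _~_ y z ys → Walk _~_ y x (upTo x∈)
  walk-upTo (here refl) (e ∷ _) = e ∷ []
  walk-upTo (there x∈)  (e ∷ w) = e ∷ walk-upTo x∈ w

  end-unique : ∀ {x z z′ ys} → Walk _~_ x z ys → Walk _~_ x z′ ys → z ≡ z′
  end-unique []      []       = refl
  end-unique (_ ∷ w) (_ ∷ w′) = end-unique w w′

  end-∈ : ∀ {x z ys} → Walk _~_ x z ys → ys ≡ [] ⊎ z ∈ ys
  end-∈ []      = inj₁ refl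
  end-∈ (_ ∷ w) with end-∈ w
  ... | inj₂ z∈ = inj₂ (there z∈)
  end-∈ (_ ∷ []) | inj₁ _ = inj₂ (here refl)
  end-∈ (_ ∷ _ ∷ _) | inj₁ ()

  walk-map : {W : Set} {_~′_ : W → W → Set} (f : V → W) →
    (∀ {x y} → x ~ y → f x ~′ f y) →
    ∀ {x z ys} → Walk _~_ x z ys → Walk _~′_ (f x) (f z) (map f ys)
  walk-map f hom []      = []
  walk-map f hom (e ∷ w) = hom e ∷ walk-map f hom w

  ∈-walk : ∀ {P : V → Set} → (∀ {x y} → P x → x ~ y → P y) →
    ∀ {x z ys} → P x → Walk _~_ x z ys → P z
  ∈-walk step p []      = p
  ∈-walk step p (e ∷ w) = ∈-walk step (step p e) w

  walk-snoc : ∀ {x y z ys} → Walk _~_ x y ys → y ~ z → Walk _~_ x z (ys ++ z ∷ [])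
  walk-snoc []      e = e ∷ []
  walk-snoc (d ∷ w) e = d ∷ walk-snoc w e

  -- Non-backtracking closed walks, which need not be cyclically reduced.
  Girth> : ℕ → Set
  Girth> n = ∀ {x ys} → Walk _~_ x x ys → Reduced (x ∷ ys) → 1 ≤ length ys → ¬ length ys ≤ n

  module _ (_≟_ : DecidableEquality V) where
    open import Data.List.Membership.DecPropositional _≟_ using (_∈?_)

    -- Each cancelled backtrack removes two vertices. The margin of 2 matters in `lift-geodesic`: an
    -- image of length at most 6 that backtracks shrinks to length at most 4.
    reduce : ∀ {x z ys} → Walk _~_ x z ys → Reduced (x ∷ ys) ⊎
      (∃ λ ys′ → Walk _~_ x z ys′ × Reduced (x ∷ ys′) × 2 + length ys′ ≤ length ys)
    reduce [] = inj₁ tt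
    reduce {x} (_∷_ {y = y} {ys = ys} e w) with reduce w
    reduce (e ∷ []) | inj₁ r = inj₁ tt
    reduce {x} (_∷_ {y = y} e (_∷_ {y = z} {ys = zs} d w)) | inj₁ r with x ≟ z
    ... | yes refl = inj₂ (zs , w , reduced-tail (x ∷ zs) r , ≤-refl)
    ... | no x≢z   = inj₁ (x≢z , r)
    reduce (e ∷ w) | inj₂ ([] , [] , r , le) = inj₂ (_ , e ∷ [] , tt , s≤s le)
    reduce {x} (_∷_ {y = y} e w) | inj₂ (z ∷ zs , d ∷ w′ , r , le) with x ≟ z
    ... | yes refl = inj₂ (zs , w′ , reduced-tail (x ∷ zs) r , ≤-trans (m≤n+m _ 2) (s≤s le))
    ... | no x≢z   = inj₂ (y ∷ z ∷ zs , e ∷ d ∷ w′ , (x≢z , r) , s≤s le)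

    Cycle≤ : ℕ → Set
    Cycle≤ n = ∃ λ x → ∃ λ ys →
      Walk _~_ x x ys × Reduced (x ∷ ys) × Unique ys × 1 ≤ length ys × length ys ≤ n

    -- If the tail has no repetition but returns to the start, cutting it at this return by `upTo`
    -- leaves a cycle.
    unique⊎cycle : ∀ {x z ys} → Walk _~_ x z ys → Reduced (x ∷ ys) →
      Unique (x ∷ ys) ⊎ Cycle≤ (length ys)
    unique⊎cycle [] r = inj₁ ([] ∷ [])
    unique⊎cycle {x} {ys = ys} (e ∷ w) r with unique⊎cycle w (reduced-tail _ r)
    ... | inj₂ (_ , _ , w′ , r′ , u , 1≤ , ≤n) = inj₂ (_ , _ , w′ , r′ , u , 1≤ , m≤n⇒m≤1+n ≤n)
    ... | inj₁ u with x ∈? ys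
    ...   | no x∉ = inj₁ (All.tabulate (λ { y∈ refl → x∉ y∈ }) ∷ u)
    ...   | yes x∈ = inj₂ (x , upTo x∈ , walk-upTo x∈ (e ∷ w) , reduced-upTo x∈ r
                          , unique-upTo x∈ u , 1≤length-upTo x∈ , length-upTo x∈)

    girth : ∀ n → ¬ Cycle≤ n → Girth> n
    girth n no-cycle w r 1≤ ≤n with unique⊎cycle w r
    ... | inj₂ (_ , _ , w′ , r′ , u , 1≤′ , ≤n′) =
      no-cycle (_ , _ , w′ , r′ , u , 1≤′ , ≤-trans ≤n′ ≤n)
    ... | inj₁ (x∉ ∷ _) with end-∈ w
    ...   | inj₁ refl = contradiction 1≤ λ ()
    ...   | inj₂ x∈   = All.lookup x∉ x∈ refl

  module _ (sym~ : ∀ {x y} → x ~ y → y ~ x) {n : ℕ} (girth : Girth> n) where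

    -- Moving the starting point along the first walk turns the two walks into
    -- a single closed one.
    private
      diverging : ∀ {x z} as bs → Walk _~_ x z as → Walk _~_ x z bs →
        Reduced (x ∷ as) → Reduced (x ∷ bs) → length as + length bs ≤ n →
        (∀ {a as′ b bs′} → as ≡ a ∷ as′ → bs ≡ b ∷ bs′ → a ≢ b) →
        as ≡ [] × bs ≡ []
      diverging [] [] _ _ _ _ _ _ = refl , refl
      diverging [] (b ∷ bs) [] w _ r le _ = ⊥-elim (girth w r (s≤s z≤n) le)
      diverging {x} (a ∷ as) bs (e ∷ v) w r r′ le a≢b
        with diverging as (x ∷ bs) v (sym~ e ∷ w) (reduced-tail _ r) (extend bs r′ a≢b)
          (subst (_≤ n) (sym (+-suc (length as) (length bs))) le) (turn as r)
        where
        extend : ∀ bs → Reduced (x ∷ bs) →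
          (∀ {a′ as′ b bs′} → a ∷ as ≡ a′ ∷ as′ → bs ≡ b ∷ bs′ → a′ ≢ b) →
          Reduced (a ∷ x ∷ bs)
        extend []      _ _ = tt
        extend (b ∷ _) r f = f refl refl , r
        turn : ∀ as → Reduced (x ∷ a ∷ as) →
          ∀ {a′ as′ b bs′} → as ≡ a′ ∷ as′ → x ∷ bs ≡ b ∷ bs′ → a′ ≢ b
        turn (_ ∷ _) (x≢a′ , _) refl refl = x≢a′ ∘ sym
      ... | ()

    module _ (_≟_ : DecidableEquality V) where

      -- Common first steps are stripped off. Walks with different first steps would close up to a
      -- non-backtracking closed walk that the girth forbids.
      reduced-walk-unique : ∀ {x z} as bs → Walk _~_ x z as → Walk _~_ x z bs →
        Reduced (x ∷ as) → Reduced (x ∷ bs) → length as + length bs ≤ n → as ≡ bs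
      reduced-walk-unique [] bs v w r r′ le
        with refl , refl ← diverging [] bs v w r r′ le (λ ()) = refl
      reduced-walk-unique (a ∷ as) [] v w r r′ le
        with () , _ ← diverging (a ∷ as) [] v w r r′ le (λ _ ())
      reduced-walk-unique (a ∷ as) (b ∷ bs) (e ∷ v) (e′ ∷ w) r r′ le with a ≟ b
      ... | yes refl = cong (a ∷_) (reduced-walk-unique as bs v w (reduced-tail _ r) (reduced-tail _ r′)
                         (≤-trans (+-mono-≤ (n≤1+n (length as)) (n≤1+n (length bs))) le))
      ... | no a≢b with () , _ ← diverging (a ∷ as) (b ∷ bs) (e ∷ v) (e′ ∷ w) r r′ le
                                   (λ { refl refl → a≢b })

-- Enumerating and counting labelled paths

record LocallyFinite {V : Set} (_~_ : V → V → Set) : Set where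
  field
    _≟_         : DecidableEquality V
    nbrs        : V → List V
    nbrs-unique : ∀ x → Unique (nbrs x)
    nbrs⁺       : ∀ {x y} → x ~ y → y ∈ nbrs x
    nbrs⁻       : ∀ {x y} → y ∈ nbrs x → x ~ y

-- The labelling is the epimorphism when fibres are counted. With a one-element set of labels the
-- same enumeration lists all non-backtracking walks of a concrete graph.
module LabelledPaths {V A : Set} {_~_ : V → V → Set} (Γ : LocallyFinite _~_)
  (_≟ᴬ_ : DecidableEquality A) (f : V → A) where
  open LocallyFinite Γ

  over : A → V → List V
  over u x = filter (λ y → f y ≟ᴬ u) (nbrs x)

  over⁺ : ∀ {x y u} → x ~ y → f y ≡ u → y ∈ over u x
  over⁺ {u = u} e eq = ∈-filter⁺ (λ y → f y ≟ᴬ u) (nbrs⁺ e) eq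

  over⁻ : ∀ {x y} u → y ∈ over u x → x ~ y × f y ≡ u
  over⁻ u y∈ with ∈-filter⁻ (λ y → f y ≟ᴬ u) y∈
  ... | y∈nbrs , eq = nbrs⁻ y∈nbrs , eq

  over-unique : ∀ u x → Unique (over u x)
  over-unique u x = Unique.filter⁺ (λ y → f y ≟ᴬ u) (nbrs-unique x)

  step : V → V → A → List V
  step w x u = filter (λ y → ¬? (y ≟ w)) (over u x)

  step⁺ : ∀ {w x y u} → x ~ y → f y ≡ u → w ≢ y → y ∈ step w x u
  step⁺ {w} e eq w≢y = ∈-filter⁺ (λ y → ¬? (y ≟ w)) (over⁺ e eq) (≢-sym w≢y)

  step⁻ : ∀ {w x y} u → y ∈ step w x u → x ~ y × f y ≡ u × w ≢ y
  step⁻ {w} u y∈ with ∈-filter⁻ (λ y → ¬? (y ≟ w)) y∈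
  ... | y∈over , y≢w with over⁻ u y∈over
  ...   | e , eq = e , eq , ≢-sym y≢w

  -- The non-backtracking walks from x with the given labels that could be
  -- reached from w; for w = x this imposes nothing on the first step.
  paths : V → V → List A → List (List V)
  paths w x []       = [] ∷ []
  paths w x (u ∷ us) = concatMap (λ y → map (y ∷_) (paths x y us)) (step w x u)

  paths⁺ : ∀ {w x z ys} → Walk _~_ x z ys → Reduced (w ∷ x ∷ ys) → ys ∈ paths w x (map f ys)
  paths⁺ [] r = here refl
  paths⁺ {w} {x} {ys = y ∷ ys} (e ∷ v) (w≢y , r) =
    ∈-concatMap⁺ (λ y → map (y ∷_) (paths x y (map f ys)))
      (lose (step⁺ e refl w≢y) (∈-map⁺ (y ∷_) (paths⁺ v r)))

  paths⁻ : ∀ {w x ys} us → ys ∈ paths w x us →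
    (∃ λ z → Walk _~_ x z ys) × Reduced (w ∷ x ∷ ys) × map f ys ≡ us
  paths⁻ [] (here refl) = (_ , []) , tt , refl
  paths⁻ {w} {x} (u ∷ us) ys∈ with find (∈-concatMap⁻ _ {xs = step w x u} ys∈)
  ... | y , y∈ , ys∈′ with ∈-map⁻ (y ∷_) ys∈′ | step⁻ u y∈
  ...   | zs , zs∈ , refl | e , refl , w≢y with paths⁻ us zs∈
  ...     | (z , v) , r , refl = (z , e ∷ v) , (w≢y , r) , refl

  paths-unique : ∀ w x us → Unique (paths w x us)
  paths-unique w x []       = [] ∷ []
  paths-unique w x (u ∷ us) = unique-concatMap (λ y → map (y ∷_) (paths x y us))
    (Unique.filter⁺ (λ y → ¬? (y ≟ w)) (over-unique u x))
    (λ {y} _ → Unique.map⁺ (λ { refl → refl }) (paths-unique x y us))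
    (λ {y} {y′} l∈ l∈′ → case ∈-map⁻ (y ∷_) l∈ , ∈-map⁻ (y′ ∷_) l∈′ of λ where
      ((_ , _ , refl) , (_ , _ , refl)) → refl)

  module _ {_~ᴬ_ : A → A → Set} (p : A → A → ℕ)
    (length-over : ∀ {x u} → f x ~ᴬ u → length (over u x) ≡ p (f x) u) where

    -- Weight a v us n: a walk of V at v that came from a continues along us
    -- in n ways without backtracking.
    data Weight : A → A → List A → ℕ → Set where
      stop     : ∀ {a v} → Weight a v [] 1
      straight : ∀ {a v u us m n} → v ~ᴬ u → u ≢ a → p v u ≡ m →
                 Weight v u us n → Weight a v (u ∷ us) (m * n)
      fold     : ∀ {a v us m n} → v ~ᴬ a → p v a ≡ suc m →
                 Weight v a us n → Weight a v (a ∷ us) (m * n)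

    private
      length-paths-∷ : ∀ w {x} u us {m n} → length (step w x u) ≡ m →
        (∀ {y} → x ~ y → f y ≡ u → length (paths x y us) ≡ n) →
        length (paths w x (u ∷ us)) ≡ m * n
      length-paths-∷ w {x} u us {n = n} eq rec = trans
        (length-concatMap _ n (step w x u) (λ {y} y∈ → let e , fy≡u , _ = step⁻ u y∈ in
          trans (List.length-map (y ∷_) (paths x y us)) (rec e fy≡u)))
        (cong (_* n) eq)

    -- Forbidding a return to `w` only matters when the next label is that of `w`; then exactly one
    -- of the neighbours counted by `p` is lost, which is the drop from `suc m` to `m` in `fold`.
    length-paths : (∀ {x y} → x ~ y → y ~ x) → ∀ {a v us n} → Weight a v us n →
      ∀ {w x} → f w ≡ a → f x ≡ v → x ~ w → length (paths w x us) ≡ n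
    length-paths sym~ stop _ _ _ = refl
    length-paths sym~ (straight {u = u} {us} v~u u≢a eq W) {w} {x} refl refl _ =
      length-paths-∷ w u us
        (trans (cong length (List.filter-all (λ y → ¬? (y ≟ w))
          (All.tabulate λ y∈ → λ { refl → u≢a (sym (proj₂ (over⁻ u y∈))) })))
          (trans (length-over v~u) eq))
        (λ e fy≡u → length-paths sym~ W refl fy≡u (sym~ e))
    length-paths sym~ (fold {us = us} v~a eq W) {w} {x} refl refl x~w =
      length-paths-∷ w (f w) us
        (trans (length-filter-≢ _≟_ (over-unique (f w) x) (over⁺ x~w refl))
          (cong (_∸ 1) (trans (length-over v~a) eq)))
        (λ e fy≡u → length-paths sym~ W refl fy≡u (sym~ e))

    length-paths-start : (∀ {x y} → x ~ y → y ~ x) → (∀ {x} → ¬ x ~ x) →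
      ∀ {v u us m n x} → f x ≡ v → v ~ᴬ u → p v u ≡ m →
      Weight v u us n → length (paths x x (u ∷ us)) ≡ m * n
    length-paths-start sym~ irr {u = u} {us} {x = x} refl v~u eq W =
      length-paths-∷ x u us
        (trans (cong length (List.filter-all (λ y → ¬? (y ≟ x))
          (All.tabulate λ y∈ → λ { refl → irr (proj₁ (over⁻ u y∈)) })))
          (trans (length-over v~u) eq))
        (λ e fy≡u → length-paths sym~ W refl fy≡u (sym~ e))

-- Ordinary polygons as closed walks in the incidence graph

next-fromℕ : ∀ k → next (fromℕ k) ≡ zero
next-fromℕ k = Fin.toℕ-injective (trans (Fin.toℕ-fromℕ< _)
  (trans (cong (λ n → suc n % suc k) (Fin.toℕ-fromℕ k)) (n%n≡0 (suc k))))

next-inject₁ : ∀ {k} (i : Fin k) → next (inject₁ i) ≡ suc i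
next-inject₁ {k} i = Fin.toℕ-injective (trans (Fin.toℕ-fromℕ< _)
  (trans (cong (λ n → suc n % suc k) (Fin.toℕ-inject₁ i)) (m<n⇒m%n≡m (s≤s (Fin.toℕ<n i)))))

next-injective : ∀ {k} → Injective _≡_ _≡_ (next {k})
next-injective {suc k} {i} {j} eq with view i | view j
... | ‵fromℕ     | ‵fromℕ     = refl
... | ‵fromℕ     | ‵inject₁ j = contradiction
  (trans (sym (next-fromℕ k)) (trans eq (next-inject₁ j))) λ ()
... | ‵inject₁ i | ‵fromℕ     = contradiction
  (trans (sym (next-fromℕ k)) (trans (sym eq) (next-inject₁ i))) λ ()
... | ‵inject₁ i | ‵inject₁ j = cong inject₁
  (Fin.suc-injective (trans (sym (next-inject₁ i)) (trans eq (next-inject₁ j))))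

next-surjective : ∀ {k} (j : Fin k) → ∃ λ i → next i ≡ j
next-surjective {suc k} zero    = fromℕ k , next-fromℕ k
next-surjective {suc k} (suc j) = inject₁ j , next-inject₁ j

dualElement : ∀ {G} → Element G → Element (dual G)
dualElement (inj₁ x) = inj₂ x
dualElement (inj₂ l) = inj₁ l

-- The shift by `next` is forced: consecutive sides `i` and `next i` meet in the vertex `next i`.
dualSubgon : ∀ {G k} → OrdinarySubgon G k → OrdinarySubgon (dual G) k
dualSubgon Δ = record
  { vertex           = side
  ; side             = vertex ∘ next
  ; vertex-injective = side-injective
  ; side-injective   = next-injective ∘ vertex-injective
  ; vertex-I-side    = next-I-side
  ; next-I-side      = vertex-I-side ∘ next
  }
  where
  open OrdinarySubgon Δ

dualSubgon-contains : ∀ {G k} (Δ : OrdinarySubgon G k) u →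
  OrdinarySubgon.Contains Δ u → OrdinarySubgon.Contains (dualSubgon Δ) (dualElement {G} u)
dualSubgon-contains Δ (inj₁ x) (i , refl) with next-surjective i
... | j , refl = j , refl
dualSubgon-contains Δ (inj₂ l) l∈Δ = l∈Δ

dual-isWeak : ∀ {m G} → IsWeakGeneralizedPolygon m G → IsWeakGeneralizedPolygon m (dual G)
dual-isWeak {m} {G} weak = record
  { somePoint     = let Δ , (i , _) , _ = commonSubgon (inj₁ somePoint) (inj₁ somePoint) in
                    OrdinarySubgon.side Δ i
  ; commonSubgon  = λ u v → let Δ , u∈Δ , v∈Δ = commonSubgon (dualElement {dual G} u) (dualElement {dual G} v) in
                    dualSubgon Δ , contains Δ u u∈Δ , contains Δ v v∈Δ
  ; noSmallSubgon = λ k 2≤k k<m Δ → noSmallSubgon k 2≤k k<m (dualSubgon Δ)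
  }
  where
  open IsWeakGeneralizedPolygon weak
  contains : ∀ {k} (Δ : OrdinarySubgon G k) u → OrdinarySubgon.Contains Δ (dualElement {dual G} u) →
    OrdinarySubgon.Contains (dualSubgon Δ) u
  contains Δ (inj₁ l) = dualSubgon-contains Δ (inj₂ l)
  contains Δ (inj₂ x) = dualSubgon-contains Δ (inj₁ x)

module _ (G : Geometry) where
  open Geometry G using (_I_)

  data Adj : Element G → Element G → Set where
    up   : ∀ {x l} → x I l → Adj (inj₁ x) (inj₂ l)
    down : ∀ {x l} → x I l → Adj (inj₂ l) (inj₁ x)

module _ {G : Geometry} where
  open Geometry G using (_I_)

  adj-sym : ∀ {u v} → Adj G u v → Adj G v u
  adj-sym (up e)   = down e
  adj-sym (down e) = up e

  adj-irreflexive : ∀ {u} → ¬ Adj G u u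
  adj-irreflexive ()

  private
    interleave : ∀ {n} → Vec (Point G) n → Vec (Line G) n → List (Element G)
    interleave []       []       = []
    interleave (p ∷ ps) (l ∷ ls) = inj₁ p ∷ inj₂ l ∷ interleave ps ls

    length-interleave : ∀ {n} (ps : Vec (Point G) n) ls → length (interleave ps ls) ≡ n * 2
    length-interleave []       []       = refl
    length-interleave (p ∷ ps) (l ∷ ls) = cong (2 +_) (length-interleave ps ls)

    point-∈ : ∀ {n} (ps : Vec (Point G) n) ls i → inj₁ (lookup ps i) ∈ interleave ps ls
    point-∈ (p ∷ ps) (l ∷ ls) zero    = here refl
    point-∈ (p ∷ ps) (l ∷ ls) (suc i) = there (there (point-∈ ps ls i))

    line-∈ : ∀ {n} (ps : Vec (Point G) n) ls i → inj₂ (lookup ls i) ∈ interleave ps ls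
    line-∈ (p ∷ ps) (l ∷ ls) zero    = there (here refl)
    line-∈ (p ∷ ps) (l ∷ ls) (suc i) = there (there (line-∈ ps ls i))

    points-injective : ∀ {n} (ps : Vec (Point G) n) ls → Unique (interleave ps ls) →
      Injective _≡_ _≡_ (lookup ps)
    points-injective (p ∷ ps) (l ∷ ls) _ {zero} {zero} _ = refl
    points-injective (p ∷ ps) (l ∷ ls) ((_ ∷ p∉) ∷ _) {zero} {suc j} eq =
      contradiction (cong inj₁ eq) (All.lookup p∉ (point-∈ ps ls j))
    points-injective (p ∷ ps) (l ∷ ls) ((_ ∷ p∉) ∷ _) {suc i} {zero} eq =
      contradiction (cong inj₁ (sym eq)) (All.lookup p∉ (point-∈ ps ls i))
    points-injective (p ∷ ps) (l ∷ ls) (_ ∷ _ ∷ u) {suc i} {suc j} eq =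
      cong suc (points-injective ps ls u eq)

    lines-injective : ∀ {n} (ps : Vec (Point G) n) ls → Unique (interleave ps ls) →
      Injective _≡_ _≡_ (lookup ls)
    lines-injective (p ∷ ps) (l ∷ ls) _ {zero} {zero} _ = refl
    lines-injective (p ∷ ps) (l ∷ ls) (_ ∷ l∉ ∷ _) {zero} {suc j} eq =
      contradiction (cong inj₂ eq) (All.lookup l∉ (line-∈ ps ls j))
    lines-injective (p ∷ ps) (l ∷ ls) (_ ∷ l∉ ∷ _) {suc i} {zero} eq =
      contradiction (cong inj₂ (sym eq)) (All.lookup l∉ (line-∈ ps ls i))
    lines-injective (p ∷ ps) (l ∷ ls) (_ ∷ _ ∷ u) {suc i} {suc j} eq =
      cong suc (lines-injective ps ls u eq)

    ∈-point⁻ : ∀ {n x} (ps : Vec (Point G) n) ls → inj₁ x ∈ interleave ps ls → ∃ λ i → lookup ps i ≡ x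
    ∈-point⁻ [] [] ()
    ∈-point⁻ (p ∷ ps) (l ∷ ls) (here refl) = zero , refl
    ∈-point⁻ (p ∷ ps) (l ∷ ls) (there (there x∈)) = let i , eq = ∈-point⁻ ps ls x∈ in suc i , eq

    ∈-line⁻ : ∀ {n m} (ps : Vec (Point G) n) ls → inj₂ m ∈ interleave ps ls → ∃ λ i → lookup ls i ≡ m
    ∈-line⁻ [] [] ()
    ∈-line⁻ (p ∷ ps) (l ∷ ls) (there (here refl)) = zero , refl
    ∈-line⁻ (p ∷ ps) (l ∷ ls) (there (there m∈)) = let i , eq = ∈-line⁻ ps ls m∈ in suc i , eq

    record Zigzag (p : Point G) (m : Line G) (vs : List (Element G)) : Set where
      field
        {k}      : ℕ
        ps       : Vec (Point G) (suc k)
        ls       : Vec (Line G) (suc k)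
        vs≡      : vs ≡ interleave ps ls
        first    : lookup ps zero ≡ p
        last     : lookup ls (fromℕ k) ≡ m
        p-I-l    : ∀ i → lookup ps i I lookup ls i
        next-I-l : ∀ (i : Fin k) → lookup ps (suc i) I lookup ls (inject₁ i)

    zigzag : ∀ {p m vs} → Walk (Adj G) (inj₁ p) (inj₂ m) vs → Zigzag p m (inj₁ p ∷ vs)
    zigzag (up {p} {m} e ∷ []) = record
      { ps = p ∷ [] ; ls = m ∷ [] ; vs≡ = refl ; first = refl ; last = refl
      ; p-I-l = λ { zero → e } ; next-I-l = λ () }
    zigzag (up {p} {l} e ∷ down {p′} d ∷ w) = record
      { ps = p ∷ ps ; ls = l ∷ ls ; vs≡ = cong (λ vs → inj₁ p ∷ inj₂ l ∷ vs) vs≡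
      ; first = refl ; last = last
      ; p-I-l = λ { zero → e ; (suc i) → p-I-l i }
      ; next-I-l = λ { zero → subst (_I l) (sym first) d ; (suc i) → next-I-l i } }
      where
      open Zigzag (zigzag w)

    PolygonOn : List (Element G) → Set
    PolygonOn ys = ∃ λ k → Σ (OrdinarySubgon G k) λ Δ → length ys ≡ k * 2 ×
      (∀ {v} → v ∈ ys → OrdinarySubgon.Contains Δ v)

    zigzag⇒polygon : ∀ {p m ys} → Walk (Adj G) (inj₁ p) (inj₂ m) ys → p I m →
      Unique (inj₁ p ∷ ys) → PolygonOn (inj₁ p ∷ ys)
    zigzag⇒polygon {p} {m} {ys} w pIm u = _ , Δ , trans (cong length vs≡) (length-interleave ps ls) , contains
      where
      open Zigzag (zigzag w)
      u′ : Unique (interleave ps ls)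
      u′ = subst Unique vs≡ u
      closing : ∀ i → lookup ps (next i) I lookup ls i
      closing i with view i
      ... | ‵fromℕ     = subst₂ _I_ (trans (sym first) (cong (lookup ps) (sym (next-fromℕ k)))) (sym last) pIm
      ... | ‵inject₁ j = subst (λ i → lookup ps i I lookup ls (inject₁ j)) (sym (next-inject₁ j)) (next-I-l j)
      Δ : OrdinarySubgon G (suc k)
      Δ = record
        { vertex = lookup ps ; side = lookup ls
        ; vertex-injective = points-injective ps ls u′
        ; side-injective = lines-injective ps ls u′
        ; vertex-I-side = p-I-l ; next-I-side = closing }
      contains : ∀ {v} → v ∈ inj₁ p ∷ ys → OrdinarySubgon.Contains Δ v
      contains {inj₁ x} v∈ = ∈-point⁻ ps ls (subst (_ ∈_) vs≡ v∈)
      contains {inj₂ l} v∈ = ∈-line⁻ ps ls (subst (_ ∈_) vs≡ v∈)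

  -- Based at a line, the list pairs each point with the line after it. Based at a point, it starts
  -- with a line, which is moved to the end to restore this pairing.
  closed-walk⇒polygon : ∀ {x ys} → Walk (Adj G) x x ys → 1 ≤ length ys → Unique ys → PolygonOn ys
  closed-walk⇒polygon (down e ∷ w) _ u = zigzag⇒polygon w e u
  closed-walk⇒polygon (up {l = l} e ∷ _∷_ {ys = ys} (down {x = p} {.l} d) w) _ (l∉ ∷ u) =
    let k , Δ , eq , contains = zigzag⇒polygon (walk-snoc w (up e)) d
          (Unique.++⁺ u ([] ∷ []) λ { (l∈ , here refl) → All.lookup l∉ l∈ refl })
    in k , Δ
      , trans (cong suc (trans (+-comm 1 (length ys)) (sym (List.length-++ ys)))) eq
      , λ { {v} (here refl) → contains (∈-++⁺ʳ (inj₁ p ∷ ys) {v ∷ []} (here refl))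
          ; (there v∈)      → contains (∈-++⁺ˡ v∈) }

-- Weak generalized hexagons

-- Indexing by all natural numbers makes a rotation an addition and a reflection a multiplication by
-- 11. Distinctness of the twelve elements is not recorded: it follows from `turn` and the girth,
-- see `cycle-≢`.
record IsCycle (G : Geometry) (c : ℕ → Element G) : Set where
  field
    edge   : ∀ n → Adj G (c n) (c (suc n))
    turn   : ∀ n → c n ≢ c (2 + n)
    period : ∀ n → c (12 + n) ≡ c n

  period* : ∀ k n → c (k * 12 + n) ≡ c n
  period* zero    n = refl
  period* (suc k) n = trans (period (k * 12 + n)) (period* k n)

module _ {G : Geometry} where

  shift : ∀ {c} → IsCycle G c → ∀ k → IsCycle G (λ n → c (n + k))
  shift C k = record
    { edge = λ n → edge (n + k) ; turn = λ n → turn (n + k) ; period = λ n → period (n + k) }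
    where
    open IsCycle C

  -- 11 is −1 modulo the period.
  reverse : ∀ {c} → IsCycle G c → IsCycle G (λ n → c (n * 11))
  reverse {c} C = record
    { edge   = λ n → adj-sym (subst (Adj G (c (11 + n * 11))) (period (n * 11)) (edge (11 + n * 11)))
    ; turn   = λ n eq → turn (22 + n * 11)
                 (trans (sym eq) (sym (period* 2 (n * 11))))
    ; period = λ n → period* 11 (n * 11)
    }
    where
    open IsCycle C

  within-half : ∀ {c} → IsCycle G c → ∀ n → ∃ λ k → k ≤ 6 × (c n ≡ c k ⊎ c n ≡ c (k * 11))
  within-half C 0  = 0 , z≤n , inj₁ refl
  within-half C 1  = 1 , s≤s z≤n , inj₁ refl
  within-half C 2  = 2 , s≤s (s≤s z≤n) , inj₁ refl
  within-half C 3  = 3 , s≤s (s≤s (s≤s z≤n)) , inj₁ refl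
  within-half C 4  = 4 , s≤s (s≤s (s≤s (s≤s z≤n))) , inj₁ refl
  within-half C 5  = 5 , n≤1+n 5 , inj₁ refl
  within-half C 6  = 6 , ≤-refl , inj₁ refl
  within-half C 7  = 5 , n≤1+n 5 , inj₂ (sym (IsCycle.period* C 4 7))
  within-half C 8  = 4 , s≤s (s≤s (s≤s (s≤s z≤n))) , inj₂ (sym (IsCycle.period* C 3 8))
  within-half C 9  = 3 , s≤s (s≤s (s≤s z≤n)) , inj₂ (sym (IsCycle.period* C 2 9))
  within-half C 10 = 2 , s≤s (s≤s z≤n) , inj₂ (sym (IsCycle.period* C 1 10))
  within-half C 11 = 1 , s≤s z≤n , inj₂ refl
  within-half C (suc (suc (suc (suc (suc (suc (suc (suc (suc (suc (suc (suc n))))))))))))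
    with within-half C n
  ... | k , k≤6 , inj₁ eq = k , k≤6 , inj₁ (trans (IsCycle.period C n) eq)
  ... | k , k≤6 , inj₂ eq = k , k≤6 , inj₂ (trans (IsCycle.period C n) eq)

  segment : (ℕ → Element G) → ℕ → ℕ → List (Element G)
  segment c i zero    = []
  segment c i (suc n) = c (suc i) ∷ segment c (suc i) n

  length-segment : ∀ c i n → length (segment c i n) ≡ n
  length-segment c i zero    = refl
  length-segment c i (suc n) = cong suc (length-segment c (suc i) n)

  module _ {c} (C : IsCycle G c) where
    open IsCycle C

    segment-walk : ∀ i n → Walk (Adj G) (c i) (c (n + i)) (segment c i n)
    segment-walk i zero    = []
    segment-walk i (suc n) = edge i ∷ subst (λ m → Walk (Adj G) (c (suc i)) (c m) (segment c (suc i) n))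
      (+-suc n i) (segment-walk (suc i) n)

    segment-reduced : ∀ i n → Reduced (c i ∷ segment c i n)
    segment-reduced i zero          = tt
    segment-reduced i (suc zero)    = tt
    segment-reduced i (suc (suc n)) = turn i , segment-reduced (suc i) (suc n)

module _ {G : Geometry} where

  private
    digon : ∀ {x ys} → Walk (Adj G) x x ys → Reduced (x ∷ ys) → length ys ≢ 2
    digon (_ ∷ _ ∷ []) (x≢x , _) _ = x≢x refl

  -- The assumption on subgons starts at `k = 2`; a closed walk of length 2 is excluded by being
  -- reduced.
  no-small-subgon⇒no-cycle : (_≟_ : DecidableEquality (Element G)) →
    (∀ k → 2 ≤ k → k < 6 → ¬ OrdinarySubgon G k) → ¬ Cycle≤ {_~_ = Adj G} _≟_ 11
  no-small-subgon⇒no-cycle _≟_ no-small (x , ys , w , r , u , 1≤ , ≤11) =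
    case closed-walk⇒polygon w 1≤ u of λ where
      (0 , _ , eq , _) → contradiction (subst (1 ≤_) eq 1≤) λ ()
      (1 , _ , eq , _) → digon w r eq
      (suc (suc k) , Δ , eq , _) → no-small (suc (suc k)) (s≤s (s≤s z≤n))
        (*-cancelʳ-< 2 (suc (suc k)) 6 (s≤s (subst (_≤ 11) eq ≤11))) Δ

  no-small-subgon⇒girth : (_≟_ : DecidableEquality (Element G)) →
    (∀ k → 2 ≤ k → k < 6 → ¬ OrdinarySubgon G k) → Girth> {_~_ = Adj G} 11
  no-small-subgon⇒girth _≟_ no-small = girth _≟_ 11 (no-small-subgon⇒no-cycle _≟_ no-small)

module _ {G : Geometry} (weak : IsWeakGeneralizedPolygon 6 G) where
  open IsWeakGeneralizedPolygon weak
  open Geometry G using (_I_)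

  -- Two elements of one kind are vertices or sides of a common hexagon, where equality amounts to
  -- equality of indices in `Fin 6`.
  _≟ₑ_ : DecidableEquality (Element G)
  inj₁ x ≟ₑ inj₁ y with commonSubgon (inj₁ x) (inj₁ y)
  ... | Δ , (i , refl) , (j , refl) = map′ (cong (inj₁ ∘ vertex)) (vertex-injective ∘ inj₁-injective) (i Fin.≟ j)
    where
    open OrdinarySubgon Δ
  inj₂ l ≟ₑ inj₂ m with commonSubgon (inj₂ l) (inj₂ m)
  ... | Δ , (i , refl) , (j , refl) = map′ (cong (inj₂ ∘ side)) (side-injective ∘ inj₂-injective) (i Fin.≟ j)
    where
    open OrdinarySubgon Δ
  inj₁ _ ≟ₑ inj₂ _ = no λ ()
  inj₂ _ ≟ₑ inj₁ _ = no λ ()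

  girth>11 : Girth> {_~_ = Adj G} 11
  girth>11 = no-small-subgon⇒girth _≟ₑ_ noSmallSubgon

  walk-unique : ∀ {x z} as bs → Walk (Adj G) x z as → Walk (Adj G) x z bs →
    Reduced (x ∷ as) → Reduced (x ∷ bs) → length as + length bs ≤ 11 → as ≡ bs
  walk-unique = reduced-walk-unique adj-sym girth>11 _≟ₑ_

  private
    module Around (Δ : OrdinarySubgon G 6) where
      open OrdinarySubgon Δ

      nth : ℕ → Fin 6
      nth zero    = zero
      nth (suc n) = next (nth n)

      next≢ : ∀ (i : Fin 6) → i ≢ next i
      next≢ 0F ()
      next≢ 1F ()
      next≢ 2F ()
      next≢ 3F ()
      next≢ 4F ()
      next≢ 5F ()

      next⁶ : ∀ (i : Fin 6) → next (next (next (next (next (next i))))) ≡ i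
      next⁶ 0F = refl
      next⁶ 1F = refl
      next⁶ 2F = refl
      next⁶ 3F = refl
      next⁶ 4F = refl
      next⁶ 5F = refl

      nth-surjective : ∀ i → ∃ λ n → nth n ≡ i
      nth-surjective 0F = 0 , refl
      nth-surjective 1F = 1 , refl
      nth-surjective 2F = 2 , refl
      nth-surjective 3F = 3 , refl
      nth-surjective 4F = 4 , refl
      nth-surjective 5F = 5 , refl

      element : ℕ → ℕ → Element G
      element k 0             = inj₁ (vertex (nth k))
      element k 1             = inj₂ (side (nth k))
      element k (suc (suc n)) = element (suc k) n

      around : ℕ → Element G
      around = element 0

      isCycle : ∀ k → IsCycle G (element k)
      isCycle k = record { edge = edge k ; turn = turn k ; period = period k }
        where
        edge : ∀ k n → Adj G (element k n) (element k (suc n))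
        edge k 0             = up (vertex-I-side (nth k))
        edge k 1             = down (next-I-side (nth k))
        edge k (suc (suc n)) = edge (suc k) n
        turn : ∀ k n → element k n ≢ element k (2 + n)
        turn k 0 eq          = next≢ (nth k) (vertex-injective (inj₁-injective eq))
        turn k 1 eq          = next≢ (nth k) (side-injective (inj₂-injective eq))
        turn k (suc (suc n)) = turn (suc k) n
        period : ∀ k n → element (6 + k) n ≡ element k n
        period k 0             = cong (inj₁ ∘ vertex) (next⁶ (nth k))
        period k 1             = cong (inj₂ ∘ side) (next⁶ (nth k))
        period k (suc (suc n)) = period (suc k) n

      advance : ∀ n k j → ∃ λ m → element k m ≡ element (n + k) j
      advance zero    k j = j , refl
      advance (suc n) k j with m , eq ← advance n (suc k) j =
        2 + m , trans eq (cong (λ i → element i j) (+-suc n k))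

      contains⇒around : ∀ u → Contains u → ∃ λ n → around n ≡ u
      contains⇒around (inj₁ x) (i , refl) with n , refl ← nth-surjective i =
        let m , eq = advance n 0 0 in m , trans eq (cong (λ k → element k 0) (+-identityʳ n))
      contains⇒around (inj₂ l) (i , refl) with n , refl ← nth-surjective i =
        let m , eq = advance n 0 1 in m , trans eq (cong (λ k → element k 1) (+-identityʳ n))

  cycle-through : ∀ u v → ∃ λ c → IsCycle G c × c 0 ≡ u × (∃ λ k → k ≤ 6 × c k ≡ v)
  cycle-through u v with commonSubgon u v
  ... | Δ , u∈Δ , v∈Δ with Around.contains⇒around Δ u u∈Δ | Around.contains⇒around Δ v v∈Δ
  ... | i , refl | j , refl = from-shifted (within-half C j′)
    where
    open Around Δ
    C = shift (isCycle 0) i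
    -- This is `j − i` modulo 12, the position of `v` on the cycle rotated to begin at `u`.
    j′ = j + i * 11
    v≡ : around (j′ + i) ≡ around j
    v≡ = trans (cong around (begin
        j + i * 11 + i   ≡⟨ +-assoc j (i * 11) i ⟩
        j + (i * 11 + i) ≡⟨ cong (j +_) (trans (+-comm (i * 11) i) (sym (*-suc i 11))) ⟩
        j + i * 12       ≡⟨ +-comm j (i * 12) ⟩
        i * 12 + j       ∎))
      (IsCycle.period* (isCycle 0) i j)
      where
      open ≡-Reasoning
    from-shifted : (∃ λ k → k ≤ 6 × (around (j′ + i) ≡ around (k + i) ⊎ around (j′ + i) ≡ around (k * 11 + i))) →
      ∃ λ c → IsCycle G c × c 0 ≡ around i × (∃ λ k → k ≤ 6 × c k ≡ around j)
    from-shifted (k , k≤6 , inj₁ eq) = _ , C , refl , k , k≤6 , trans (sym eq) v≡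
    from-shifted (k , k≤6 , inj₂ eq) = _ , reverse C , refl , k , k≤6 , trans (sym eq) v≡

  cycle-from : ∀ u → ∃ λ c → IsCycle G c × c 0 ≡ u
  cycle-from u = let c , C , eq , _ = cycle-through u u in c , C , eq

  connect : ∀ u v → ∃ λ ys → Walk (Adj G) u v ys × Reduced (u ∷ ys) × length ys ≤ 6
  connect u v with cycle-through u v
  ... | c , C , refl , k , k≤6 , refl = segment c 0 k
    , subst (λ n → Walk (Adj G) (c 0) (c n) (segment c 0 k)) (+-identityʳ k) (segment-walk C 0 k)
    , segment-reduced C 0 k
    , subst (_≤ 6) (sym (length-segment c 0 k)) k≤6

module _ {G : Geometry} {u v : ℕ} (order : HasOrder G u v) (_≟_ : DecidableEquality (Element G)) where

  locallyFinite : LocallyFinite (Adj G)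
  locallyFinite = record
    { _≟_ = _≟_ ; nbrs = nbrs ; nbrs-unique = nbrs-unique ; nbrs⁺ = nbrs⁺ ; nbrs⁻ = nbrs⁻ }
    where
    nbrs : Element G → List (Element G)
    nbrs (inj₁ x) = tabulate (inj₂ ∘ proj₁ (proj₂ order x))
    nbrs (inj₂ l) = tabulate (inj₁ ∘ proj₁ (proj₁ order l))

    nbrs-unique : ∀ x → Unique (nbrs x)
    nbrs-unique (inj₁ x) = Unique.tabulate⁺ (proj₁ (proj₂ (proj₂ order x)) ∘ inj₂-injective)
    nbrs-unique (inj₂ l) = Unique.tabulate⁺ (proj₁ (proj₂ (proj₁ order l)) ∘ inj₁-injective)

    nbrs⁺ : ∀ {x y} → Adj G x y → y ∈ nbrs x
    nbrs⁺ (up {x} {l} e) with proj₂ (proj₂ (proj₂ (proj₂ order x))) l e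
    ... | i , refl = ∈-tabulate⁺ {f = inj₂ ∘ proj₁ (proj₂ order x)} i
    nbrs⁺ (down {x} {l} e) with proj₂ (proj₂ (proj₂ (proj₁ order l))) x e
    ... | i , refl = ∈-tabulate⁺ {f = inj₁ ∘ proj₁ (proj₁ order l)} i

    nbrs⁻ : ∀ {x y} → y ∈ nbrs x → Adj G x y
    nbrs⁻ {inj₁ x} y∈ with i , refl ← ∈-tabulate⁻ {f = inj₂ ∘ proj₁ (proj₂ order x)} y∈ =
      up (proj₁ (proj₂ (proj₂ (proj₂ order x))) i)
    nbrs⁻ {inj₂ l} y∈ with i , refl ← ∈-tabulate⁻ {f = inj₁ ∘ proj₁ (proj₁ order l)} y∈ =
      down (proj₁ (proj₂ (proj₂ (proj₁ order l))) i)

-- Fibres of an epimorphism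

two-nbrs : ∀ {G u v} → HasOrder G u v → 1 ≤ u → 1 ≤ v → ∀ x →
  ∃₂ λ y z → Adj G x y × Adj G x z × y ≢ z
two-nbrs {v = suc v} (_ , lines) _ _ (inj₁ x) = let h , inj , inc , _ = lines x in
  inj₂ (h zero) , inj₂ (h (suc zero)) , up (inc zero) , up (inc (suc zero)) ,
  λ eq → case inj (inj₂-injective eq) of λ ()
two-nbrs {u = suc u} (points , _) _ _ (inj₂ l) = let h , inj , inc , _ = points l in
  inj₁ (h zero) , inj₁ (h (suc zero)) , down (inc zero) , down (inc (suc zero)) ,
  λ eq → case inj (inj₁-injective eq) of λ ()

another-nbr : ∀ {G u v} → DecidableEquality (Element G) → HasOrder G u v → 1 ≤ u → 1 ≤ v →
  ∀ {x} w → Adj G w x → ∃ λ y → Adj G x y × w ≢ y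
another-nbr _≟_ order 1≤u 1≤v {x} w _ with two-nbrs order 1≤u 1≤v x
... | y , z , e , d , y≢z with w ≟ y
...   | no w≢y   = y , e , w≢y
...   | yes refl = z , d , y≢z

module Cover {S G : Geometry} {s t s′ t′ : ℕ}
  (weakS : IsWeakGeneralizedPolygon 6 S) (weakG : IsWeakGeneralizedPolygon 6 G)
  (orderS : HasOrder S s t) (orderG : HasOrder G s′ t′) (1≤s′ : 1 ≤ s′) (1≤t′ : 1 ≤ t′)
  (Φ : Epimorphism S G) where
  open Epimorphism Φ

  f : Element S → Element G
  f (inj₁ x) = inj₁ (onPoint x)
  f (inj₂ l) = inj₂ (onLine l)

  hom : ∀ {x y} → Adj S x y → Adj G (f x) (f y)
  hom (up e)   = up (preserves e)
  hom (down e) = down (preserves e)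

  lift : Element G → Element S
  lift (inj₁ x) = inj₁ (proj₁ (onPoint-surjective x))
  lift (inj₂ l) = inj₂ (proj₁ (onLine-surjective l))

  f-lift : ∀ v → f (lift v) ≡ v
  f-lift (inj₁ x) = cong inj₁ (proj₂ (onPoint-surjective x))
  f-lift (inj₂ l) = cong inj₂ (proj₂ (onLine-surjective l))

  open LabelledPaths (locallyFinite orderS (_≟ₑ_ weakS)) (_≟ₑ_ weakG) f public

  another : ∀ {x} w → Adj G w x → ∃ λ y → Adj G x y × w ≢ y
  another = another-nbr (_≟ₑ_ weakG) orderG 1≤s′ 1≤t′

  -- Elements over the ends of a geodesic of length 5 are themselves at
  -- distance 5, as a shorter walk between them would map to a shorter one.
  lift-geodesic : ∀ {v w vs x z} → Walk (Adj G) v w vs → Reduced (v ∷ vs) → length vs ≡ 5 →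
    f x ≡ v → f z ≡ w → ∃ λ zs → Walk (Adj S) x z zs × Reduced (x ∷ zs) × map f zs ≡ vs
  lift-geodesic {vs = vs} {x} {z} walk r len refl refl with connect weakS x z
  ... | zs , w , rz , ≤6 with reduce (_≟ₑ_ weakG) (walk-map f hom w)
  ...   | inj₁ r′ = zs , w , rz , walk-unique weakG _ vs (walk-map f hom w) walk r′ r
          (subst₂ (λ a b → a + b ≤ 11) (sym (List.length-map f zs)) (sym len) (+-monoˡ-≤ 5 ≤6))
  ...   | inj₂ (us , w′ , r′ , us+2≤) = contradiction (≤-trans us+2≤ zs≤) (<⇒≱ us+2>6)
    where
    zs≤ : length (map f zs) ≤ 6
    zs≤ = subst (_≤ 6) (sym (List.length-map f zs)) ≤6
    us≡vs : us ≡ vs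
    us≡vs = walk-unique weakG us vs w′ walk r′ r
      (subst (λ b → length us + b ≤ 11) (sym len) (+-monoˡ-≤ 5 (≤-trans (m≤n+m _ 2) (≤-trans us+2≤ zs≤))))
    us+2>6 : 6 < 2 + length us
    us+2>6 = subst (λ n → 6 < 2 + n) (sym (trans (cong length us≡vs) len)) ≤-refl

  extend : ∀ {v u} → Adj G v u → ∀ n → ∃ λ w → ∃ λ vs →
    Walk (Adj G) v w (u ∷ vs) × Reduced (v ∷ u ∷ vs) × length vs ≡ n
  extend {u = u} e zero = u , [] , e ∷ [] , tt , refl
  extend {v} e (suc n) with another v e
  ... | w , d , v≢w with extend d n
  ...   | z , vs , _ ∷ walk , r , len = z , w ∷ vs , e ∷ d ∷ walk , (v≢w , r) , cong suc len

  private
    first-step : ∀ {x z zs u vs} → Walk (Adj S) x z zs → map f zs ≡ u ∷ vs → ∃ λ y → Adj S x y × f y ≡ u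
    first-step (d ∷ _) refl = _ , d , refl

  -- An epimorphism is not given as surjective on incident pairs. The edge is prolonged to a
  -- geodesic of length 5, and the lift of this geodesic begins with the required step.
  lift-edge : ∀ {x u} → Adj G (f x) u → ∃ λ y → Adj S x y × f y ≡ u
  lift-edge {x} {u} e =
    let w , vs , walk , r , len = extend e 4
        zs , v , _ , eq = lift-geodesic {z = lift w} walk r (cong suc len) refl (f-lift w)
    in first-step v eq

  -- A neighbour `x₁` over `v₁` is at distance 5 from `y`; it is sent to the last element before `y`
  -- on the geodesic. Two preimages of one `y₅` would give two walks of length 5 from `x` to `y₅`.
  length-over-≤ : ∀ {v₀ v₁ v₂ v₃ v₄ v₅ v₆ x y} →
    Walk (Adj G) v₀ v₆ (v₁ ∷ v₂ ∷ v₃ ∷ v₄ ∷ v₅ ∷ v₆ ∷ []) →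
    Reduced (v₀ ∷ v₁ ∷ v₂ ∷ v₃ ∷ v₄ ∷ v₅ ∷ v₆ ∷ []) →
    f x ≡ v₀ → f y ≡ v₆ → length (over v₁ x) ≤ length (over v₅ y)
  length-over-≤ {v₀} {v₁} {v₂} {v₃} {v₄} {v₅} {v₆} {x} {y} (e ∷ walk) r fx≡ fy≡ =
    length-≤-by-injection R R-injective (over-unique v₁ x) (over v₅ y) image
    where
    R : Element S → Element S → Set
    R x₁ y₅ = Adj S x x₁ × f x₁ ≡ v₁ × ∃ λ zs → Walk (Adj S) x₁ y₅ zs × map f zs ≡ v₂ ∷ v₃ ∷ v₄ ∷ v₅ ∷ []
    reduced : ∀ {x₁ zs} → f x₁ ≡ v₁ → map f zs ≡ v₂ ∷ v₃ ∷ v₄ ∷ v₅ ∷ [] → Reduced (x ∷ x₁ ∷ zs)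
    reduced eq eq′ = reduced-map⁻ f _ (subst Reduced
      (sym (cong₂ _∷_ fx≡ (cong₂ _∷_ eq eq′)))
      (let n₁ , n₂ , n₃ , n₄ , _ = r in n₁ , n₂ , n₃ , n₄ , tt))
    four : ∀ {zs} → map f zs ≡ v₂ ∷ v₃ ∷ v₄ ∷ v₅ ∷ [] → length zs ≡ 4
    four {zs} eq = trans (sym (List.length-map f zs)) (cong length eq)
    R-injective : ∀ {x₁ x₁′ y₅} → R x₁ y₅ → R x₁′ y₅ → x₁ ≡ x₁′
    R-injective (d , eq , zs , w , zs≡) (d′ , eq′ , zs′ , w′ , zs≡′) =
      List.∷-injectiveˡ (walk-unique weakS _ _ (d ∷ w) (d′ ∷ w′) (reduced eq zs≡) (reduced eq′ zs≡′)
        (subst₂ (λ a b → suc a + suc b ≤ 11) (sym (four zs≡)) (sym (four zs≡′)) (n≤1+n 10)))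
    last-step : ∀ {x₁ zs} → Walk (Adj S) x₁ y zs → map f zs ≡ v₂ ∷ v₃ ∷ v₄ ∷ v₅ ∷ v₆ ∷ [] →
      ∃₂ λ y₅ zs′ → Adj S y y₅ × f y₅ ≡ v₅ × Walk (Adj S) x₁ y₅ zs′ × map f zs′ ≡ v₂ ∷ v₃ ∷ v₄ ∷ v₅ ∷ []
    last-step (d₁ ∷ d₂ ∷ d₃ ∷ d₄ ∷ d₅ ∷ []) refl =
      _ , _ , adj-sym d₅ , refl , d₁ ∷ d₂ ∷ d₃ ∷ d₄ ∷ [] , refl
    image : ∀ {x₁} → x₁ ∈ over v₁ x → ∃ λ y₅ → y₅ ∈ over v₅ y × R x₁ y₅
    image x₁∈ with over⁻ v₁ x₁∈
    ... | d , eq with lift-geodesic walk (proj₂ r) refl eq fy≡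
    ...   | zs , w , _ , zs≡ with last-step w zs≡
    ...     | y₅ , zs′ , a , fy₅≡ , w′ , zs≡′ = y₅ , over⁺ a fy₅≡ , d , eq , zs′ , w′ , zs≡′

  length-over-opposite : ∀ {v₀ v₁ v₂ v₃ v₄ v₅ v₆ x y} →
    Walk (Adj G) v₀ v₆ (v₁ ∷ v₂ ∷ v₃ ∷ v₄ ∷ v₅ ∷ v₆ ∷ []) →
    Reduced (v₀ ∷ v₁ ∷ v₂ ∷ v₃ ∷ v₄ ∷ v₅ ∷ v₆ ∷ []) →
    f x ≡ v₀ → f y ≡ v₆ → length (over v₁ x) ≡ length (over v₅ y)
  length-over-opposite w@(e₁ ∷ e₂ ∷ e₃ ∷ e₄ ∷ e₅ ∷ e₆ ∷ []) r@(n₁ , n₂ , n₃ , n₄ , n₅ , _) fx≡ fy≡ =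
    ≤-antisym (length-over-≤ w r fx≡ fy≡)
      (length-over-≤
        (adj-sym e₆ ∷ adj-sym e₅ ∷ adj-sym e₄ ∷ adj-sym e₃ ∷ adj-sym e₂ ∷ adj-sym e₁ ∷ [])
        (≢-sym n₅ , ≢-sym n₄ , ≢-sym n₃ , ≢-sym n₂ , ≢-sym n₁ , tt) fy≡ fx≡)

  -- Both elements are compared with one and the same element over some `w` opposite `v`.
  length-over-constant : ∀ {v u x x′} → Adj G v u → f x ≡ v → f x′ ≡ v → length (over u x) ≡ length (over u x′)
  length-over-constant {v} {u} {x} {x′} e fx≡ fx′≡ = let w , vs , walk , r , len = extend e 5 in opposite w walk r len
    where
    opposite : ∀ w {vs} → Walk (Adj G) v w (u ∷ vs) → Reduced (v ∷ u ∷ vs) → length vs ≡ 5 →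
      length (over u x) ≡ length (over u x′)
    opposite w walk@(_ ∷ _ ∷ _ ∷ _ ∷ _ ∷ _ ∷ []) r refl =
      trans (length-over-opposite walk r fx≡ (f-lift w)) (sym (length-over-opposite walk r fx′≡ (f-lift w)))

  -- Opaque, so that these numbers remain atoms in the arithmetic below; `length-over-lift` restores
  -- the definition where it is wanted.
  abstract
    p : Element G → Element G → ℕ
    p v u = length (over u (lift v))

    length-over-lift : ∀ v u → length (over u (lift v)) ≡ p v u
    length-over-lift v u = refl

    length-over : ∀ {x u} → Adj G (f x) u → length (over u x) ≡ p (f x) u
    length-over {x} e = length-over-constant e refl (f-lift (f x))

    p-opposite : ∀ {v₀ v₁ v₂ v₃ v₄ v₅ v₆} →
      Walk (Adj G) v₀ v₆ (v₁ ∷ v₂ ∷ v₃ ∷ v₄ ∷ v₅ ∷ v₆ ∷ []) →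
      Reduced (v₀ ∷ v₁ ∷ v₂ ∷ v₃ ∷ v₄ ∷ v₅ ∷ v₆ ∷ []) → p v₀ v₁ ≡ p v₆ v₅
    p-opposite w r = length-over-opposite w r (f-lift _) (f-lift _)

    p-positive : ∀ {v u} → Adj G v u → 1 ≤ p v u
    p-positive {v} {u} e = nonempty (lift-edge {lift v} (subst (λ w → Adj G w u) (sym (f-lift v)) e))
      where
      ∈⇒1≤length : ∀ {y : Element S} {ys} → y ∈ ys → 1 ≤ length ys
      ∈⇒1≤length (here _)  = s≤s z≤n
      ∈⇒1≤length (there _) = s≤s z≤n
      nonempty : (∃ λ y → Adj S (lift v) y × f y ≡ u) → 1 ≤ length (over u (lift v))
      nonempty (y , d , eq) = ∈⇒1≤length (over⁺ d eq)

  paths-start⁺ : ∀ {x z ys us} → Walk (Adj S) x z ys → Reduced (x ∷ ys) → 1 ≤ length us →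
    map f ys ≡ us → ys ∈ paths x x us
  paths-start⁺ []      _ ()  refl
  paths-start⁺ (e ∷ w) r _ refl = paths⁺ (e ∷ w) ((λ { refl → adj-irreflexive e }) , r)

  -- Both sides count elements over w; those on the left are distinct because
  -- walks with different labels are different.
  count-paths : ∀ {v₀ v w vs x₀ x} →
    Walk (Adj G) v₀ w vs → Reduced (v₀ ∷ vs) → length vs ≡ 5 → f x₀ ≡ v₀ → f x ≡ v →
    ∀ {uss} → Unique uss → All (λ us → Walk (Adj G) v w us × length us ≤ 5) uss →
    sum (map (length ∘ paths x x) uss) ≤ length (paths x₀ x₀ vs)
  count-paths {v₀} {v} {w} {vs} {x₀} {x} walk r len fx₀≡ fx≡ {uss} uss! walks =
    subst (_≤ length (paths x₀ x₀ vs)) (length-concatMap-sum (paths x x) uss)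
      (length-≤-by-injection R R-injective
        (unique-concatMap (paths x x) uss! (λ {us} _ → paths-unique x x us)
          (λ {us} {us′} ys∈ ys∈′ →
            trans (sym (proj₂ (proj₂ (paths⁻ us ys∈)))) (proj₂ (proj₂ (paths⁻ us′ ys∈′)))))
        (paths x₀ x₀ vs) image)
    where
    R : List (Element S) → List (Element S) → Set
    R ys zs = ∃ λ z → Walk (Adj S) x z ys × Reduced (x ∷ ys) × length ys ≤ 5 × Walk (Adj S) x₀ z zs
    R-injective : ∀ {ys ys′ zs} → R ys zs → R ys′ zs → ys ≡ ys′
    R-injective (z , v , r , ≤5 , u) (z′ , v′ , r′ , ≤5′ , u′) with refl ← end-unique u u′ =
      walk-unique weakS _ _ v v′ r r′ (≤-trans (+-mono-≤ ≤5 ≤5′) (n≤1+n 10))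
    image : ∀ {ys} → ys ∈ concatMap (paths x x) uss → ∃ λ zs → zs ∈ paths x₀ x₀ vs × R ys zs
    image {ys} ys∈ with find (∈-concatMap⁻ (paths x x) {xs = uss} ys∈)
    ... | us , us∈ , ys∈′ with paths⁻ us ys∈′ | All.lookup walks us∈
    ...   | (z , u) , r′ , ys≡ | walk′ , ≤5 with lift-geodesic walk r len fx₀≡ end
      where
      end : f z ≡ w
      end = end-unique (subst (Walk (Adj G) (f x) (f z)) ys≡ (walk-map f hom u))
        (subst (λ v → Walk (Adj G) v w us) (sym fx≡) walk′)
    ...     | zs , u′ , rz , zs≡ = zs
        , paths-start⁺ u′ rz (subst (1 ≤_) (sym len) (s≤s z≤n)) zs≡
        , z , u , reduced-tail (x ∷ ys) r′
        , subst (_≤ 5) (trans (cong length (sym ys≡)) (List.length-map f ys)) ≤5 , u′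

-- The excess inequality along a cycle of `G`

excess-arithmetic : ∀ P₀ P₁ P₂ P₃ P₄ {m} n →
  m ≡ suc P₂ * (suc P₃ * (suc P₄ * 1)) * (1 + P₀ + P₁ + n) →
  m ≤ suc P₀ * (suc P₁ * (suc P₂ * (suc P₃ * (suc P₄ * 1)))) → n ≤ P₀ * P₁
excess-arithmetic P₀ P₁ P₂ P₃ P₄ n refl le =
  +-cancelˡ-≤ (1 + P₀ + P₁) n (P₀ * P₁)
    (*-cancelˡ-≤ (suc P₂ * (suc P₃ * (suc P₄ * 1)))
      (subst (suc P₂ * (suc P₃ * (suc P₄ * 1)) * (1 + P₀ + P₁ + n) ≤_) (rearrange P₀ P₁ P₂ P₃ P₄) le))
  where
  rearrange : ∀ P₀ P₁ P₂ P₃ P₄ → suc P₀ * (suc P₁ * (suc P₂ * (suc P₃ * (suc P₄ * 1)))) ≡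
    suc P₂ * (suc P₃ * (suc P₄ * 1)) * (1 + P₀ + P₁ + P₀ * P₁)
  rearrange = solve-∀

module _ {S G : Geometry} {s t s′ t′ : ℕ}
  (weakS : IsWeakGeneralizedPolygon 6 S) (weakG : IsWeakGeneralizedPolygon 6 G)
  (orderS : HasOrder S s t) (orderG : HasOrder G s′ t′) (1≤s′ : 1 ≤ s′) (1≤t′ : 1 ≤ t′)
  (Φ : Epimorphism S G) where
  open Cover weakS weakG orderS orderG 1≤s′ 1≤t′ Φ

  module InCycle {c : ℕ → Element G} (C : IsCycle G c) where
    open IsCycle C

    P : ℕ → ℕ
    P n = pred (p (c n) (c (suc n)))

    p-up : ∀ n → p (c n) (c (suc n)) ≡ suc (P n)
    p-up n = pos (p-positive (edge n))
      where
      pos : ∀ {k} → 1 ≤ k → k ≡ suc (pred k)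
      pos (s≤s _) = refl

    p-down : ∀ n → p (c (suc n)) (c n) ≡ suc (P (7 + n))
    p-down n = trans (sym (trans
      (p-opposite (segment-walk C (7 + n) 6) (segment-reduced C (7 + n) 6))
      (cong₂ p (period (suc n)) (period n)))) (p-up (7 + n))

    P-period : ∀ n → P (12 + n) ≡ P n
    P-period n = cong₂ (λ v u → pred (p v u)) (period n) (period (suc n))

    adjˡ : ∀ n → Adj G (c (suc n)) (c n)
    adjˡ n = adj-sym (edge n)

    private
      W : Element G → Element G → List (Element G) → ℕ → Set
      W = Weight {_~ᴬ_ = Adj G} p length-over

      start : ∀ {v u us m n} → Adj G v u → p v u ≡ m → W v u us n →
        length (paths (lift v) (lift v) (u ∷ us)) ≡ m * n
      start {v} = length-paths-start p length-over adj-sym adj-irreflexive (f-lift v)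

      ups : ℕ → ℕ → ℕ
      ups i zero    = 1
      ups i (suc n) = suc (P (suc i)) * ups (suc i) n

      ascend : ∀ i n {a} → c (2 + i) ≢ a → W a (c (suc i)) (segment {G} c (suc i) n) (ups i n)
      ascend i zero    _ = stop
      ascend i (suc n) ≢a = straight (edge (suc i)) ≢a (p-up (suc i)) (ascend (suc i) n (≢-sym (turn (suc i))))

      straight-up : ∀ i {us n} → W (c (suc i)) (c (2 + i)) us n →
        W (c i) (c (suc i)) (c (2 + i) ∷ us) (suc (P (suc i)) * n)
      straight-up i = straight (edge (suc i)) (≢-sym (turn i)) (p-up (suc i))

      fold-up : ∀ i {us n} → W (c i) (c (suc i)) us n → W (c (suc i)) (c i) (c (suc i) ∷ us) (P i * n)
      fold-up i = fold (edge i) (p-up i)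

      fold-down : ∀ i {us n} → W (c (suc i)) (c i) us n → W (c i) (c (suc i)) (c i ∷ us) (P (7 + i) * n)
      fold-down i = fold (adjˡ i) (p-down i)

      bound : ∀ {uss} → Unique uss → All (λ us → Walk (Adj G) (c 2) (c 5) us × length us ≤ 5) uss →
        sum (map (length ∘ paths (lift (c 2)) (lift (c 2))) uss) ≤ suc (P 0) * ups 0 4
      bound {uss} u all = subst (sum (map (length ∘ paths (lift (c 2)) (lift (c 2))) uss) ≤_)
        (start (edge 0) (p-up 0) (ascend 0 4 (≢-sym (turn 0))))
        (count-paths (segment-walk C 0 5) (segment-reduced C 0 5) refl (f-lift (c 0)) (f-lift (c 2)) u all)

    excess : P 1 * P 8 + P 2 * P 9 + P 3 * P 10 + P 4 * P 11 + P 5 * P 0 ≤ P 0 * P 1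
    excess = excess-arithmetic (P 0) (P 1) (P 2) (P 3) (P 4) _
      (collect (P 0) (P 1) (P 2) (P 3) (P 4) (suc (P 2)) (suc (P 3)) (suc (P 4)) (P 5) (P 8) (P 9) (P 10) (P 11))
      (subst (_≤ suc (P 0) * ups 0 4) weights (bound distinct walks))
      where
      detours : List (List (Element G))
      detours =
        (c 3 ∷ c 4 ∷ c 5 ∷ []) ∷
        (c 1 ∷ c 2 ∷ c 3 ∷ c 4 ∷ c 5 ∷ []) ∷
        (c 3 ∷ c 2 ∷ c 3 ∷ c 4 ∷ c 5 ∷ []) ∷
        (c 3 ∷ c 4 ∷ c 3 ∷ c 4 ∷ c 5 ∷ []) ∷
        (c 3 ∷ c 4 ∷ c 5 ∷ c 4 ∷ c 5 ∷ []) ∷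
        (c 3 ∷ c 4 ∷ c 5 ∷ c 6 ∷ c 5 ∷ []) ∷ []
      walks : All (λ us → Walk (Adj G) (c 2) (c 5) us × length us ≤ 5) detours
      walks =
        (edge 2 ∷ edge 3 ∷ edge 4 ∷ [] , s≤s (s≤s (s≤s z≤n))) ∷
        (adjˡ 1 ∷ edge 1 ∷ edge 2 ∷ edge 3 ∷ edge 4 ∷ [] , ≤-refl) ∷
        (edge 2 ∷ adjˡ 2 ∷ edge 2 ∷ edge 3 ∷ edge 4 ∷ [] , ≤-refl) ∷
        (edge 2 ∷ edge 3 ∷ adjˡ 3 ∷ edge 3 ∷ edge 4 ∷ [] , ≤-refl) ∷
        (edge 2 ∷ edge 3 ∷ edge 4 ∷ adjˡ 4 ∷ edge 4 ∷ [] , ≤-refl) ∷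
        (edge 2 ∷ edge 3 ∷ edge 4 ∷ edge 5 ∷ adjˡ 5 ∷ [] , ≤-refl) ∷ []
      distinct : Unique detours
      distinct =
        ((λ ()) ∷ (λ ()) ∷ (λ ()) ∷ (λ ()) ∷ (λ ()) ∷ []) ∷
        (first 1 ∷ first 1 ∷ first 1 ∷ first 1 ∷ []) ∷
        (second 2 ∷ second 2 ∷ second 2 ∷ []) ∷
        (third 3 ∷ third 3 ∷ []) ∷
        (fourth 4 ∷ []) ∷ [] ∷ []
        where
        first : ∀ n {xs ys} → c n ∷ xs ≢ c (2 + n) ∷ ys
        first n eq = turn n (List.∷-injectiveˡ eq)
        second : ∀ n {x xs ys} → x ∷ c n ∷ xs ≢ x ∷ c (2 + n) ∷ ys
        second n eq = first n (List.∷-injectiveʳ eq)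
        third : ∀ n {x y xs ys} → x ∷ y ∷ c n ∷ xs ≢ x ∷ y ∷ c (2 + n) ∷ ys
        third n eq = second n (List.∷-injectiveʳ eq)
        fourth : ∀ n {x y z xs ys} → x ∷ y ∷ z ∷ c n ∷ xs ≢ x ∷ y ∷ z ∷ c (2 + n) ∷ ys
        fourth n eq = third n (List.∷-injectiveʳ eq)
      weights : sum (map (length ∘ paths (lift (c 2)) (lift (c 2))) detours) ≡
        suc (P 2) * ups 2 2 + (suc (P 8) * (P 1 * ups 1 3) +
        (suc (P 2) * (P 9 * (P 2 * ups 2 2)) +
        (suc (P 2) * (suc (P 3) * (P 10 * (P 3 * ups 3 1))) +
        (suc (P 2) * (suc (P 3) * (suc (P 4) * (P 11 * (P 4 * 1)))) +
        (suc (P 2) * (suc (P 3) * (suc (P 4) * (suc (P 5) * (P 0 * 1)))) + 0)))))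
      weights =
        cong₂ _+_ (start (edge 2) (p-up 2) (ascend 2 2 (≢-sym (turn 2))))
        (cong₂ _+_ (start (adjˡ 1) (p-down 1) (fold-up 1 (ascend 1 3 (≢-sym (turn 1)))))
        (cong₂ _+_ (start (edge 2) (p-up 2) (fold-down 2 (fold-up 2 (ascend 2 2 (≢-sym (turn 2))))))
        (cong₂ _+_ (start (edge 2) (p-up 2) (straight-up 2 (fold-down 3 (fold-up 3 (ascend 3 1 (≢-sym (turn 3)))))))
        (cong₂ _+_ (start (edge 2) (p-up 2) (straight-up 2 (straight-up 3 (fold-down 4 (fold-up 4 stop)))))
        (cong₂ _+_ (start (edge 2) (p-up 2) (straight-up 2 (straight-up 3 (straight-up 4
          (fold (adjˡ 5) (trans (p-down 5) (cong suc (P-period 0))) stop)))))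
        refl)))))
      collect : ∀ P₀ P₁ P₂ P₃ P₄ Q₂ Q₃ Q₄ Q₅ P₈ P₉ P₁₀ P₁₁ →
        Q₂ * (Q₃ * (Q₄ * 1)) + (suc P₈ * (P₁ * (Q₂ * (Q₃ * (Q₄ * 1)))) +
        (Q₂ * (P₉ * (P₂ * (Q₃ * (Q₄ * 1)))) +
        (Q₂ * (Q₃ * (P₁₀ * (P₃ * (Q₄ * 1)))) +
        (Q₂ * (Q₃ * (Q₄ * (P₁₁ * (P₄ * 1)))) +
        (Q₂ * (Q₃ * (Q₄ * (suc Q₅ * (P₀ * 1)))) + 0))))) ≡
        Q₂ * (Q₃ * (Q₄ * 1)) *
          (1 + P₀ + P₁ + (P₁ * P₈ + P₂ * P₉ + P₃ * P₁₀ + P₄ * P₁₁ + Q₅ * P₀))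
      collect = solve-∀

    -- Two inner detours now leave the cycle, through `u` and `u′`. The way back has weight `P 9`
    -- and `P 3`, since `c 9` is opposite both, and the way out has weight at least 1. So `P 9` and
    -- `P 3` enter linearly, and thickness over `c 3` makes their sum positive if `c 3` has only two
    -- neighbours.
    excess-off-cycle : ∀ {u u′} → Adj G (c 2) u → u ≢ c 1 → u ≢ c 3 →
      Adj G (c 4) u′ → u′ ≢ c 3 → u′ ≢ c 5 → (P 9 + P 3) + P 5 * P 0 ≤ P 0 * P 1
    excess-off-cycle {u} {u′} e u≢1 u≢3 e′ u′≢3 u′≢5 = ≤-trans
      (+-mono-≤ (m≤n⇒m≤o+n (P 1 * P 8) (+-mono-≤ (m≤m+n (P 9) _) (m≤m+n (P 3) _))) (≤-refl {P 5 * P 0}))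
      (excess-arithmetic (P 0) (P 1) (P 2) (P 3) (P 4) _
        (collect (P 0) (P 1) (P 3) (P 5) (P 8) (P 9) (suc (P 2)) (suc (P 3)) (suc (P 4)) a b)
        (subst (_≤ suc (P 0) * ups 0 4) weights (bound distinct walks)))
      where
      a = pred (p (c 2) u)
      b = pred (p (c 4) u′)
      suc-pred′ : ∀ {k} → 1 ≤ k → k ≡ suc (pred k)
      suc-pred′ (s≤s _) = refl
      -- c 9 is opposite both u and u′.
      p-u : p u (c 2) ≡ suc (P 9)
      p-u = trans (p-opposite
        (adj-sym e ∷ adjˡ 1 ∷ adjˡ 0 ∷ subst (λ v → Adj G v (c 11)) (period 0) (adjˡ 11) ∷ adjˡ 10 ∷ adjˡ 9 ∷ [])
        (u≢1 , ≢-sym (turn 0) , (λ eq → turn 11 (trans (sym eq) (sym (period 1)))) ,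
         (λ eq → turn 10 (trans (sym eq) (sym (period 0)))) , ≢-sym (turn 9) , tt))
        (p-up 9)
      p-u′ : p u′ (c 4) ≡ suc (P 3)
      p-u′ = trans (trans (p-opposite
        (adj-sym e′ ∷ edge 4 ∷ edge 5 ∷ edge 6 ∷ edge 7 ∷ edge 8 ∷ [])
        (u′≢5 , turn 4 , turn 5 , turn 6 , turn 7 , tt))
        (p-down 8)) (cong suc (P-period 3))
      detours : List (List (Element G))
      detours =
        (c 3 ∷ c 4 ∷ c 5 ∷ []) ∷
        (c 1 ∷ c 2 ∷ c 3 ∷ c 4 ∷ c 5 ∷ []) ∷
        (u ∷ c 2 ∷ c 3 ∷ c 4 ∷ c 5 ∷ []) ∷
        (c 3 ∷ c 4 ∷ u′ ∷ c 4 ∷ c 5 ∷ []) ∷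
        (c 3 ∷ c 4 ∷ c 5 ∷ c 6 ∷ c 5 ∷ []) ∷ []
      walks : All (λ us → Walk (Adj G) (c 2) (c 5) us × length us ≤ 5) detours
      walks =
        (edge 2 ∷ edge 3 ∷ edge 4 ∷ [] , s≤s (s≤s (s≤s z≤n))) ∷
        (adjˡ 1 ∷ edge 1 ∷ edge 2 ∷ edge 3 ∷ edge 4 ∷ [] , ≤-refl) ∷
        (e ∷ adj-sym e ∷ edge 2 ∷ edge 3 ∷ edge 4 ∷ [] , ≤-refl) ∷
        (edge 2 ∷ edge 3 ∷ e′ ∷ adj-sym e′ ∷ edge 4 ∷ [] , ≤-refl) ∷
        (edge 2 ∷ edge 3 ∷ edge 4 ∷ edge 5 ∷ adjˡ 5 ∷ [] , ≤-refl) ∷ []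
      distinct : Unique detours
      distinct =
        ((λ ()) ∷ (λ ()) ∷ (λ ()) ∷ (λ ()) ∷ []) ∷
        ((u≢1 ∘ sym ∘ List.∷-injectiveˡ) ∷ (turn 1 ∘ List.∷-injectiveˡ) ∷ (turn 1 ∘ List.∷-injectiveˡ) ∷ []) ∷
        ((u≢3 ∘ List.∷-injectiveˡ) ∷ (u≢3 ∘ List.∷-injectiveˡ) ∷ []) ∷
        ((u′≢5 ∘ List.∷-injectiveˡ ∘ List.∷-injectiveʳ ∘ List.∷-injectiveʳ) ∷ []) ∷ [] ∷ []
      weights : sum (map (length ∘ paths (lift (c 2)) (lift (c 2))) detours) ≡
        suc (P 2) * ups 2 2 + (suc (P 8) * (P 1 * ups 1 3) +
        (suc a * (P 9 * ups 1 3) +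
        (suc (P 2) * (suc (P 3) * (suc b * (P 3 * (suc (P 4) * 1)))) +
        (suc (P 2) * (suc (P 3) * (suc (P 4) * (suc (P 5) * (P 0 * 1)))) + 0))))
      weights =
        cong₂ _+_ (start (edge 2) (p-up 2) (ascend 2 2 (≢-sym (turn 2))))
        (cong₂ _+_ (start (adjˡ 1) (p-down 1) (fold-up 1 (ascend 1 3 (≢-sym (turn 1)))))
        (cong₂ _+_ (start e (suc-pred′ (p-positive e)) (fold (adj-sym e) p-u (ascend 1 3 (≢-sym u≢3))))
        (cong₂ _+_ (start (edge 2) (p-up 2) (straight-up 2 (straight e′ u′≢3 (suc-pred′ (p-positive e′))
          (fold (adj-sym e′) p-u′ (ascend 3 1 (≢-sym u′≢5))))))
        (cong₂ _+_ (start (edge 2) (p-up 2) (straight-up 2 (straight-up 3 (straight-up 4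
          (fold (adjˡ 5) (trans (p-down 5) (cong suc (P-period 0))) stop)))))
        refl))))
      collect : ∀ P₀ P₁ P₃ P₅ P₈ P₉ Q₂ Q₃ Q₄ a b →
        Q₂ * (Q₃ * (Q₄ * 1)) + (suc P₈ * (P₁ * (Q₂ * (Q₃ * (Q₄ * 1)))) +
        (suc a * (P₉ * (Q₂ * (Q₃ * (Q₄ * 1)))) +
        (Q₂ * (Q₃ * (suc b * (P₃ * (Q₄ * 1)))) +
        (Q₂ * (Q₃ * (Q₄ * (suc P₅ * (P₀ * 1)))) + 0)))) ≡
        Q₂ * (Q₃ * (Q₄ * 1)) *
          (1 + P₀ + P₁ + ((P₁ * P₈ + (suc a * P₉ + suc b * P₃)) + P₅ * P₀))
      collect = solve-∀

    -- Every element over `c 5` ends a path along the segment from the one lift of `c 0`, and the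
    -- number of these paths is a product of ones.
    singleton-fibre : P 0 ≡ 0 → P 1 ≡ 0 → P 2 ≡ 0 → P 3 ≡ 0 → P 4 ≡ 0 →
      ∀ {x y} → f x ≡ c 5 → f y ≡ c 5 → x ≡ y
    singleton-fibre P₀ P₁ P₂ P₃ P₄ {x} {y} fx≡ fy≡ with lifting fx≡ | lifting fy≡
      where
      lifting : ∀ {z} → f z ≡ c 5 → ∃ λ zs → Walk (Adj S) (lift (c 0)) z zs ×
        zs ∈ paths (lift (c 0)) (lift (c 0)) (segment {G} c 0 5)
      lifting fz≡ with zs , w , r , eq ← lift-geodesic (segment-walk C 0 5) (segment-reduced C 0 5) refl (f-lift (c 0)) fz≡ =
        zs , w , paths-start⁺ w r (s≤s z≤n) eq
    ... | xs , v , xs∈ | ys , w , ys∈ = end-unique v (subst (Walk (Adj S) (lift (c 0)) y) (sym (unique-member xs∈ ys∈)) w)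
      where
      one : length (paths (lift (c 0)) (lift (c 0)) (segment {G} c 0 5)) ≡ 1
      one = trans (start (edge 0) (p-up 0) (ascend 0 4 (≢-sym (turn 0))))
        (cong₂ _*_ (cong suc P₀) (cong₂ _*_ (cong suc P₁) (cong₂ _*_ (cong suc P₂)
          (cong₂ _*_ (cong suc P₃) (cong (λ n → suc n * 1) P₄)))))
      unique-member : ∀ {xs ys} → xs ∈ paths (lift (c 0)) (lift (c 0)) (segment {G} c 0 5) →
        ys ∈ paths (lift (c 0)) (lift (c 0)) (segment {G} c 0 5) → xs ≡ ys
      unique-member {xs} {ys} xs∈ ys∈ with paths (lift (c 0)) (lift (c 0)) (segment {G} c 0 5) | one
      unique-member (here refl) (here refl) | _ ∷ [] | _ = refl

    -- An element over `c (suc n)` has at least three neighbours, and all of them lie over the two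
    -- neighbours of `c (suc n)`: `1 + P (7 + n)` over one, `1 + P (suc n)` over the other.
    P-antipodal : IsThick S → ∀ n → (∀ {u} → Adj G (c (suc n)) u → u ≡ c n ⊎ u ≡ c (2 + n)) →
      1 ≤ P (7 + n) + P (suc n)
    P-antipodal thick n two with at-least-3 x
      where
      x = lift (c (suc n))
      at-least-3 : ∀ x → ∃ λ ys → Unique ys × length ys ≡ 3 × (∀ {y} → y ∈ ys → Adj S x y)
      at-least-3 (inj₁ x) = let h , inj , inc = proj₁ thick x in
        tabulate (inj₂ ∘ h) , Unique.tabulate⁺ (inj ∘ inj₂-injective) , refl ,
        λ y∈ → case ∈-tabulate⁻ {f = inj₂ ∘ h} y∈ of λ { (i , refl) → up (inc i) }
      at-least-3 (inj₂ l) = let h , inj , inc = proj₂ thick l in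
        tabulate (inj₁ ∘ h) , Unique.tabulate⁺ (inj ∘ inj₁-injective) , refl ,
        λ y∈ → case ∈-tabulate⁻ {f = inj₁ ∘ h} y∈ of λ { (i , refl) → down (inc i) }
    ... | ys , u , len , adj = s≤s⁻¹ (s≤s⁻¹ (subst₂ _≤_ len total
        (unique-⊆⇒length-≤ u (over (c n) x ++ over (c (2 + n)) x) covered)))
      where
      x = lift (c (suc n))
      covered : ∀ {y} → y ∈ ys → y ∈ over (c n) x ++ over (c (2 + n)) x
      covered {y} y∈ with two (subst (λ v → Adj G v (f y)) (f-lift (c (suc n))) (hom (adj y∈)))
      ... | inj₁ eq = ∈-++⁺ˡ (over⁺ (adj y∈) eq)
      ... | inj₂ eq = ∈-++⁺ʳ (over (c n) x) (over⁺ (adj y∈) eq)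
      total : length (over (c n) x ++ over (c (2 + n)) x) ≡ suc (suc (P (7 + n) + P (suc n)))
      total = trans (List.length-++ (over (c n) x)) (trans (cong₂ _+_
        (trans (length-over-lift (c (suc n)) (c n)) (p-down n))
        (trans (length-over-lift (c (suc n)) (c (2 + n))) (p-up (suc n))))
        (cong suc (+-suc _ _)))

-- Determining `s′` and finding a one-element fibre

any-∉ : DecidableEquality A → ∀ {xs : List A} → Unique xs → ∀ ys → length ys < length xs →
  ∃ λ x → x ∈ xs × x ∉ ys
any-∉ _≟_ {xs} xs! ys ys<xs with Any.any? (λ x → ¬? (x ∈? ys)) xs
  where
  open import Data.List.Membership.DecPropositional _≟_ using (_∈?_)
... | yes found = find found
... | no none   = contradiction
  (unique-⊆⇒length-≤ xs! ys λ {x} x∈ → decidable-stable (x ∈? ys) (none ∘ lose x∈)) (<⇒≱ ys<xs)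
  where
  open import Data.List.Membership.DecPropositional _≟_ using (_∈?_)

Fin-2 : ∀ {i j k : Fin 2} → i ≢ j → k ≡ i ⊎ k ≡ j
Fin-2 {0F} {0F} i≢j = contradiction refl i≢j
Fin-2 {0F} {1F} {0F} _ = inj₁ refl
Fin-2 {0F} {1F} {1F} _ = inj₂ refl
Fin-2 {1F} {0F} {0F} _ = inj₂ refl
Fin-2 {1F} {0F} {1F} _ = inj₁ refl
Fin-2 {1F} {1F} i≢j = contradiction refl i≢j

at-most-two : {P : A → Set} → HasCardinality P 2 → ∀ {x y z} → P x → P y → P z → x ≢ y → z ≡ x ⊎ z ≡ y
at-most-two (h , _ , _ , onto) {x} {y} {z} px py pz x≢y with onto x px | onto y py | onto z pz
... | i , refl | j , refl | k , refl = case Fin-2 {i} {j} {k} (x≢y ∘ cong h) of λ where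
  (inj₁ eq) → inj₁ (cong h eq)
  (inj₂ eq) → inj₂ (cong h eq)

module _ {G : Geometry} where

  point-two-nbrs : ∀ {u} → HasOrder G u 1 → ∀ {x y z w} →
    Adj G (inj₁ x) y → Adj G (inj₁ x) z → y ≢ z → Adj G (inj₁ x) w → w ≡ y ⊎ w ≡ z
  point-two-nbrs order (up e) (up d) y≢z (up a) =
    case at-most-two (proj₂ order _) e d a (y≢z ∘ cong inj₂) of λ where
      (inj₁ eq) → inj₁ (cong inj₂ eq)
      (inj₂ eq) → inj₂ (cong inj₂ eq)

  line-two-nbrs : ∀ {v} → HasOrder G 1 v → ∀ {l y z w} →
    Adj G (inj₂ l) y → Adj G (inj₂ l) z → y ≢ z → Adj G (inj₂ l) w → w ≡ y ⊎ w ≡ z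
  line-two-nbrs order (down e) (down d) y≢z (down a) =
    case at-most-two (proj₁ order _) e d a (y≢z ∘ cong inj₁) of λ where
      (inj₁ eq) → inj₁ (cong inj₁ eq)
      (inj₂ eq) → inj₂ (cong inj₁ eq)

  only-cycle-nbrs : HasOrder G 1 1 → ∀ {c} → IsCycle G c → ∀ n {u} →
    Adj G (c (suc n)) u → u ≡ c n ⊎ u ≡ c (2 + n)
  only-cycle-nbrs order {c} C n e = two (adj-sym (edge n)) (edge (suc n)) (turn n) e
    where
    open IsCycle C
    two : ∀ {v y z w} → Adj G v y → Adj G v z → y ≢ z → Adj G v w → w ≡ y ⊎ w ≡ z
    two {inj₁ _} = point-two-nbrs order
    two {inj₂ _} = line-two-nbrs order

  IsLine : Element G → Set
  IsLine v = ∃ λ l → v ≡ inj₂ l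

  line-after-two : ∀ {v u w} → IsLine v → Adj G v u → Adj G u w → IsLine w
  line-after-two (_ , refl) (down _) (up _) = _ , refl

  third-point : ∀ {u v} → HasOrder G u v → 2 ≤ u → DecidableEquality (Element G) → ∀ {l} → IsLine l → ∀ y z →
    ∃ λ w → Adj G l w × w ≢ y × w ≢ z
  third-point order 2≤u _≟_ (l , refl) y z with proj₁ order l
  ... | h , inj , inc , _ with any-∉ _≟_ (Unique.tabulate⁺ (inj ∘ inj₁-injective)) (y ∷ z ∷ [])
      (subst (2 <_) (sym (List.length-tabulate (inj₁ ∘ h))) (s≤s 2≤u))
  ...   | w , w∈ , w∉ with ∈-tabulate⁻ {f = inj₁ ∘ h} w∈
  ...     | i , refl = _ , down (inc i) , w∉ ∘ here , w∉ ∘ there ∘ here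

module _ {S G : Geometry} {s t s′ : ℕ}
  (weakS : IsWeakGeneralizedPolygon 6 S) (weakG : IsWeakGeneralizedPolygon 6 G)
  (orderS : HasOrder S s t) (orderG : HasOrder G s′ 1) (1≤s′ : 1 ≤ s′)
  (thick : IsThick S) (Φ : Epimorphism S G) where
  open Cover weakS weakG orderS orderG 1≤s′ ≤-refl Φ using (f)

  private
    some-cycle : ∃ λ c → IsCycle G c × IsLine {G} (c 0)
    some-cycle =
      let l = Epimorphism.onLine Φ (proj₁ (proj₁ thick (IsWeakGeneralizedPolygon.somePoint {6} weakS)) zero)
          c , C , eq = cycle-from weakG (inj₂ l)
      in c , C , l , eq

    <-from-excess : ∀ m a b c → 1 ≤ m → m + b * a ≤ a * c → b < c
    <-from-excess m a b c 1≤m le = *-cancelˡ-< a b c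
      (≤-trans (+-mono-≤ 1≤m (≤-reflexive (*-comm a b))) le)

  s′≡1 : s′ ≡ 1
  s′≡1 with 2 ≤? s′
  ... | no 2≰s′   = ≤-antisym (s≤s⁻¹ (≰⇒> 2≰s′)) 1≤s′
  ... | yes 2≤s′ with some-cycle
  ...   | c , C , line₀ = contradiction
    -- Rotation by 4 carries `P 5 < P 1` to `P 9 < P 5`, keeps lines at even places, and after three
    -- turns arrives at the period 12.
    (<-trans (subst (_< P 9) (P-period 1) (P₅<P₁ 8 line₁₀)) (<-trans (P₅<P₁ 4 line₆) (P₅<P₁ 0 line₂)))
    (<-irrefl {P 1} refl)
    where
    open IsCycle C
    open InCycle weakS weakG orderS orderG 1≤s′ ≤-refl Φ C
    module K (k : ℕ) = InCycle weakS weakG orderS orderG 1≤s′ ≤-refl Φ {λ n → c (n + k)} (shift C k)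
    line : ∀ n → IsLine {G} (c n) → IsLine {G} (c (2 + n))
    line n l = line-after-two l (edge n) (edge (suc n))
    line₂ = line 0 line₀
    line₆ = line 4 (line 2 line₂)
    line₁₀ = line 8 (line 6 line₆)
    point-between : ∀ n → IsLine {G} (c n) → ∀ {u} → Adj G (c (suc n)) u → u ≡ c n ⊎ u ≡ c (2 + n)
    point-between n line-n = point (is-point line-n (edge n)) (adj-sym (edge n)) (edge (suc n)) (turn n)
      where
      is-point : ∀ {l x} → IsLine {G} l → Adj G l x → ∃ λ y → x ≡ inj₁ y
      is-point (_ , refl) (down _) = _ , refl
      point : ∀ {v y z w} → (∃ λ x → v ≡ inj₁ x) → Adj G v y → Adj G v z → y ≢ z → Adj G v w → w ≡ y ⊎ w ≡ z
      point (_ , refl) = point-two-nbrs orderG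
    P₅<P₁ : ∀ k → IsLine {G} (c (2 + k)) → P (5 + k) < P (1 + k)
    P₅<P₁ k l₂ = <-from-excess (P (9 + k) + P (3 + k)) (P k) (P (5 + k)) (P (1 + k))
           (P-antipodal thick (2 + k) (point-between (2 + k) l₂))
           (off-cycle
             (third-point orderG 2≤s′ (_≟ₑ_ weakG) l₂ (c (1 + k)) (c (3 + k)))
             (third-point orderG 2≤s′ (_≟ₑ_ weakG) (line (2 + k) l₂) (c (3 + k)) (c (5 + k))))
      where
      off-cycle : (∃ λ u → Adj G (c (2 + k)) u × u ≢ c (1 + k) × u ≢ c (3 + k)) →
        (∃ λ u → Adj G (c (4 + k)) u × u ≢ c (3 + k) × u ≢ c (5 + k)) →
        (P (9 + k) + P (3 + k)) + P (5 + k) * P k ≤ P k * P (1 + k)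
      off-cycle (u , e , u≢ , u≢′) (u′ , e′ , u′≢ , u′≢′) = K.excess-off-cycle k e u≢ u≢′ e′ u′≢ u′≢′

  -- If no P vanished then excess would give P 1 < P 9 < P 5 < P 1; so
  -- some P j vanishes while P (1 + j) does not, and from there on the excess
  -- inequality at j determines the whole cycle.
  fibre-is-singleton : s′ ≡ 1 → ∃ λ v → ∀ {x y} → f x ≡ v → f y ≡ v → x ≡ y
  fibre-is-singleton refl with some-cycle
  ... | c , C , _ = let j , P≡0 , 1≤P = descent in _ , at-descent j P≡0 1≤P
    where
    open IsCycle C
    open InCycle weakS weakG orderS orderG 1≤s′ ≤-refl Φ C
    module K (k : ℕ) = InCycle weakS weakG orderS orderG 1≤s′ ≤-refl Φ {λ n → c (n + k)} (shift C k)

    antipodal : ∀ n → 1 ≤ P (6 + n) + P n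
    antipodal n = subst₂ (λ a b → 1 ≤ a + b) (P-period (6 + n)) (P-period n)
      (P-antipodal thick (11 + n) (only-cycle-nbrs orderG C (11 + n)))

    positive : ∀ {a b} → a ≡ 0 → 1 ≤ a + b → 1 ≤ b
    positive refl 1≤b = 1≤b

    positive′ : ∀ {a b} → b ≡ 0 → 1 ≤ a + b → 1 ≤ a
    positive′ {a} refl 1≤a = subst (1 ≤_) (+-identityʳ a) 1≤a

    positive-excess : ∀ {a b p₁ p₅} r → 1 ≤ p₁ → 1 ≤ b → p₁ * b + r + p₅ * a ≤ a * p₁ → p₅ < p₁
    positive-excess {a} {b} {p₁} {p₅} r 1≤p₁ 1≤b =
      <-from-excess (p₁ * b + r) a p₅ p₁ (≤-trans (*-mono-≤ 1≤p₁ 1≤b) (m≤m+n (p₁ * b) r))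

    -- If `P (1 + k)` and `P (8 + k)` are positive, so is the first product in `excess`, and a
    -- strict inequality remains between multiples of `P k`.
    zero-or-< : ∀ k → (∃ λ j → P j ≡ 0) ⊎ P (5 + k) < P (1 + k)
    zero-or-< k with 1 ≤? P (1 + k) | 1 ≤? P (8 + k)
    ... | no 1≰P   | _        = inj₁ (1 + k , n<1⇒n≡0 (≰⇒> 1≰P))
    ... | yes _    | no 1≰P   = inj₁ (8 + k , n<1⇒n≡0 (≰⇒> 1≰P))
    ... | yes 1≤P₁ | yes 1≤P₈ = inj₂ (positive-excess {P k} {P (8 + k)} {P (1 + k)} {P (5 + k)}
        (P (2 + k) * P (9 + k) + P (3 + k) * P (10 + k) + P (4 + k) * P (11 + k)) 1≤P₁ 1≤P₈
        (subst (_≤ P k * P (1 + k)) (cong (_+ P (5 + k) * P k) reassociate) (K.excess k)))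
      where
      reassociate : P (1 + k) * P (8 + k) + P (2 + k) * P (9 + k) + P (3 + k) * P (10 + k) + P (4 + k) * P (11 + k)
        ≡ P (1 + k) * P (8 + k) + (P (2 + k) * P (9 + k) + P (3 + k) * P (10 + k) + P (4 + k) * P (11 + k))
      reassociate = trans (cong (_+ P (4 + k) * P (11 + k)) (+-assoc (P (1 + k) * P (8 + k)) _ _))
        (+-assoc (P (1 + k) * P (8 + k)) _ _)

    -- A backward search from a positive entry to a zero. By `antipodal` a zero at `i` supplies the
    -- positive entry at `6 + i`.
    descent-before : ∀ i n → P i ≡ 0 → 1 ≤ P (n + i) → ∃ λ j → P j ≡ 0 × 1 ≤ P (suc j)
    descent-before i zero    eq 1≤P = contradiction (subst (1 ≤_) eq 1≤P) λ ()
    descent-before i (suc n) eq 1≤P with P (n + i) in eq′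
    ... | zero  = n + i , eq′ , 1≤P
    ... | suc _ = descent-before i n eq (subst (1 ≤_) (sym eq′) (s≤s z≤n))

    descent : ∃ λ j → P j ≡ 0 × 1 ≤ P (suc j)
    descent with zero-or-< 0 | zero-or-< 4 | zero-or-< 8
    ... | inj₁ (i , eq) | _ | _ = descent-before i 6 eq (positive′ eq (antipodal i))
    ... | inj₂ _ | inj₁ (i , eq) | _ = descent-before i 6 eq (positive′ eq (antipodal i))
    ... | inj₂ _ | inj₂ _ | inj₁ (i , eq) = descent-before i 6 eq (positive′ eq (antipodal i))
    ... | inj₂ 5<1 | inj₂ 9<5 | inj₂ 13<9 = contradiction
      (<-trans (subst (_< P 9) (P-period 1) 13<9) (<-trans 9<5 5<1)) (<-irrefl {P 1} refl)

    at-descent : ∀ j → P j ≡ 0 → 1 ≤ P (suc j) → ∀ {x y} → f x ≡ c (13 + j) → f y ≡ c (13 + j) → x ≡ y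
    at-descent j P₀≡0 1≤P₁ = K.singleton-fibre (8 + j) P₈ P₉ P₁₀ P₁₁ (trans (P-period j) P₀≡0)
      where
      total : ℕ
      total = P (1 + j) * P (8 + j) + P (2 + j) * P (9 + j) + P (3 + j) * P (10 + j) + P (4 + j) * P (11 + j)
        + P (5 + j) * P j
      sum≡0 : total ≡ 0
      sum≡0 = n≤0⇒n≡0 (subst (total ≤_) (cong (_* P (1 + j)) P₀≡0) (K.excess j))
      factor : ∀ {a b} → 1 ≤ a → a * b ≡ 0 → b ≡ 0
      factor {suc _} {b} _ eq = m+n≡0⇒m≡0 b eq
      sum₄ = m+n≡0⇒m≡0
        (P (1 + j) * P (8 + j) + P (2 + j) * P (9 + j) + P (3 + j) * P (10 + j) + P (4 + j) * P (11 + j)) sum≡0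
      sum₃ = m+n≡0⇒m≡0 (P (1 + j) * P (8 + j) + P (2 + j) * P (9 + j) + P (3 + j) * P (10 + j)) sum₄
      sum₂ = m+n≡0⇒m≡0 (P (1 + j) * P (8 + j) + P (2 + j) * P (9 + j)) sum₃
      -- All products in `excess` vanish since `P j` does. Alternately, a positive factor makes its
      -- partner zero, and thickness makes the entry opposite that zero positive: the next factor.
      -- With `P (12 + j)` this gives five consecutive zeros.
      P₈ : P (8 + j) ≡ 0
      P₈ = factor 1≤P₁ (m+n≡0⇒m≡0 (P (1 + j) * P (8 + j)) sum₂)
      P₉ : P (9 + j) ≡ 0
      P₉ = factor (positive P₈ (antipodal (2 + j))) (m+n≡0⇒n≡0 (P (1 + j) * P (8 + j)) sum₂)
      P₁₀ : P (10 + j) ≡ 0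
      P₁₀ = factor (positive P₉ (antipodal (3 + j))) (m+n≡0⇒n≡0 (P (1 + j) * P (8 + j) + P (2 + j) * P (9 + j)) sum₃)
      P₁₁ : P (11 + j) ≡ 0
      P₁₁ = factor (positive P₁₀ (antipodal (4 + j)))
        (m+n≡0⇒n≡0 (P (1 + j) * P (8 + j) + P (2 + j) * P (9 + j) + P (3 + j) * P (10 + j)) sum₄)

-- An epimorphism onto the ordinary hexagon with a one-element line fibre

hasCardinality : {P : A → Set} (xs : List A) → Unique xs → (∀ {x} → x ∈ xs → P x) → (∀ {x} → P x → x ∈ xs) →
  HasCardinality P (length xs)
hasCardinality xs xs! sound complete = List.lookup xs , injective xs! , sound ∘ ∈-lookup ,
  λ x px → Any.index (complete px) , sym (Any.lookup-index (complete px))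
  where
  injective : ∀ {xs} → Unique xs → Injective _≡_ _≡_ (List.lookup xs)
  injective (_ ∷ _) {zero} {zero} _ = refl
  injective {_ ∷ xs} (x∉ ∷ _) {zero} {suc j} eq = contradiction eq (All.lookup x∉ (∈-lookup j))
  injective {_ ∷ xs} (x∉ ∷ _) {suc i} {zero} eq = contradiction (sym eq) (All.lookup x∉ (∈-lookup i))
  injective (_ ∷ xs!) {suc i} {suc j} eq = cong suc (injective xs! eq)

module _ {G : Geometry} where

  -- Kinds alternate definitionally here, so that the points and joins of `cycle-naming` are the
  -- terms `pt k` and `ln k` themselves.
  alternate : (ℕ → Line G) → (ℕ → Point G) → ℕ → Element G
  alternate ln pt 0             = inj₂ (ln 0)
  alternate ln pt 1             = inj₁ (pt 0)
  alternate ln pt (suc (suc n)) = alternate (ln ∘ suc) (pt ∘ suc) n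

  cycle-≗ : ∀ {c d} → IsCycle G c → (∀ n → d n ≡ c n) → IsCycle G d
  cycle-≗ C d≗c = record
    { edge   = λ n → subst₂ (Adj G) (sym (d≗c n)) (sym (d≗c (suc n))) (edge n)
    ; turn   = λ n eq → turn n (trans (sym (d≗c n)) (trans eq (d≗c (2 + n))))
    ; period = λ n → trans (d≗c (12 + n)) (trans (period n) (sym (d≗c n)))
    }
    where
    open IsCycle C

  module _ (weak : IsWeakGeneralizedPolygon 6 G) where

    line-cycle-from : ∀ m → ∃₂ λ ln pt → ln 0 ≡ m × IsCycle G (alternate ln pt)
    line-cycle-from m with cycle-from weak (inj₂ m)
    ... | c , C , c₀≡ = (λ k → asLine (c (k * 2))) , (λ k → asPoint (c (suc (k * 2))))
        , cong asLine c₀≡ , cycle-≗ C (alternate≗ C (m , c₀≡))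
      where
      asLine : Element G → Line G
      asLine (inj₁ _) = m
      asLine (inj₂ l) = l
      asPoint : Element G → Point G
      asPoint (inj₁ x) = x
      asPoint (inj₂ _) = IsWeakGeneralizedPolygon.somePoint weak
      alternate≗ : ∀ {c} → IsCycle G c → IsLine {G} (c 0) →
        ∀ n → alternate (λ k → asLine (c (k * 2))) (λ k → asPoint (c (suc (k * 2)))) n ≡ c n
      alternate≗ C (l , eq) 0 = trans (cong (inj₂ ∘ asLine) eq) (sym eq)
      alternate≗ {c} C line 1 = point line (IsCycle.edge C 0)
        where
        point : ∀ {v u} → IsLine {G} v → Adj G v u → inj₁ (asPoint u) ≡ u
        point (_ , refl) (down _) = refl
      alternate≗ {c} C line (suc (suc n)) = alternate≗ {λ k → c (2 + k)}
        (record { edge = λ k → edge (2 + k) ; turn = λ k → turn (2 + k) ; period = λ k → period (2 + k) })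
        (line-after-two line (edge 0) (edge 1)) n
        where
        open IsCycle C

    cycle-≢ : ∀ {c} → IsCycle G c → ∀ i k → 1 ≤ k → k ≤ 11 → c i ≢ c (k + i)
    cycle-≢ {c} C i k 1≤k k≤11 eq = girth>11 weak
      (subst (λ v → Walk (Adj G) (c i) v (segment {G} c i k)) (sym eq) (segment-walk C i k))
      (segment-reduced C i k)
      (subst (1 ≤_) (sym (length-segment {G} c i k)) 1≤k)
      (subst (_≤ 11) (sym (length-segment {G} c i k)) k≤11)

    -- `G` is connected, and an element of the cycle has no neighbours off it. The index `11 + n`
    -- plays the role of `n − 1`.
    cycle-surjective : HasOrder G 1 1 → ∀ {c} → IsCycle G c → ∀ v → ∃ λ n → c n ≡ v
    cycle-surjective order {c} C v with connect weak (c 0) v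
    ... | _ , w , _ = ∈-walk step (12 , IsCycle.period C 0) w
      where
      step : ∀ {v u} → (∃ λ n → c n ≡ v) → Adj G v u → ∃ λ n → c n ≡ u
      step (n , refl) e with only-cycle-nbrs order C (11 + n) (subst (λ v → Adj G v _) (sym (IsCycle.period C n)) e)
      ... | inj₁ eq = _ , sym eq
      ... | inj₂ eq = _ , sym eq

module _ {S G : Geometry} {s t : ℕ}
  (weakS : IsWeakGeneralizedPolygon 6 S) (weakG : IsWeakGeneralizedPolygon 6 G)
  (orderS : HasOrder S s t) (orderG : HasOrder G 1 1) (Φ : Epimorphism S G) where
  open Cover weakS weakG orderS orderG ≤-refl ≤-refl Φ using (f; hom; lift-edge)

  -- Neighbours of an element over `c (suc n)` lie over `c n` or `c (2 + n)`, so excluding one fibre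
  -- identifies the other. Starting from the single line `L` over `c 0`, this describes the fibres
  -- one after another.
  module FibreSteps {c : ℕ → Element G} (C : IsCycle G c) where
    open IsCycle C

    down-nbr : ∀ n {u} → f u ≡ c (suc n) → ∃ λ w → Adj S u w × f w ≡ c n
    down-nbr n eq = lift-edge (subst (λ v → Adj G v (c n)) (sym eq) (adj-sym (edge n)))

    nbr-fibre : ∀ n {u w} → f u ≡ c (suc n) → Adj S u w → f w ≡ c n ⊎ f w ≡ c (2 + n)
    nbr-fibre n eq e = only-cycle-nbrs orderG C n (subst (λ v → Adj G v _) eq (hom e))

    next-line⁺ : ∀ n {m} → f m ≡ c (2 + n) → f m ≢ c n × ∃ λ q → f q ≡ c (suc n) × Adj S q m
    next-line⁺ n eq = let q , e , q∈ = down-nbr (suc n) eq in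
      (λ eq′ → turn n (trans (sym eq′) eq)) , q , q∈ , adj-sym e

    next-line⁻ : ∀ n {m q} → f m ≢ c n → f q ≡ c (suc n) → Adj S q m → f m ≡ c (2 + n)
    next-line⁻ n m∉ q∈ e with nbr-fibre n q∈ e
    ... | inj₁ m∈ = contradiction m∈ m∉
    ... | inj₂ m∈ = m∈

    two-down : ∀ n {p} → f p ≡ c (2 + n) → ∃₂ λ q l → f q ≡ c n × Adj S p l × Adj S q l
    two-down n {p} p∈ = from-line (down-nbr (suc n) {p} p∈)
      where
      from-point : ∀ l → Adj S p l → (∃ λ q → Adj S l q × f q ≡ c n) →
        ∃₂ λ q l → f q ≡ c n × Adj S p l × Adj S q l
      from-point l e (q , d , q∈) = q , l , q∈ , e , adj-sym d
      from-line : (∃ λ l → Adj S p l × f l ≡ c (suc n)) → ∃₂ λ q l → f q ≡ c n × Adj S p l × Adj S q l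
      from-line (l , e , l∈) = from-point l e (down-nbr n {l} l∈)

    next-point⁺ : ∀ n {p} → f p ≡ c (4 + n) →
      f p ≢ c n × f p ≢ c (2 + n) × ∃₂ λ q l → f q ≡ c (2 + n) × Adj S p l × Adj S q l
    next-point⁺ n {p} eq =
        (λ eq′ → cycle-≢ weakG C n 4 (s≤s z≤n) (m≤m+n 4 7) (trans (sym eq′) eq))
      , (λ eq′ → turn (2 + n) (trans (sym eq′) eq))
      , two-down (2 + n) {p} eq

    next-point⁻ : ∀ n {p q l} → f p ≢ c n → f p ≢ c (2 + n) → f q ≡ c (2 + n) → Adj S p l → Adj S q l →
      f p ≡ c (4 + n)
    next-point⁻ n p∉ p∉′ q∈ e d with nbr-fibre (suc n) q∈ d
    ... | inj₁ l∈ = contradiction (nbr-fibre n l∈ (adj-sym e)) [ p∉ , p∉′ ]′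
    ... | inj₂ l∈ with nbr-fibre (2 + n) l∈ (adj-sym e)
    ...   | inj₁ p∈ = contradiction p∈ p∉′
    ...   | inj₂ p∈ = p∈

    module _ {L : Element S} (L∈ : f L ≡ c 0) (L! : ∀ l → f l ≡ c 0 → l ≡ L) where

      on-L⁺ : ∀ {p} → f p ≡ c 1 → Adj S p L
      on-L⁺ {p} p∈ = via (down-nbr 0 {p} p∈)
        where
        via : (∃ λ l → Adj S p l × f l ≡ c 0) → Adj S p L
        via (l , e , l∈) = subst (Adj S p) (L! l l∈) e

      on-L⁻ : ∀ {p} → Adj S p L → f p ≡ c 1 ⊎ f p ≡ c 11
      on-L⁻ e with nbr-fibre 11 (trans L∈ (sym (period 0))) (adj-sym e)
      ... | inj₁ p∈ = inj₂ p∈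
      ... | inj₂ p∈ = inj₁ (trans p∈ (period 1))

      first-line⁺ : ∀ {m} → f m ≡ c 2 → m ≢ L × ∃ λ q → f q ≡ c 1 × Adj S q m
      first-line⁺ {m} m∈ =
        let m∉ , met = next-line⁺ 0 {m} m∈ in
        (λ m≡L → m∉ (subst (λ m → f m ≡ c 0) (sym m≡L) L∈)) , met

      first-line⁻ : ∀ {m q} → m ≢ L → f q ≡ c 1 → Adj S q m → f m ≡ c 2
      first-line⁻ {m} {q} m≢L = next-line⁻ 0 {m} {q} (m≢L ∘ L! m)

      first-point⁺ : ∀ {p} → f p ≡ c 3 → ¬ Adj S p L × ∃₂ λ q l → f q ≡ c 1 × Adj S p l × Adj S q l
      first-point⁺ {p} p∈ = (λ p∈L → not-next-to-L (on-L⁻ {p} p∈L)) , two-down 1 {p} p∈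
        where
        not-next-to-L : ¬ (f p ≡ c 1 ⊎ f p ≡ c 11)
        not-next-to-L (inj₁ p∈′) = turn 1 (trans (sym p∈′) p∈)
        not-next-to-L (inj₂ p∈′) = cycle-≢ weakG C 3 8 (s≤s z≤n) (m≤m+n 8 3) (trans (sym p∈) p∈′)

      first-point⁻ : ∀ {p q l} → ¬ Adj S p L → f q ≡ c 1 → Adj S p l → Adj S q l → f p ≡ c 3
      first-point⁻ {p} {q} {l} p∉L q∈ e d with nbr-fibre 0 {q} {l} q∈ d
      ... | inj₁ l∈ = contradiction (subst (Adj S p) (L! l l∈) e) p∉L
      ... | inj₂ l∈ with nbr-fibre 1 l∈ (adj-sym e)
      ...   | inj₁ p∈ = contradiction (on-L⁺ p∈) p∉L
      ...   | inj₂ p∈ = p∈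

module _ {S G : Geometry} {s t : ℕ}
  (weakS : IsWeakGeneralizedPolygon 6 S) (weakG : IsWeakGeneralizedPolygon 6 G)
  (orderS : HasOrder S s t) (orderG : HasOrder G 1 1) (Φ : Epimorphism S G) where
  open Cover weakS weakG orderS orderG ≤-refl ≤-refl Φ using (f)
  open Epimorphism Φ
  open Geometry S using (_I_; CollinearWith; Meets)

  private
    Adj⇒I : ∀ {x l} → Adj S (inj₁ x) (inj₂ l) → x I l
    Adj⇒I (up e) = e

    Over : Point G → Pred (Point S) 0ℓ
    Over x p = onPoint p ≡ x

    Overₗ : Line G → Pred (Line S) 0ℓ
    Overₗ l m = onLine m ≡ l

  -- One side of `L`; it is used for the cycle and for its reverse, which exchanges C̃, D̃, Ẽ with
  -- B̃, Ã, F̃. The elements of `d` are given by equations because those of the reverse reduce to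
  -- `pt k` and `ln k` only after applying the period.
  module Side {d : ℕ → Element G} (D : IsCycle G d)
    (L : Line S) (L∈ : f (inj₂ L) ≡ d 0) (L! : ∀ l → f l ≡ d 0 → l ≡ inj₂ L)
    {x₁ x₃ x₅ : Point G} {l₂ l₄ l₆ : Line G}
    (d₁ : d 1 ≡ inj₁ x₁) (d₂ : d 2 ≡ inj₂ l₂) (d₃ : d 3 ≡ inj₁ x₃)
    (d₄ : d 4 ≡ inj₂ l₄) (d₅ : d 5 ≡ inj₁ x₅) (d₆ : d 6 ≡ inj₂ l₆) where
    open FibreSteps weakS weakG orderS orderG Φ D

    point⁺ : ∀ {n x p} → d n ≡ inj₁ x → onPoint p ≡ x → f (inj₁ p) ≡ d n
    point⁺ dn eq = trans (cong inj₁ eq) (sym dn)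

    point⁻ : ∀ {n x p} → d n ≡ inj₁ x → f (inj₁ p) ≡ d n → onPoint p ≡ x
    point⁻ dn eq = inj₁-injective (trans eq dn)

    line⁺ : ∀ {n l m} → d n ≡ inj₂ l → onLine m ≡ l → f (inj₂ m) ≡ d n
    line⁺ dn eq = trans (cong inj₂ eq) (sym dn)

    line⁻ : ∀ {n l m} → d n ≡ inj₂ l → f (inj₂ m) ≡ d n → onLine m ≡ l
    line⁻ dn eq = inj₂-injective (trans eq dn)

    meets⁺ : ∀ {n x m} → d n ≡ inj₁ x → (∃ λ q → f q ≡ d n × Adj S q (inj₂ m)) → m ∈ᵖ Meets (Over x)
    meets⁺ {n} {x} dn (inj₁ q , q∈ , up e) = q , point⁻ {n} {x} {q} dn q∈ , e

    collinear⁺ : ∀ {n x p} → d n ≡ inj₁ x → (∃₂ λ q l → f q ≡ d n × Adj S (inj₁ p) l × Adj S q l) →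
      p ∈ᵖ CollinearWith (Over x)
    collinear⁺ {n} {x} dn (inj₁ q , inj₂ l , q∈ , up e , up e′) = q , point⁻ {n} {x} {q} dn q∈ , l , e , e′

    lines₂ : Overₗ l₂ ≐ (λ m → m ≢ L × m ∈ᵖ Meets (Over x₁))
    lines₂ =
      (λ {m} m∈ → let m≢L , met = first-line⁺ {inj₂ L} L∈ L! {inj₂ m} (line⁺ {2} d₂ m∈) in
        (m≢L ∘ cong inj₂) , meets⁺ {1} d₁ met) ,
      (λ {m} (m≢L , q , q∈ , e) → line⁻ {2} d₂
        (first-line⁻ {inj₂ L} L∈ L! {inj₂ m} {inj₁ q} (m≢L ∘ inj₂-injective) (point⁺ {1} d₁ q∈) (up e)))

    next-lines : ∀ n {l l′ x} → d n ≡ inj₂ l → d (1 + n) ≡ inj₁ x → d (2 + n) ≡ inj₂ l′ →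
      Overₗ l′ ≐ (λ m → ¬ Overₗ l m × m ∈ᵖ Meets (Over x))
    next-lines n dl dx dl′ =
      (λ {m} m∈ → let m∉ , met = next-line⁺ n {inj₂ m} (line⁺ {2 + n} dl′ m∈) in
        (m∉ ∘ line⁺ {n} dl) , meets⁺ {1 + n} dx met) ,
      (λ {m} (m∉ , q , q∈ , e) → line⁻ {2 + n} dl′
        (next-line⁻ n {inj₂ m} {inj₁ q} (m∉ ∘ line⁻ {n} dl) (point⁺ {1 + n} dx q∈) (up e)))

    lines₄ : Overₗ l₄ ≐ (λ m → ¬ Overₗ l₂ m × m ∈ᵖ Meets (Over x₃))
    lines₄ = next-lines 2 d₂ d₃ d₄

    lines₆ : Overₗ l₆ ≐ (λ m → ¬ Overₗ l₄ m × m ∈ᵖ Meets (Over x₅))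
    lines₆ = next-lines 4 d₄ d₅ d₆

    points₃ : Over x₃ ≐ (λ p → ¬ (p I L) × p ∈ᵖ CollinearWith (Over x₁))
    points₃ =
      (λ {p} p∈ → let p∉L , col = first-point⁺ {inj₂ L} L∈ L! {inj₁ p} (point⁺ {3} d₃ p∈) in
        (p∉L ∘ up) , collinear⁺ {1} d₁ col) ,
      (λ {p} (p∉L , q , q∈ , l , e , e′) → point⁻ {3} d₃
        (first-point⁻ {inj₂ L} L∈ L! {inj₁ p} {inj₁ q} {inj₂ l} (p∉L ∘ Adj⇒I) (point⁺ {1} d₁ q∈) (up e) (up e′)))

    points₅ : Over x₅ ≐ (λ p → (¬ Over x₁ p × ¬ Over x₃ p) × p ∈ᵖ CollinearWith (Over x₃))
    points₅ =
      (λ {p} p∈ → let p∉₁ , p∉₃ , col = next-point⁺ 1 {inj₁ p} (point⁺ {5} d₅ p∈) in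
        ((p∉₁ ∘ point⁺ {1} d₁) , (p∉₃ ∘ point⁺ {3} d₃)) , collinear⁺ {3} d₃ col) ,
      (λ {p} ((p∉₁ , p∉₃) , q , q∈ , l , e , e′) → point⁻ {5} d₅
        (next-point⁻ 1 {inj₁ p} {inj₁ q} {inj₂ l} (p∉₁ ∘ point⁻ {1} d₁) (p∉₃ ∘ point⁻ {3} d₃)
          (point⁺ {3} d₃ q∈) (up e) (up e′)))

    on-L : ∀ {p} → p I L → Over x₁ p ⊎ f (inj₁ p) ≡ d 11
    on-L {p} e with on-L⁻ {inj₂ L} L∈ L! {inj₁ p} (up e)
    ... | inj₁ eq = inj₁ (point⁻ {1} d₁ eq)
    ... | inj₂ eq = inj₂ eq

    L-through : ∀ {p} → Over x₁ p → p I L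
    L-through {p} p∈ = Adj⇒I (on-L⁺ {inj₂ L} L∈ L! {inj₁ p} (point⁺ {1} d₁ p∈))

incident : ∀ {G x l} → Adj G (inj₁ x) (inj₂ l) → Geometry._I_ G x l
incident (up e) = e

incident′ : ∀ {G x l} → Adj G (inj₂ l) (inj₁ x) → Geometry._I_ G x l
incident′ (down e) = e

module _ {G : Geometry} (weak : IsWeakGeneralizedPolygon 6 G) (order : HasOrder G 1 1)
  (ln : ℕ → Line G) (pt : ℕ → Point G) (C : IsCycle G (alternate {G} ln pt)) where
  open IsCycle C
  private
    c = alternate {G} ln pt

    apart : ∀ i k → 1 ≤ k → k ≤ 11 → c i ≢ c (k + i)
    apart = cycle-≢ weak C

    ≢-points : ∀ {x y : Point G} {i j} → c i ≡ inj₁ x → c j ≡ inj₁ y → c i ≢ c j → x ≢ y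
    ≢-points ci cj ci≢cj refl = ci≢cj (trans ci (sym cj))

  points-of-cycle : ∀ n {x} → c n ≡ inj₁ x → x ∈ pt 4 ∷ pt 5 ∷ pt 0 ∷ pt 1 ∷ pt 2 ∷ pt 3 ∷ []
  points-of-cycle 1  eq = there (there (here (sym (inj₁-injective eq))))
  points-of-cycle 3  eq = there (there (there (here (sym (inj₁-injective eq)))))
  points-of-cycle 5  eq = there (there (there (there (here (sym (inj₁-injective eq))))))
  points-of-cycle 7  eq = there (there (there (there (there (here (sym (inj₁-injective eq)))))))
  points-of-cycle 9  eq = here (sym (inj₁-injective eq))
  points-of-cycle 11 eq = there (here (sym (inj₁-injective eq)))
  points-of-cycle (suc (suc (suc (suc (suc (suc (suc (suc (suc (suc (suc (suc n)))))))))))) eq =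
    points-of-cycle n (trans (sym (period n)) eq)

  -- The centre ln 0 of the cycle is the line joining b and c.
  cycle-naming : HexagonNaming G
  cycle-naming = record
    { a = pt 4 ; b = pt 5 ; c = pt 0 ; d = pt 1 ; e = pt 2 ; f = pt 3
    ; distinct =
        (≢-points {i = 9} {11} refl refl (apart 9 2 (s≤s z≤n) (m≤m+n 2 9)) ∷
         ≢-points {i = 9} {1} refl refl (≢-sym (apart 1 8 (s≤s z≤n) (m≤m+n 8 3))) ∷
         ≢-points {i = 9} {3} refl refl (≢-sym (apart 3 6 (s≤s z≤n) (m≤m+n 6 5))) ∷
         ≢-points {i = 9} {5} refl refl (≢-sym (apart 5 4 (s≤s z≤n) (m≤m+n 4 7))) ∷
         ≢-points {i = 9} {7} refl refl (≢-sym (apart 7 2 (s≤s z≤n) (m≤m+n 2 9))) ∷ []) ∷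
        (≢-points {i = 11} {1} refl refl (≢-sym (apart 1 10 (s≤s z≤n) (m≤m+n 10 1))) ∷
         ≢-points {i = 11} {3} refl refl (≢-sym (apart 3 8 (s≤s z≤n) (m≤m+n 8 3))) ∷
         ≢-points {i = 11} {5} refl refl (≢-sym (apart 5 6 (s≤s z≤n) (m≤m+n 6 5))) ∷
         ≢-points {i = 11} {7} refl refl (≢-sym (apart 7 4 (s≤s z≤n) (m≤m+n 4 7))) ∷ []) ∷
        (≢-points {i = 1} {3} refl refl (apart 1 2 (s≤s z≤n) (m≤m+n 2 9)) ∷
         ≢-points {i = 1} {5} refl refl (apart 1 4 (s≤s z≤n) (m≤m+n 4 7)) ∷
         ≢-points {i = 1} {7} refl refl (apart 1 6 (s≤s z≤n) (m≤m+n 6 5)) ∷ []) ∷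
        (≢-points {i = 3} {5} refl refl (apart 3 2 (s≤s z≤n) (m≤m+n 2 9)) ∷
         ≢-points {i = 3} {7} refl refl (apart 3 4 (s≤s z≤n) (m≤m+n 4 7)) ∷ []) ∷
        (≢-points {i = 5} {7} refl refl (apart 5 2 (s≤s z≤n) (m≤m+n 2 9)) ∷ []) ∷ [] ∷ []
    ; exhaustive = λ x → let n , eq = cycle-surjective weak order C (inj₁ x) in points-of-cycle n eq
    ; a∼b = ln 5 , incident (edge 9) , incident′ (edge 10)
    ; b∼c = ln 0 , incident (subst (Adj G (c 11)) (period 0) (edge 11)) , incident′ (edge 0)
    ; c∼d = ln 1 , incident (edge 1) , incident′ (edge 2)
    ; d∼e = ln 2 , incident (edge 3) , incident′ (edge 4)
    ; e∼f = ln 3 , incident (edge 5) , incident′ (edge 6)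
    ; f∼a = ln 4 , incident (edge 7) , incident′ (edge 8)
    }

module _ {S G : Geometry} {s t : ℕ}
  (weakS : IsWeakGeneralizedPolygon 6 S) (weakG : IsWeakGeneralizedPolygon 6 G)
  (orderS : HasOrder S s t) (orderG : HasOrder G 1 1) (Φ : Epimorphism S G) where
  open Cover weakS weakG orderS orderG ≤-refl ≤-refl Φ using (f)
  open Epimorphism Φ
  open Geometry S using (_I_)

  private
    _≟ᵖ_ : DecidableEquality (Point G)
    x ≟ᵖ y = map′ inj₁-injective (cong inj₁) (_≟ₑ_ weakG (inj₁ x) (inj₁ y))

    fibre-cardinality : ∀ {L} x → (∀ {p} → onPoint p ≡ x → p I L) → (∃ λ q → q I L × onPoint q ≢ x) →
      ∃ λ n → HasCardinality (λ p → onPoint p ≡ x) n × 1 ≤ n × n ≤ s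
    fibre-cardinality {L} x x⊆L (q , qIL , q∉) = length ps
      , hasCardinality ps ps! (λ p∈ → proj₂ (∈-filter⁻ over? p∈)) complete
      , nonempty (complete (proj₂ (onPoint-surjective x)))
      -- Together with `q`, which lies on `L` outside the fibre, the fibre still fits into the
      -- `s + 1` points of `L`.
      , s≤s⁻¹ (subst (suc (length ps) ≤_) (List.length-tabulate h)
          (unique-⊆⇒length-≤
            (All.tabulate (λ { p∈ refl → q∉ (proj₂ (∈-filter⁻ over? {xs = tabulate h} p∈)) }) ∷ ps!)
            (tabulate h)
            λ { (here refl) → on-L qIL ; (there p∈) → proj₁ (∈-filter⁻ over? p∈) }))
      where
      h = proj₁ (proj₁ orderS L)
      over? = λ p → onPoint p ≟ᵖ x
      ps : List (Point S)
      ps = filter over? (tabulate h)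
      ps! : Unique ps
      ps! = Unique.filter⁺ over? (Unique.tabulate⁺ (proj₁ (proj₂ (proj₁ orderS L))))
      on-L : ∀ {p} → p I L → p ∈ tabulate h
      on-L {p} e = let i , eq = proj₂ (proj₂ (proj₂ (proj₁ orderS L))) p e in
        subst (_∈ tabulate h) eq (∈-tabulate⁺ {f = h} i)
      complete : ∀ {p} → onPoint p ≡ x → p ∈ ps
      complete p∈ = ∈-filter⁺ over? (on-L (x⊆L p∈)) p∈
      nonempty : ∀ {p ps} → p ∈ ps → 1 ≤ length {A = Point S} ps
      nonempty (here _)  = s≤s z≤n
      nonempty (there _) = s≤s z≤n

  singleton-line⇒classA : ∀ m → (∀ {l l′} → onLine l ≡ m → onLine l′ ≡ m → l ≡ l′) → IsClassA s Φ
  singleton-line⇒classA m single = classA (line-cycle-from weakG m)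
    where
    L : Line S
    L = proj₁ (onLine-surjective m)
    L∈ : onLine L ≡ m
    L∈ = proj₂ (onLine-surjective m)
    L! : ∀ l → f l ≡ inj₂ m → l ≡ inj₂ L
    L! (inj₂ l) l∈ = cong inj₂ (single (inj₂-injective l∈) L∈)
    classA : (∃₂ λ ln pt → ln 0 ≡ m × IsCycle G (alternate {G} ln pt)) → IsClassA s Φ
    classA (ln , pt , refl , C) = record
      { naming = cycle-naming weakG orderG ln pt C
      ; L = L
      ; L-points = (λ { {p} (inj₁ p∈C) → Right.L-through p∈C ; {p} (inj₂ p∈B) → Left.L-through p∈B })
                 , (λ {p} e → [ inj₁ , inj₂ ∘ inj₁-injective ]′ (Right.on-L {p} e))
      ; C̃⊥B̃ = λ (p∈C , p∈B) → C≢B (trans (sym p∈C) p∈B)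
      ; card-C̃ = fibre-cardinality {L} (pt 0) Right.L-through
          (proj₁ b̃ , Left.L-through (proj₂ b̃) , λ b∈C → C≢B (trans (sym b∈C) (proj₂ b̃)))
      ; card-B̃ = fibre-cardinality {L} (pt 5) Left.L-through
          (proj₁ c̃ , Right.L-through (proj₂ c̃) , λ c∈B → C≢B (trans (sym (proj₂ c̃)) c∈B))
      ; D̃-points = Right.points₃
      ; Ã-points = Left.points₃
      ; Ẽ-points = (λ p∈ → let (n₁ , n₃) , col = proj₁ Right.points₅ p∈ in [ n₁ , n₃ ]′ , col)
                 , (λ (n , col) → proj₂ Right.points₅ ((n ∘ inj₁ , n ∘ inj₂) , col))
      ; F̃-points = (λ p∈ → let (n₁ , n₃) , col = proj₁ Left.points₅ p∈ in [ n₃ , n₁ ]′ , col)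
                 , (λ (n , col) → proj₂ Left.points₅ ((n ∘ inj₂ , n ∘ inj₁) , col))
      ; bc-lines = (λ l∈ → single l∈ L∈) , λ { refl → L∈ }
      ; cd-lines = Right.lines₂
      ; ab-lines = Left.lines₂
      ; de-lines = Right.lines₄
      ; fa-lines = Left.lines₄
      ; ef-linesF = Left.lines₆
      ; ef-linesE = Right.lines₆
      }
      where
      open IsCycle C
      module Right = Side weakS weakG orderS orderG Φ C L (cong inj₂ L∈) L!
        {pt 0} {pt 1} {pt 2} {ln 1} {ln 2} {ln 3} refl refl refl refl refl refl
      module Left = Side weakS weakG orderS orderG Φ {λ n → alternate {G} ln pt (n * 11)} (reverse C)
        L (cong inj₂ L∈) L!
        {pt 5} {pt 4} {pt 3} {ln 5} {ln 4} {ln 3}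
        refl (period* 1 10) (period* 2 9) (period* 3 8) (period* 4 7) (period* 5 6)
      b̃ = onPoint-surjective (pt 5)
      c̃ = onPoint-surjective (pt 0)
      C≢B : pt 0 ≢ pt 5
      C≢B eq = cycle-≢ weakG C 1 10 (s≤s z≤n) (m≤m+n 10 1) (cong inj₁ eq)

-- The classification

swap-order : ∀ {G u v} → HasOrder G u v → HasOrder (dual G) v u
swap-order (points , lines) = lines , points

dual-thick : ∀ {G} → IsThick G → IsThick (dual G)
dual-thick (points , lines) = lines , points

epimorphism-classes : ∀ S G s t s′ → IsFiniteThickHexagon S s t → IsThinHexagon G s′ →
  (Φ : Epimorphism S G) → s′ ≡ 1 × (IsClassA s Φ ⊎ IsClassB t Φ)
epimorphism-classes S G s t s′ hexagon thin Φ
  with s′≡1 S.isWeak T.isWeak S.hasOrder T.hasOrder T.1≤s′ S.isThick Φ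
  where
  module S = IsFiniteThickHexagon hexagon
  module T = IsThinHexagon thin
... | refl = refl , classes (fibre-is-singleton S.isWeak T.isWeak S.hasOrder T.hasOrder T.1≤s′ S.isThick Φ refl)
  where
  module S = IsFiniteThickHexagon hexagon
  module T = IsThinHexagon thin
  open Cover S.isWeak T.isWeak S.hasOrder T.hasOrder T.1≤s′ ≤-refl Φ using (f)
  classes : (∃ λ v → ∀ {x y} → f x ≡ v → f y ≡ v → x ≡ y) → IsClassA s Φ ⊎ IsClassB t Φ
  classes (inj₂ m , single) = inj₁ (singleton-line⇒classA S.isWeak T.isWeak S.hasOrder T.hasOrder Φ m
    λ {l} {l′} l∈ l∈′ → inj₂-injective (single {inj₂ l} {inj₂ l′} (cong inj₂ l∈) (cong inj₂ l∈′)))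
  classes (inj₁ x , single) = inj₂ (singleton-line⇒classA (dual-isWeak S.isWeak) (dual-isWeak T.isWeak)
    (swap-order {S} S.hasOrder) (swap-order {G} T.hasOrder) (dualEpimorphism Φ) x
    λ {p} {p′} p∈ p∈′ → inj₁-injective (single {inj₁ p} {inj₁ p′} (cong inj₁ p∈) (cong inj₁ p∈′)))

-- Folding a thick hexagon onto the ordinary one

at-least-≤ : ∀ {P : A → Set} {m n} → AtLeast m P → HasCardinality P n → m ≤ n
at-least-≤ {P = P} (h , inj , h∈) (k , _ , _ , onto) =
  subst₂ _≤_ (List.length-tabulate h) (List.length-tabulate k)
    (unique-⊆⇒length-≤ (Unique.tabulate⁺ inj) (tabulate k) λ x∈ → case ∈-tabulate⁻ {f = h} x∈ of λ where
      (i , refl) → let j , eq = onto (h i) (h∈ i) in subst (_∈ tabulate k) eq (∈-tabulate⁺ {f = k} j))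

-- The folding is built on points and lines at once; this relation splits it into its two maps.
data SameKind {S G : Geometry} : Element S → Element G → Set where
  point-point : ∀ {x y} → SameKind (inj₁ x) (inj₁ y)
  line-line  : ∀ {l m} → SameKind (inj₂ l) (inj₂ m)

module _ {S G : Geometry} {s t : ℕ}
  (weakS : IsWeakGeneralizedPolygon 6 S) (weakG : IsWeakGeneralizedPolygon 6 G)
  (orderS : HasOrder S s t) (orderG : HasOrder G 1 1) (thick : IsThick S)
  (ln : ℕ → Line G) (pt : ℕ → Point G) (C : IsCycle G (alternate {G} ln pt)) where
  open Geometry S using (_I_)
  open IsCycle C

  private
    c : ℕ → Element G
    c = alternate {G} ln pt

    _≟_ : DecidableEquality (Element S)
    _≟_ = _≟ₑ_ weakS

    L : Line S
    L = proj₁ (proj₁ thick (IsWeakGeneralizedPolygon.somePoint {6} weakS)) zero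

    x₀ x₁ : Element S
    x₀ = inj₁ (proj₁ (proj₂ thick L) zero)
    x₁ = inj₁ (proj₁ (proj₂ thick L) (suc zero))

    x₁≢x₀ : x₁ ≢ x₀
    x₁≢x₀ eq = case proj₁ (proj₂ (proj₂ thick L)) (inj₁-injective eq) of λ ()

    through-x₀ : Element S → List (Element S) → Bool
    -- The empty walk at `L` passes no point of `L`; either value leads to `c 0`.
    through-x₀ x []           = true
    through-x₀ x (_ ∷ [])     = does (x ≟ x₀)
    through-x₀ x (y ∷ z ∷ zs) = through-x₀ y (z ∷ zs)

    place : Bool → ℕ → Element G
    place true  n = c n
    place false n = c (n * 11)

    place-edge : ∀ b n → Adj G (place b (suc n)) (place b n)
    place-edge true  n = adj-sym (edge n)
    place-edge false n = adj-sym (IsCycle.edge (reverse C) n)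

    place-0 : ∀ b → place b 0 ≡ c 0
    place-0 true  = refl
    place-0 false = refl

    place-6 : ∀ b → place b 6 ≡ c 6
    place-6 true  = refl
    place-6 false = period* 5 6

    place-≢0 : ∀ b n → 1 ≤ n → n ≤ 6 → place b n ≢ c 0
    place-≢0 true  n 1≤n n≤6 eq = cycle-≢ weakG C 0 n 1≤n (≤-trans n≤6 (m≤m+n 6 5))
      (trans (sym eq) (cong c (sym (+-identityʳ n))))
    place-≢0 false n 1≤n n≤6 eq = cycle-≢ weakG (reverse C) 0 n 1≤n (≤-trans n≤6 (m≤m+n 6 5))
      (trans (sym eq) (cong (λ k → c (k * 11)) (sym (+-identityʳ n))))

    image : Element S → List (Element S) → Element G
    image x ys = place (through-x₀ x ys) (length ys)

    image-step : ∀ x y ys → Adj G (image x (y ∷ ys)) (image y ys)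
    image-step x y []       = subst (Adj G (place (does (x ≟ x₀)) 1)) (place-0 (does (x ≟ x₀)))
      (place-edge (does (x ≟ x₀)) 0)
    image-step x y (z ∷ zs) = place-edge (through-x₀ y (z ∷ zs)) (length (z ∷ zs))

    Geodesic : Element S → List (Element S) → Set
    Geodesic x ys = Walk (Adj S) x (inj₂ L) ys × Reduced (x ∷ ys) × length ys ≤ 6

    -- By the girth only two walks of length 6 can differ. Their signs may disagree then, but both
    -- signs lead to `c 6`, the place opposite `c 0`.
    image-unique : ∀ x ys zs → Geodesic x ys → Geodesic x zs → image x ys ≡ image x zs
    image-unique x ys zs (v , r , ≤6) (w , r′ , ≤6′) with length ys + length zs ≤? 11
    ... | yes ≤11 = cong (image x) (walk-unique weakS ys zs v w r r′ ≤11)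
    ... | no ≰11  = trans (at-6 ys (six ≤6 ≤6′ (≰⇒> ≰11)))
      (sym (at-6 zs (six ≤6′ ≤6 (subst (12 ≤_) (+-comm (length ys) (length zs)) (≰⇒> ≰11)))))
      where
      at-6 : ∀ ys → length ys ≡ 6 → image x ys ≡ c 6
      at-6 ys eq = trans (cong (place (through-x₀ x ys)) eq) (place-6 (through-x₀ x ys))
      six : ∀ {a b} → a ≤ 6 → b ≤ 6 → 12 ≤ a + b → a ≡ 6
      six {a} a≤6 b≤6 12≤ = ≤-antisym a≤6 (+-cancelʳ-≤ 6 6 a (≤-trans 12≤ (+-monoʳ-≤ a b≤6)))

    geodesic : ∀ x → ∃ (Geodesic x)
    geodesic x = connect weakS x (inj₂ L)

    F : Element S → Element G
    F x = image x (proj₁ (geodesic x))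

    F≡ : ∀ x ys → Geodesic x ys → F x ≡ image x ys
    F≡ x ys g = image-unique x (proj₁ (geodesic x)) ys (proj₂ (geodesic x)) g

    even-walk : ∀ {p z ys} → Walk (Adj S) (inj₁ p) z ys → length ys ≡ 6 → ∃ λ q → z ≡ inj₁ q
    even-walk (up _ ∷ down _ ∷ up _ ∷ down _ ∷ up _ ∷ down _ ∷ []) _ = _ , refl

    F-incident : ∀ {p l} → p I l → Adj G (F (inj₁ p)) (F (inj₂ l))
    F-incident {p} {l} e with geodesic (inj₁ p)
    ... | y ∷ ys , d ∷ w , r , ≤6 with y ≟ inj₂ l
    ...   | yes refl = subst (Adj G (image (inj₁ p) (y ∷ ys))) 
                           (sym (F≡ (inj₂ l) ys (w , reduced-tail _ r , ≤-trans (n≤1+n _) ≤6)))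
                         (image-step (inj₁ p) y ys)
    -- A walk of length 6 from a point ends in a point, so the walk from `p` to `L` has length at
    -- most 5 and may be prolonged by `l`.
    ...   | no y≢l   = subst (Adj G (image (inj₁ p) (y ∷ ys))) (sym (F≡ (inj₂ l) (inj₁ p ∷ y ∷ ys)
                           (down e ∷ d ∷ w , (≢-sym y≢l , r) , ≤∧≢⇒< ≤6 λ eq → case even-walk (d ∷ w) eq of λ ())))
                         (adj-sym (image-step (inj₂ l) (inj₁ p) (y ∷ ys)))

    same-kind-step : ∀ {x y v u} → SameKind {S} {G} x v → Adj S y x → Adj G u v → SameKind {S} {G} y u
    same-kind-step point-point (down _) (down _) = line-line
    same-kind-step line-line  (up _)   (up _)   = point-point

    image-kind : ∀ {x ys} → Walk (Adj S) x (inj₂ L) ys → SameKind {S} {G} x (image x ys)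
    image-kind [] = line-line
    image-kind {x} {y ∷ ys} (e ∷ w) = same-kind-step (image-kind w) e (image-step x y ys)

    F-kind : ∀ x → SameKind {S} {G} x (F x)
    F-kind x = image-kind (proj₁ (proj₂ (geodesic x)))

    -- Walking away from `L` through `x` reaches each distance up to 6 and never changes the sign,
    -- as the sign depends on `x` only.
    grow : ∀ {x} → Adj S x (inj₂ L) → ∀ n → n ≤ 5 → ∃ λ y → F y ≡ place (does (x ≟ x₀)) (suc n)
    grow {x} e n n≤5 with walks n
      where
      1≤s : 1 ≤ s
      1≤s = ≤-trans (n≤1+n 1) (s≤s⁻¹ (at-least-≤ (proj₂ thick L) (proj₁ orderS L)))
      1≤t : 1 ≤ t
      1≤t = let p = IsWeakGeneralizedPolygon.somePoint {6} weakS in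
        ≤-trans (n≤1+n 1) (s≤s⁻¹ (at-least-≤ (proj₁ thick p) (proj₂ orderS p)))
      walks : ∀ n → ∃₂ λ y z → ∃ λ zs → Walk (Adj S) y (inj₂ L) (z ∷ zs) × Reduced (y ∷ z ∷ zs) ×
        length zs ≡ n × through-x₀ y (z ∷ zs) ≡ does (x ≟ x₀)
      walks zero = x , inj₂ L , [] , e ∷ [] , tt , refl , refl
      walks (suc n) with walks n
      ... | y , z , zs , d ∷ w , r , len , side with another-nbr _≟_ orderS 1≤s 1≤t z (adj-sym d)
      ...   | y′ , d′ , z≢y′ = y′ , y , z ∷ zs , adj-sym d′ ∷ d ∷ w , (≢-sym z≢y′ , r) , cong suc len , side
    ... | y , z , zs , w , r , len , side = y , trans
      (F≡ y (z ∷ zs) (w , r , s≤s (subst (_≤ 5) (sym len) n≤5)))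
      (cong₂ place side (cong suc len))

    F-surjective : ∀ v → ∃ λ x → F x ≡ v
    F-surjective v with cycle-surjective weakG orderG C v
    ... | n , refl with within-half C n
    ...   | zero , _ , eq = inj₂ L , trans (F≡ (inj₂ L) [] ([] , tt , z≤n)) (sym ([ id , id ]′ eq))
    ...   | suc k , s≤s k≤5 , inj₁ eq = let y , Fy≡ = grow {x₀} (up (proj₂ (proj₂ (proj₂ thick L)) zero)) k k≤5 in
      y , trans Fy≡ (trans (cong (λ b → place b (suc k)) (dec-true (x₀ ≟ x₀) refl)) (sym eq))
    ...   | suc k , s≤s k≤5 , inj₂ eq = let y , Fy≡ = grow {x₁} (up (proj₂ (proj₂ (proj₂ thick L)) (suc zero))) k k≤5 in
      y , trans Fy≡ (trans (cong (λ b → place b (suc k)) (dec-false (x₁ ≟ x₀) x₁≢x₀)) (sym eq))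

    pointOf : ∀ {p v} → SameKind {S} {G} (inj₁ p) v → Point G
    pointOf (point-point {y = y}) = y

    pointOf≡ : ∀ {p v} (k : SameKind {S} {G} (inj₁ p) v) → inj₁ (pointOf k) ≡ v
    pointOf≡ point-point = refl

    lineOf : ∀ {l v} → SameKind {S} {G} (inj₂ l) v → Line G
    lineOf (line-line {m = m}) = m

    lineOf≡ : ∀ {l v} (k : SameKind {S} {G} (inj₂ l) v) → inj₂ (lineOf k) ≡ v
    lineOf≡ line-line = refl

    point≡ : ∀ p → inj₁ (pointOf (F-kind (inj₁ p))) ≡ F (inj₁ p)
    point≡ p = pointOf≡ (F-kind (inj₁ p))

    line≡ : ∀ l → inj₂ (lineOf (F-kind (inj₂ l))) ≡ F (inj₂ l)
    line≡ l = lineOf≡ (F-kind (inj₂ l))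

  folding : Epimorphism S G
  folding = record
    { onPoint            = λ p → pointOf (F-kind (inj₁ p))
    ; onLine             = λ l → lineOf (F-kind (inj₂ l))
    ; preserves          = λ {p} {l} e → incident (subst₂ (Adj G) (sym (point≡ p)) (sym (line≡ l)) (F-incident e))
    ; onPoint-surjective = λ y → over-point y (F-surjective (inj₁ y))
    ; onLine-surjective  = λ m → over-line m (F-surjective (inj₂ m))
    }
    where
    over-point : ∀ y → (∃ λ x → F x ≡ inj₁ y) → ∃ λ p → pointOf (F-kind (inj₁ p)) ≡ y
    over-point y (inj₁ p , eq) = p , inj₁-injective (trans (point≡ p) eq)
    over-point y (inj₂ l , eq) = contradiction (trans (line≡ l) eq) λ ()
    over-line : ∀ m → (∃ λ x → F x ≡ inj₂ m) → ∃ λ l → lineOf (F-kind (inj₂ l)) ≡ m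
    over-line m (inj₂ l , eq) = l , inj₂-injective (trans (line≡ l) eq)
    over-line m (inj₁ p , eq) = contradiction (trans (point≡ p) eq) λ ()

  folding-classA : IsClassA s folding
  folding-classA = singleton-line⇒classA weakS weakG orderS orderG folding (ln 0)
    λ {l} {l′} l∈ l∈′ → trans (only-L l l∈) (sym (only-L l′ l∈′))
    where
    at-centre : ∀ x ys → Walk (Adj S) x (inj₂ L) ys → length ys ≤ 6 → image x ys ≡ c 0 → x ≡ inj₂ L
    at-centre x []       []      _  _  = refl
    at-centre x (y ∷ ys) (_ ∷ _) ≤6 eq = contradiction eq
      (place-≢0 (through-x₀ x (y ∷ ys)) (length (y ∷ ys)) (s≤s z≤n) ≤6)
    only-L : ∀ l → lineOf (F-kind (inj₂ l)) ≡ ln 0 → l ≡ L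
    only-L l l∈ = let ys , w , _ , ≤6 = geodesic (inj₂ l) in
      inj₂-injective (at-centre (inj₂ l) ys w ≤6 (trans (sym (line≡ l)) (cong inj₂ l∈)))

foldings : ∀ {S G s t} → IsWeakGeneralizedPolygon 6 S → IsThick S → HasOrder S s t →
  IsWeakGeneralizedPolygon 6 G → HasOrder G 1 1 → Σ (Epimorphism S G) (IsClassA s)
foldings weakS thick orderS weakG orderG
  with ln , pt , _ , C ← line-cycle-from weakG (IsWeakGeneralizedPolygon.somePoint (dual-isWeak weakG)) =
  folding weakS weakG orderS orderG thick ln pt C , folding-classA weakS weakG orderS orderG thick ln pt C

dual-foldings : ∀ {S G s t} → IsWeakGeneralizedPolygon 6 S → IsThick S → HasOrder S s t →
  IsWeakGeneralizedPolygon 6 G → HasOrder G 1 1 → Σ (Epimorphism S G) (IsClassB t)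
dual-foldings {S} {G} {t = t} weakS thick orderS weakG orderG = dualize
  (foldings (dual-isWeak weakS) (dual-thick {S} thick) (swap-order {S} orderS) (dual-isWeak weakG) (swap-order {G} orderG))
  where
  dualize : Σ (Epimorphism (dual S) (dual G)) (IsClassA t) → Σ (Epimorphism S G) (IsClassB t)
  dualize (Φ , classA) = dualEpimorphism Φ , classA

-- A criterion for weak generalized hexagons

module _ {V : Set} {_~_ : V → V → Set} (sym~ : ∀ {x y} → x ~ y → y ~ x) where

  walk-reverse : ∀ {x z ys} → Walk _~_ x z ys → ∃ λ zs → Walk _~_ z x zs × length zs ≡ length ys
  walk-reverse [] = [] , [] , refl
  walk-reverse (e ∷ w) with zs , v , eq ← walk-reverse w =
    _ , walk-snoc v (sym~ e) , trans (List.length-++ zs) (trans (+-comm (length zs) 1) (cong suc eq))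

  Diverge : List V → List V → Set
  Diverge as bs = ∀ {a as′ b bs′} → as ≡ a ∷ as′ → bs ≡ b ∷ bs′ → a ≢ b

  -- The first walk is reversed onto the second step by step; divergence at `x` keeps the result
  -- reduced there. The inclusions keep track of elements that the resulting polygon must contain.
  join-walks : ∀ {x y z} as bs → Walk _~_ x y as → Walk _~_ x z bs →
    Reduced (x ∷ as) → Reduced (x ∷ bs) → Diverge as bs →
    ∃ λ cs → Walk _~_ y z cs × Reduced (y ∷ cs) × length cs ≡ length as + length bs ×
      (∀ {v} → v ∈ x ∷ as → v ∈ y ∷ cs) × (∀ {v} → v ∈ bs → v ∈ cs)
  join-walks [] bs [] w _ r _ = bs , w , r , refl , (λ { (here eq) → here eq }) , id
  join-walks {x} (a ∷ as) bs (e ∷ v) w r r′ a≢b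
    with join-walks as (x ∷ bs) v (sym~ e ∷ w) (reduced-tail _ r) (extend bs r′ a≢b) (turn as r)
    where
    extend : ∀ bs → Reduced (x ∷ bs) → Diverge (a ∷ as) bs → Reduced (a ∷ x ∷ bs)
    extend []      _ _ = tt
    extend (b ∷ _) r f = f refl refl , r
    turn : ∀ as → Reduced (x ∷ a ∷ as) → Diverge as (x ∷ bs)
    turn (_ ∷ _) (x≢a′ , _) refl refl = x≢a′ ∘ sym
  ... | cs , u , r″ , len , as⊆ , bs⊆ = cs , u , r″ , trans len (+-suc (length as) (length bs))
      , (λ { (here refl) → there (bs⊆ (here refl)) ; (there v∈) → as⊆ v∈ }) , bs⊆ ∘ there

isPoint : ∀ {G} → Element G → Bool
isPoint (inj₁ _) = true
isPoint (inj₂ _) = false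

flips : ℕ → Bool → Bool
flips zero    b = b
flips (suc n) b = flips n (not b)

-- Walks between the same ends have lengths of equal parity; in `close-up` this lowers the bound 6
-- beside a walk of length 7 to 5.
walk-kind : ∀ {G x z ys} → Walk (Adj G) x z ys → isPoint {G} z ≡ flips (length ys) (isPoint {G} x)
walk-kind []           = refl
walk-kind (up _ ∷ w)   = walk-kind w
walk-kind (down _ ∷ w) = walk-kind w

module HexagonCriterion {G : Geometry} {s t : ℕ} (_≟_ : DecidableEquality (Element G))
  (order : HasOrder G s t) (1≤s : 1 ≤ s) (1≤t : 1 ≤ t)
  (no-small : ∀ k → 2 ≤ k → k < 6 → ¬ OrdinarySubgon G k)
  (distance≤5 : ∀ p l → ∃ λ ys → Walk (Adj G) (inj₁ p) (inj₂ l) ys × length ys ≤ 5) where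

  private
    a-nbr : ∀ x → ∃ λ y → Adj G x y
    a-nbr x = let y , _ , e , _ = two-nbrs order 1≤s 1≤t x in y , e

    distance≤6 : ∀ x y → ∃ λ ys → Walk (Adj G) x y ys × length ys ≤ 6
    distance≤6 (inj₁ p) (inj₂ l) = let ys , w , ≤5 = distance≤5 p l in ys , w , m≤n⇒m≤1+n ≤5
    distance≤6 (inj₂ l) (inj₁ p) =
      let _ , w , ≤5 = distance≤5 p l
          zs , v , eq = walk-reverse adj-sym w in zs , v , subst (_≤ 6) (sym eq) (m≤n⇒m≤1+n ≤5)
    distance≤6 (inj₁ p) (inj₁ q) with a-nbr (inj₁ q)
    ... | inj₂ l , up e = let ys , w , ≤5 = distance≤5 p l in
      _ , walk-snoc w (down e) , subst (_≤ 6) (sym (trans (List.length-++ ys) (+-comm (length ys) 1))) (s≤s ≤5)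
    distance≤6 (inj₂ l) (inj₂ m) with a-nbr (inj₂ l)
    ... | inj₁ p , down e = let ys , w , ≤5 = distance≤5 p m in _ , down e ∷ w , s≤s ≤5

    reduced≤6 : ∀ x y → ∃ λ ys → Walk (Adj G) x y ys × Reduced (x ∷ ys) × length ys ≤ 6
    reduced≤6 x y with distance≤6 x y
    ... | ys , w , ≤6 with reduce _≟_ w
    ...   | inj₁ r = ys , w , r , ≤6
    ...   | inj₂ (zs , v , r , le) = zs , v , r , ≤-trans (m≤n+m (length zs) 2) (≤-trans le ≤6)

    -- The walk is prolonged before its start, so it still ends in `y` and passes through `x`.
    grow : ∀ n {x y ys} → Walk (Adj G) x y ys → Reduced (x ∷ ys) →
      ∃₂ λ z zs → Walk (Adj G) z y zs × Reduced (z ∷ zs) × length zs ≡ n + length ys × x ∈ z ∷ zs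
    grow zero    w r = _ , _ , w , r , refl , here refl
    grow (suc n) {x} {y} {ys} w r with grow n w r
    ... | z , [] , [] , _ , len , x∈ = let z′ , e = a-nbr z in
      z′ , z ∷ [] , adj-sym e ∷ [] , tt , cong suc len , there x∈
    ... | z , a ∷ zs , d ∷ v , r′ , len , x∈ with another-nbr _≟_ order 1≤s 1≤t a (adj-sym d)
    ...   | z′ , e , a≢z′ = z′ , z ∷ a ∷ zs , adj-sym e ∷ d ∷ v , (≢-sym a≢z′ , r′) , cong suc len , there x∈

    girth>11′ : Girth> {_~_ = Adj G} 11
    girth>11′ = no-small-subgon⇒girth _≟_ no-small

    Twelvegon : Element G → Element G → Set
    Twelvegon u v = ∃ λ cs → Walk (Adj G) v v cs × Unique cs × length cs ≡ 12 × u ∈ cs × v ∈ cs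

    -- After a common first step, walks of lengths 6 and at most 5 would remain, which the girth
    -- makes equal.
    diverge : ∀ {x v as bs} → Walk (Adj G) x v as → Walk (Adj G) x v bs → Reduced (x ∷ as) → Reduced (x ∷ bs) →
      length as ≡ 7 → length bs ≤ 6 → Diverge {_~_ = Adj G} adj-sym as bs
    diverge (_∷_ {ys = as} _ α) (_∷_ {ys = bs} _ β) r r′ len ≤6 refl refl refl = contradiction
      (cong length as≡bs) λ eq → <⇒≱ (≤-reflexive (trans (sym len) (cong suc eq))) ≤6
      where
      as≡bs : as ≡ bs
      as≡bs = reduced-walk-unique adj-sym girth>11′ _≟_ as bs α β (reduced-tail _ r) (reduced-tail _ r′)
        (subst (λ n → n + length bs ≤ 11) (sym (suc-injective len)) (+-monoʳ-≤ 6 (s≤s⁻¹ ≤6)))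

    -- A reduced walk of length 7 and a shorter one between the same ends
    -- diverge at both ends and so close up to a cycle of length 12.
    close-up : ∀ {x u v as bs} → Walk (Adj G) x v as → Reduced (x ∷ as) → length as ≡ 7 → u ∈ x ∷ as →
      Walk (Adj G) x v bs → Reduced (x ∷ bs) → length bs ≤ 6 → Twelvegon u v
    close-up {x} {u} {v} {as} {bs} α r len u∈ β r′ ≤6 =
      twelve (join-walks adj-sym as bs α β r r′ (diverge α β r r′ len ≤6))
      where
      ≤5 : length bs ≤ 5
      ≤5 = s≤s⁻¹ (≤∧≢⇒< ≤6 λ eq → not-fixed (isPoint {G} x) (trans
          (sym (subst (λ n → isPoint {G} v ≡ flips n (isPoint {G} x)) len (walk-kind α)))
          (subst (λ n → isPoint {G} v ≡ flips n (isPoint {G} x)) eq (walk-kind β))))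
        where
        not-fixed : ∀ b → flips 7 b ≢ flips 6 b
        not-fixed true ()
        not-fixed false ()
      twelve : (∃ λ cs → Walk (Adj G) v v cs × Reduced (v ∷ cs) × length cs ≡ length as + length bs ×
          (∀ {w} → w ∈ x ∷ as → w ∈ v ∷ cs) × (∀ {w} → w ∈ bs → w ∈ cs)) → Twelvegon u v
      twelve ([] , [] , _ , eq , _) = contradiction (trans eq (cong (_+ length bs) len)) λ ()
      twelve (c ∷ cs , e ∷ γ , r″ , eq , as⊆ , _) = c ∷ cs , e ∷ γ , unique , ≡12 , shift-in (as⊆ u∈) , v∈
        where
        ≤12 : suc (length cs) ≤ 12
        ≤12 = subst (_≤ 12) (sym (trans eq (cong (_+ length bs) len))) (+-monoʳ-≤ 7 ≤5)
        ≡12 : suc (length cs) ≡ 12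
        ≡12 = ≤-antisym ≤12 (≰⇒> (girth>11′ (e ∷ γ) r″ (s≤s z≤n)))
        unique : Unique (c ∷ cs)
        -- Without its first step the closed walk has length 11, so a repetition would produce a
        -- cycle of length at most 11.
        unique with unique⊎cycle _≟_ γ (reduced-tail (c ∷ cs) r″)
        ... | inj₁ u = u
        ... | inj₂ cycle = contradiction (subst (Cycle≤ {_~_ = Adj G} _≟_) (suc-injective ≡12) cycle)
          (no-small-subgon⇒no-cycle _≟_ no-small)
        v∈ : v ∈ c ∷ cs
        v∈ with end-∈ (e ∷ γ)
        ... | inj₂ v∈ = v∈
        shift-in : u ∈ v ∷ c ∷ cs → u ∈ c ∷ cs
        shift-in (here refl) = v∈
        shift-in (there u∈)  = u∈

    twelvegon : ∀ u v → Twelvegon u v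
    twelvegon u v with reduced≤6 u v
    -- Length 7 exceeds the bound 6 on distances, so a second, shorter walk between the ends exists.
    ... | ys , w , r , ≤6 with grow (7 ∸ length ys) w r
    ...   | x , as , α , r′ , len , u∈ with reduced≤6 x v
    ...     | bs , β , r″ , ≤6′ = close-up α r′ (trans len (m∸n+n≡m (m≤n⇒m≤1+n ≤6))) u∈ β r″ ≤6′

  isWeakHexagon : Point G → IsWeakGeneralizedPolygon 6 G
  isWeakHexagon p = record
    { somePoint     = p
    ; commonSubgon  = common
    ; noSmallSubgon = no-small
    }
    where
    common : ∀ u v → Σ (OrdinarySubgon G 6) λ Δ → OrdinarySubgon.Contains Δ u × OrdinarySubgon.Contains Δ v
    common u v with twelvegon u v
    ... | cs , γ , cs! , ≡12 , u∈ , v∈ with closed-walk⇒polygon γ (subst (1 ≤_) (sym ≡12) (s≤s z≤n)) cs!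
    ...   | k , Δ , len , contains with *-cancelʳ-≡ k 6 2 (trans (sym len) ≡12)
    ...     | refl = Δ , contains u∈ , contains v∈

-- Hexagons whose incidence graph is a cycle with chords

vertices≢ : ∀ {G k} (Δ : OrdinarySubgon G k) {i j} → i ≢ j →
  _≢_ {A = Element G} (inj₁ (OrdinarySubgon.vertex Δ i)) (inj₁ (OrdinarySubgon.vertex Δ j))
vertices≢ Δ i≢j = i≢j ∘ OrdinarySubgon.vertex-injective Δ ∘ inj₁-injective

sides≢ : ∀ {G k} (Δ : OrdinarySubgon G k) {i j} → i ≢ j →
  _≢_ {A = Element G} (inj₂ (OrdinarySubgon.side Δ i)) (inj₂ (OrdinarySubgon.side Δ j))
sides≢ Δ i≢j = i≢j ∘ OrdinarySubgon.side-injective Δ ∘ inj₂-injective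

-- On the cycle point 0, line 0, point 1, line 1, … of length 2 (m + 1), a and b
-- list the lines on a point and the points on a line by the difference of indices.
module ChordedCycle (m : ℕ) (a b : ℕ → List ℕ) where
  private
    n = suc m

  linesOn pointsOn : Fin n → List (Fin n)
  linesOn  i = map (λ d → (toℕ i + d) mod n) (a (toℕ i))
  pointsOn j = map (λ d → (toℕ j + d) mod n) (b (toℕ j))

  chorded : Geometry
  chorded = record { Point = Fin n ; Line = Fin n ; _I_ = λ i j → j ∈ linesOn i }

  Consistent : (Fin n → List (Fin n)) → (Fin n → List (Fin n)) → ℕ → Set
  Consistent f g k = ∀ i → Unique (f i) × length (f i) ≡ k × All (λ j → i ∈ g j) (f i)

  consistent? : ∀ f g k → Dec (Consistent f g k)
  consistent? f g k = Fin.all? λ i → unique? (f i) ×-dec length (f i) ℕ.≟ k ×-dec All.all? (λ j → i ∈? g j) (f i)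
    where
    open import Data.List.Membership.DecPropositional (Fin._≟_ {n}) using (_∈?_)
    open import Data.List.Relation.Unary.Unique.DecPropositional (Fin._≟_ {n}) using (unique?)

  module _ {s t} (lines✓ : Consistent linesOn pointsOn (suc t)) (points✓ : Consistent pointsOn linesOn (suc s)) where

    order : HasOrder chorded s t
    order =
      (λ j → let u , len , all = points✓ j in
        subst (HasCardinality (λ i → j ∈ linesOn i)) len
          (hasCardinality (pointsOn j) u (All.lookup all) (λ {i} j∈ → All.lookup (proj₂ (proj₂ (lines✓ i))) j∈))) ,
      (λ i → let u , len , _ = lines✓ i in
        subst (HasCardinality (λ j → j ∈ linesOn i)) len (hasCardinality (linesOn i) u id id))

    _≟_ : DecidableEquality (Element chorded)
    _≟_ = Sum.≡-dec Fin._≟_ Fin._≟_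

    -- The explicit lists are used instead of those extracted from `order`, because the paths over
    -- `Γ` get evaluated.
    Γ : LocallyFinite (Adj chorded)
    Γ = record { _≟_ = _≟_ ; nbrs = nbrs ; nbrs-unique = nbrs-unique ; nbrs⁺ = nbrs⁺ ; nbrs⁻ = nbrs⁻ }
      where
      nbrs : Element chorded → List (Element chorded)
      nbrs (inj₁ i) = map inj₂ (linesOn i)
      nbrs (inj₂ j) = map inj₁ (pointsOn j)

      nbrs-unique : ∀ x → Unique (nbrs x)
      nbrs-unique (inj₁ i) = Unique.map⁺ inj₂-injective (proj₁ (lines✓ i))
      nbrs-unique (inj₂ j) = Unique.map⁺ inj₁-injective (proj₁ (points✓ j))

      nbrs⁺ : ∀ {x y} → Adj chorded x y → y ∈ nbrs x
      nbrs⁺ (up e)               = ∈-map⁺ inj₂ e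
      nbrs⁺ (down {x = i} e)     = ∈-map⁺ inj₁ (All.lookup (proj₂ (proj₂ (lines✓ i))) e)

      nbrs⁻ : ∀ {x y} → y ∈ nbrs x → Adj chorded x y
      nbrs⁻ {inj₁ i} y∈ with _ , j∈ , refl ← ∈-map⁻ inj₂ y∈ = up j∈
      nbrs⁻ {inj₂ j} y∈ with _ , i∈ , refl ← ∈-map⁻ inj₁ y∈ = down (All.lookup (proj₂ (proj₂ (points✓ j))) i∈)

    open LabelledPaths Γ Unit._≟_ (λ _ → tt) using (paths; paths⁺; paths⁻)

    oddPaths : Element chorded → List (List (Element chorded))
    oddPaths x = paths x x (tt ∷ []) ++ paths x x (tt ∷ tt ∷ tt ∷ []) ++ paths x x (tt ∷ tt ∷ tt ∷ tt ∷ tt ∷ [])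

    -- Plain numbers are cheap to compare in the evaluated checks. The value `n` for points is not
    -- the index of any line.
    code : Element chorded → ℕ
    code (inj₁ _) = n
    code (inj₂ j) = toℕ j

    code-line : ∀ {z} j → toℕ j ≡ code z → z ≡ inj₂ j
    code-line {inj₁ _} j eq = contradiction eq (<⇒≢ (Fin.toℕ<n j))
    code-line {inj₂ _} j eq = cong inj₂ (sym (Fin.toℕ-injective eq))

    endCode : Element chorded → List (Element chorded) → ℕ
    endCode x []       = code x
    endCode x (y ∷ ys) = endCode y ys

    endCode-walk : ∀ {x z ys} → Walk (Adj chorded) x z ys → endCode x ys ≡ code z
    endCode-walk []      = refl
    endCode-walk (_ ∷ w) = endCode-walk w

    endCodes : Fin n → List ℕ
    endCodes i = map (endCode (inj₁ i)) (oddPaths (inj₁ i))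

    -- Each line ends exactly one non-backtracking walk of length 1, 3 or 5 from the point `i`.
    -- Covering all lines bounds distances by 5, and uniqueness excludes small polygons. For order
    -- (2, 2) this is the count 3 + 12 + 48 = 63.
    Moore : Fin n → Set
    Moore i = Unique (endCodes i) × (∀ (j : Fin n) → toℕ j ∈ endCodes i)

    moore? : ∀ i → Dec (Moore i)
    moore? i = all-lines-once? (endCodes i)
      where
      open import Data.List.Membership.DecPropositional ℕ._≟_ using (_∈?_)
      open import Data.List.Relation.Unary.Unique.DecPropositional ℕ._≟_ using (unique?)
      -- The argument is shared by all the membership tests.
      all-lines-once? : ∀ ks → Dec (Unique ks × (∀ (j : Fin n) → toℕ j ∈ ks))
      all-lines-once? ks = unique? ks ×-dec Fin.all? (λ j → toℕ j ∈? ks)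

    module _ (moore : ∀ i → Moore i) where

      paths⁻≤5 : ∀ {x ys} us → length us ≤ 5 → ys ∈ paths x x us → ∃ λ z → Walk (Adj chorded) x z ys × length ys ≤ 5
      paths⁻≤5 {ys = ys} us ≤5 ys∈ with paths⁻ us ys∈
      ... | (z , w) , _ , refl = z , w , subst (_≤ 5) (List.length-map (λ _ → tt) ys) ≤5

      oddPaths⁻ : ∀ {x ys} → ys ∈ oddPaths x → ∃ λ z → Walk (Adj chorded) x z ys × length ys ≤ 5
      oddPaths⁻ {x} ys∈ with ∈-++⁻ (paths x x (tt ∷ [])) ys∈
      ... | inj₁ ys∈₁ = paths⁻≤5 (tt ∷ []) (s≤s z≤n) ys∈₁
      ... | inj₂ ys∈′ with ∈-++⁻ (paths x x (tt ∷ tt ∷ tt ∷ [])) ys∈′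
      ...   | inj₁ ys∈₃ = paths⁻≤5 (tt ∷ tt ∷ tt ∷ []) (s≤s (s≤s (s≤s z≤n))) ys∈₃
      ...   | inj₂ ys∈₅ = paths⁻≤5 (tt ∷ tt ∷ tt ∷ tt ∷ tt ∷ []) ≤-refl ys∈₅

      oddPaths⁺ : ∀ {i j ys} → Walk (Adj chorded) (inj₁ i) (inj₂ j) ys → Reduced (inj₁ i ∷ ys) → length ys ≤ 5 →
        ys ∈ oddPaths (inj₁ i)
      oddPaths⁺ w@(up _ ∷ []) r _ = ∈-++⁺ˡ (paths⁺ w ((λ ()) , r))
      oddPaths⁺ {i} w@(up _ ∷ down _ ∷ up _ ∷ []) r _ =
        ∈-++⁺ʳ (paths (inj₁ i) (inj₁ i) (tt ∷ [])) (∈-++⁺ˡ (paths⁺ w ((λ ()) , r)))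
      oddPaths⁺ {i} w@(up _ ∷ down _ ∷ up _ ∷ down _ ∷ up _ ∷ []) r _ =
        ∈-++⁺ʳ (paths (inj₁ i) (inj₁ i) (tt ∷ [])) (∈-++⁺ʳ (paths (inj₁ i) (inj₁ i) (tt ∷ tt ∷ tt ∷ []))
          (paths⁺ w ((λ ()) , r)))
      oddPaths⁺ (up _ ∷ down _ ∷ up _ ∷ down _ ∷ up _ ∷ down _ ∷ up _ ∷ _) _ (s≤s (s≤s (s≤s (s≤s (s≤s ())))))

      short-unique : ∀ {i j ys zs} → Walk (Adj chorded) (inj₁ i) (inj₂ j) ys → Walk (Adj chorded) (inj₁ i) (inj₂ j) zs →
        Reduced (inj₁ i ∷ ys) → Reduced (inj₁ i ∷ zs) → length ys ≤ 5 → length zs ≤ 5 → ys ≡ zs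
      short-unique {i} v w r r′ ≤5 ≤5′ = unique-map⇒injective (endCode (inj₁ i)) (proj₁ (moore i))
        (oddPaths⁺ v r ≤5) (oddPaths⁺ w r′ ≤5′) (trans (endCode-walk v) (sym (endCode-walk w)))

      distance≤5 : ∀ i j → ∃ λ ys → Walk (Adj chorded) (inj₁ i) (inj₂ j) ys × length ys ≤ 5
      distance≤5 i j with ∈-map⁻ (endCode (inj₁ i)) (proj₂ (moore i) j)
      ... | ys , ys∈ , eq with oddPaths⁻ ys∈
      ...   | z , w , ≤5 with code-line {z} j (trans eq (endCode-walk w))
      ...     | refl = ys , w , ≤5

      -- A polygon with at most five sides splits into two different arcs of odd length at most 5
      -- from a vertex to a side.
      no-small : ∀ k → 2 ≤ k → k < 6 → ¬ OrdinarySubgon chorded k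
      no-small 0 () _ _
      no-small 1 (s≤s ()) _ _
      no-small 2 _ _ Δ = contradiction (short-unique
          (up (next-I-side 1F) ∷ [])
          (up (vertex-I-side 0F) ∷ down (next-I-side 0F) ∷ up (vertex-I-side 1F) ∷ [])
          tt (vertices≢ Δ (λ ()) , sides≢ Δ (λ ()) , tt)
          (s≤s z≤n) (s≤s (s≤s (s≤s z≤n)))) λ ()
        where
        open OrdinarySubgon Δ
      no-small 3 _ _ Δ = contradiction (short-unique
          (up (vertex-I-side 0F) ∷ down (next-I-side 0F) ∷ up (vertex-I-side 1F) ∷ [])
          (up (next-I-side 2F) ∷ down (vertex-I-side 2F) ∷ up (next-I-side 1F) ∷ [])
          (vertices≢ Δ (λ ()) , sides≢ Δ (λ ()) , tt)
          (vertices≢ Δ (λ ()) , sides≢ Δ (λ ()) , tt)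
          (s≤s (s≤s (s≤s z≤n))) (s≤s (s≤s (s≤s z≤n))))
          (sides≢ Δ (λ ()) ∘ List.∷-injectiveˡ)
        where
        open OrdinarySubgon Δ
      no-small 4 _ _ Δ = contradiction (short-unique
          (up (vertex-I-side 0F) ∷ down (next-I-side 0F) ∷ up (vertex-I-side 1F) ∷
           down (next-I-side 1F) ∷ up (vertex-I-side 2F) ∷ [])
          (up (next-I-side 3F) ∷ down (vertex-I-side 3F) ∷ up (next-I-side 2F) ∷ [])
          (vertices≢ Δ (λ ()) , sides≢ Δ (λ ()) ,
           vertices≢ Δ (λ ()) , sides≢ Δ (λ ()) , tt)
          (vertices≢ Δ (λ ()) , sides≢ Δ (λ ()) , tt)
          ≤-refl (s≤s (s≤s (s≤s z≤n)))) λ ()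
        where
        open OrdinarySubgon Δ
      no-small 5 _ _ Δ = contradiction (short-unique
          (up (vertex-I-side 0F) ∷ down (next-I-side 0F) ∷ up (vertex-I-side 1F) ∷
           down (next-I-side 1F) ∷ up (vertex-I-side 2F) ∷ [])
          (up (next-I-side 4F) ∷ down (vertex-I-side 4F) ∷ up (next-I-side 3F) ∷
           down (vertex-I-side 3F) ∷ up (next-I-side 2F) ∷ [])
          (vertices≢ Δ (λ ()) , sides≢ Δ (λ ()) ,
           vertices≢ Δ (λ ()) , sides≢ Δ (λ ()) , tt)
          (vertices≢ Δ (λ ()) , sides≢ Δ (λ ()) ,
           vertices≢ Δ (λ ()) , sides≢ Δ (λ ()) , tt)
          ≤-refl ≤-refl)
          (sides≢ Δ (λ ()) ∘ List.∷-injectiveˡ)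
        where
        open OrdinarySubgon Δ
      no-small (suc (suc (suc (suc (suc (suc _)))))) _ (s≤s (s≤s (s≤s (s≤s (s≤s (s≤s ())))))) _

      isWeak : 1 ≤ s → 1 ≤ t → IsWeakGeneralizedPolygon 6 chorded
      isWeak 1≤s 1≤t = HexagonCriterion.isWeakHexagon _≟_ order 1≤s 1≤t no-small distance≤5 zero

-- The ordinary hexagon and a thick hexagon of order (2, 2)

at-least-of-cardinality : ∀ {P : A → Set} {k} → HasCardinality P k → AtLeast k P
at-least-of-cardinality (h , inj , h∈ , _) = h , inj , h∈

¬thick-of-order-1 : ∀ {G u} → Point G → HasOrder G u 1 → ¬ IsThick G
¬thick-of-order-1 p (_ , lines) (thick , _) = <⇒≱ ≤-refl (at-least-≤ (thick p) (lines p))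

-- The cycle of length 12 without chords; 5 is -1 modulo 6.
module Hexagon₁ where
  open ChordedCycle 5 (λ _ → 0 ∷ 5 ∷ []) (λ _ → 0 ∷ 1 ∷ []) public

  lines✓ : Consistent linesOn pointsOn 2
  lines✓ = toWitness {a? = consistent? linesOn pointsOn 2} tt

  points✓ : Consistent pointsOn linesOn 2
  points✓ = toWitness {a? = consistent? pointsOn linesOn 2} tt

  moore : ∀ i → Moore lines✓ points✓ i
  moore = toWitness {a? = Fin.all? (moore? lines✓ points✓)} tt

  isThinHexagon : IsThinHexagon chorded 1
  isThinHexagon = record
    { isWeak   = isWeak lines✓ points✓ moore ≤-refl ≤-refl
    ; isThin   = ¬thick-of-order-1 {chorded} zero (order lines✓ points✓)
    ; hasOrder = order lines✓ points✓
    ; 1≤s′     = ≤-refl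
    }

-- The incidence graph is Tutte's 12-cage, with LCF notation
-- [17, 27, −13, −59, −35, 35, −11, 13, −53, 53, −27, 21, 57, 11, −21, −57, 59, −17]⁷:
-- an entry x at an even position gives chord₁ = (x − 1) / 2 and one at an odd
-- position gives chord₂ = (x + 1) / 2, both modulo 63.
module Hexagon₂ where
  chord₁ chord₂ : ℕ → ℕ
  chord₁ 0 = 8
  chord₁ 1 = 56
  chord₁ 2 = 45
  chord₁ 3 = 57
  chord₁ 4 = 36
  chord₁ 5 = 49
  chord₁ 6 = 28
  chord₁ 7 = 52
  chord₁ _ = 29
  chord₂ 0 = 14
  chord₂ 1 = 34
  chord₂ 2 = 18
  chord₂ 3 = 7
  chord₂ 4 = 27
  chord₂ 5 = 11
  chord₂ 6 = 6
  chord₂ 7 = 35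
  chord₂ _ = 55

  open ChordedCycle 62 (λ i → 0 ∷ 62 ∷ chord₁ (i % 9) ∷ []) (λ j → 0 ∷ 1 ∷ chord₂ (j % 9) ∷ []) public

  lines✓ : Consistent linesOn pointsOn 3
  lines✓ = toWitness {a? = consistent? linesOn pointsOn 3} tt

  points✓ : Consistent pointsOn linesOn 3
  points✓ = toWitness {a? = consistent? pointsOn linesOn 3} tt

  -- Evaluating all 63 cases at once takes several times the memory.
  moore-block : ∀ (q : Fin 7) (r : Fin 9) → Moore lines✓ points✓ (Fin.combine q r)
  moore-block 0F = toWitness {a? = Fin.all? λ r → moore? lines✓ points✓ (Fin.combine {7} 0F r)} tt
  moore-block 1F = toWitness {a? = Fin.all? λ r → moore? lines✓ points✓ (Fin.combine {7} 1F r)} tt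
  moore-block 2F = toWitness {a? = Fin.all? λ r → moore? lines✓ points✓ (Fin.combine {7} 2F r)} tt
  moore-block 3F = toWitness {a? = Fin.all? λ r → moore? lines✓ points✓ (Fin.combine {7} 3F r)} tt
  moore-block 4F = toWitness {a? = Fin.all? λ r → moore? lines✓ points✓ (Fin.combine {7} 4F r)} tt
  moore-block 5F = toWitness {a? = Fin.all? λ r → moore? lines✓ points✓ (Fin.combine {7} 5F r)} tt
  moore-block 6F = toWitness {a? = Fin.all? λ r → moore? lines✓ points✓ (Fin.combine {7} 6F r)} tt

  moore : ∀ i → Moore lines✓ points✓ i
  moore i = let q , r , eq = Fin.combine-surjective {7} {9} i in subst (Moore lines✓ points✓) eq (moore-block q r)

  isFiniteThickHexagon : IsFiniteThickHexagon chorded 2 2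
  isFiniteThickHexagon = record
    { isFinite = (63 , ↔-id _) , (63 , ↔-id _)
    ; isWeak   = isWeak lines✓ points✓ moore (s≤s z≤n) (s≤s z≤n)
    ; isThick  = (λ x → at-least-of-cardinality (proj₂ (order lines✓ points✓) x))
               , (λ l → at-least-of-cardinality (proj₁ (order lines✓ points✓) l))
    ; hasOrder = order lines✓ points✓
    }

-- That both classes occur is shown over every finite thick hexagon; the last component exhibits
-- such a hexagon, so that this is not vacuous.
theorem5p1 : ( (S G : Geometry) (s t s′ : ℕ) →
    IsFiniteThickHexagon S s t → IsThinHexagon G s′ →
    (Φ : Epimorphism S G) →
    s′ ≡ 1 × (IsClassA s Φ ⊎ IsClassB t Φ) )
    ×
    ( (S : Geometry) (s t : ℕ) → IsFiniteThickHexagon S s t →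
    Σ Geometry λ G → IsThinHexagon G 1 ×
    (Σ (Epimorphism S G) λ Φ → IsClassA s Φ) ×
    (Σ (Epimorphism S G) λ Φ → IsClassB t Φ) )
    ×
    ( Σ Geometry λ S → ∃₂ λ s t → IsFiniteThickHexagon S s t )
theorem5p1 = epimorphism-classes , both-classes , Hexagon₂.chorded , 2 , 2 , Hexagon₂.isFiniteThickHexagon
  where
  module G = IsThinHexagon Hexagon₁.isThinHexagon
  both-classes : ∀ S s t → IsFiniteThickHexagon S s t → Σ Geometry λ G → IsThinHexagon G 1 ×
    (Σ (Epimorphism S G) λ Φ → IsClassA s Φ) × (Σ (Epimorphism S G) λ Φ → IsClassB t Φ)
  both-classes S s t hexagon = Hexagon₁.chorded , Hexagon₁.isThinHexagon ,
    foldings S.isWeak S.isThick S.hasOrder G.isWeak G.hasOrder ,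
    dual-foldings S.isWeak S.isThick S.hasOrder G.isWeak G.hasOrder
    where
    module S = IsFiniteThickHexagon hexagon
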